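{- Let $\lambda=(\lambda_1,\dots,\lambda_s)$ be a partition of $n$. Then, as polynomials in $w$, \[ \sum_{k=0}^na_{nk}(\lambda)q^{k(k-n)}H_{n-2k}(w\,|\,1/q)=[\lambda]_q!\,(q-1)^nq^{ -\mathsf{n}(\lambda')}\prod_{i=1}^s\sum_{\rho\vdash\lambda_i}\frac{2^{\ell(\rho)}T_\rho(w)}{z_\rho\prod_{j=1}^{\ell(\rho)}(q^{\rho_j}-1)}. \]
   Context: For a prime power $q$, $\mathfrak{u}_\lambda(\mathbb{F}_q)$ is the nilradical of the standard parabolic subalgebra of $\mathfrak{gl}_n(\mathbb{F}_q)$ with diagonal blocks of sizes $\lambda_1,\dots,\lambda_s$, and $a_{nk}(\lambda)=\#\{X\in\mathfrak{u}_\lambda(\mathbb{F}_q):X^2=0,\ \mathrm{rank}X=k\}$ (so $a_{nk}(\lambda)=0$ for $k>n/2$). The continuous $q$-Hermite polynomials are defined by $H_0(w|q)=1$, $H_m(w|q)=0$ for $m<0$, and $H_{m+1}(w|q)=2wH_m(w|q)+(q^m-1)H_{m-1}(w|q)$ for $m\ge0$. $T_m$ are Chebyshev polynomials of the first kind ($T_m(\cos\theta)=\cos(m\theta)$) and $T_\rho=T_{\rho_1}T_{\rho_2}\cdots$. $z_\rho=\prod_i i^{m_i}m_i!$ with $m_i$ the number of parts of $\rho$ equal to $i$. $[m]_q!=\prod_{j=1}^m\frac{q^j-1}{q-1}$, $[\lambda]_q!=\prod_i[\lambda_i]_q!$, $\lambda'$ the conjugate partition, $\mathsf{n}(\lambda)=\sum_i(i-1)\lambda_i$,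 $\ell(\rho)$ the number of parts. -}

module Defs where

open import Data.Nat as ℕ using (ℕ; zero; suc; _≤ᵇ_)
open import Data.Integer using (+_)
open import Data.Rational as ℚ using (ℚ; 0ℚ; 1ℚ; _/_)
open import Data.Fin using (Fin; toℕ)
open import Data.List as L using (List; []; _∷_; length; filter; map; concat; concatMap; allFin; upTo; foldr)
open import Data.List.Membership.Propositional using (_∈_)
open import Data.List.Relation.Unary.Unique.Propositional using (Unique)
open import Data.Bool using (Bool; true; false; _∧_; _∨_; not; if_then_else_; T)
open import Data.Product using (∃; _×_)
open import Relation.Binary.PropositionalEquality using (_≡_; _≢_)
open import Relation.Binary.Definitions using (DecidableEquality)
open import Relation.Nullary using (does; yes; no)
open import Algebra.Structures using (IsCommutativeRing)

record FiniteField : Set₁ where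
  field
    Carrier   : Set
    _+_ _*_   : Carrier → Carrier → Carrier
    -_        : Carrier → Carrier
    0# 1#     : Carrier
    isCommutativeRing : IsCommutativeRing _≡_ _+_ _*_ -_ 0# 1#
    0≢1       : 0# ≢ 1#
    inverse   : ∀ x → x ≢ 0# → ∃ λ y → (x * y) ≡ 1#
    _≟_       : DecidableEquality Carrier
    elements  : List Carrier
    complete  : ∀ x → x ∈ elements
    unique    : Unique elements

  order : ℕ
  order = length elements

allFuns : ∀ {A : Set} → List A → (n : ℕ) → List (Fin n → A)
allFuns xs zero    = (λ ()) ∷ []
allFuns xs (suc n) = concatMap (λ x → map (λ f → λ { Fin.zero → x ; (Fin.suc i) → f i }) (allFuns xs n)) xs

allLists : ∀ {A : Set} → List A → ℕ → List (List A)
allLists xs zero    = [] ∷ []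
allLists xs (suc L) = concatMap (λ x → map (x ∷_) (allLists xs L)) xs

sublists : ∀ {A : Set} → List A → List (List A)
sublists []       = [] ∷ []
sublists (x ∷ xs) = sublists xs L.++ map (x ∷_) (sublists xs)

allB : ∀ {A : Set} → (A → Bool) → List A → Bool
allB p = foldr (λ x b → p x ∧ b) true

maxℕ : List ℕ → ℕ
maxℕ = foldr ℕ._⊔_ 0

sumℕ : List ℕ → ℕ
sumℕ = foldr ℕ._+_ 0

module _ (F : FiniteField) where
  open FiniteField F

  Matrix : ℕ → Set
  Matrix n = Fin n → Fin n → Carrier

  eqB : Carrier → Carrier → Bool
  eqB x y = does (x ≟ y)

  sumF : ∀ {n} → (Fin n → Carrier) → Carrier
  sumF {n} f = foldr _+_ 0# (map f (allFin n))

  mulM : ∀ {n} → Matrix n → Matrix n → Matrix n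
  mulM X Y i j = sumF (λ l → X i l * Y l j)

  isZeroM : ∀ {n} → Matrix n → Bool
  isZeroM {n} X = allB (λ i → allB (λ j → eqB (X i j) 0#) (allFin n)) (allFin n)

  linIndep : ∀ {n} → List (Fin n → Carrier) → Bool
  linIndep {n} vs = allB check (allLists elements (length vs))
    where
    comb : List Carrier → List (Fin n → Carrier) → Fin n → Carrier
    comb (a ∷ as) (v ∷ ws) i = (a * v i) + comb as ws i
    comb _ _ i = 0#
    check : List Carrier → Bool
    check as = not (allB (λ i → eqB (comb as vs i) 0#) (allFin n)) ∨ allB (λ a → eqB a 0#) as

  column : ∀ {n} → Matrix n → Fin n → (Fin n → Carrier)
  column X j i = X i j

  rank : ∀ {n} → Matrix n → ℕ
  rank {n} X = maxℕ (map length (filter (λ s → T? (linIndep (map (column X) s))) (sublists (allFin n))))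
    where
    open import Relation.Nullary.Decidable using (Dec)
    open import Data.Bool.Properties using (T?)

  blockOf : List ℕ → ℕ → ℕ
  blockOf []       i = 0
  blockOf (l ∷ ls) i = if suc i ≤ᵇ l then 0 else suc (blockOf ls (i ℕ.∸ l))

  inNilradical : ∀ {n} → List ℕ → Matrix n → Bool
  inNilradical {n} λs X =
    allB (λ i → allB (λ j → (blockOf λs (toℕ i) ℕ.<ᵇ blockOf λs (toℕ j)) ∨ eqB (X i j) 0#) (allFin n)) (allFin n)

  a : (n k : ℕ) → List ℕ → ℕ
  a n k λs = length (filter (λ X → T? (inNilradical λs X ∧ isZeroM (mulM X X) ∧ (rank X ℕ.≡ᵇ k)))
                            (allFuns (allFuns elements n) n))
    where open import Data.Bool.Properties using (T?)

nonincreasing : List ℕ → Bool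
nonincreasing (x ∷ y ∷ xs) = (y ≤ᵇ x) ∧ nonincreasing (y ∷ xs)
nonincreasing _ = true

isPartitionB : List ℕ → ℕ → Bool
isPartitionB ρ m = allB (λ x → 1 ≤ᵇ x) ρ ∧ nonincreasing ρ ∧ (sumℕ ρ ℕ.≡ᵇ m)

IsPartition : List ℕ → ℕ → Set
IsPartition ρ m = T (isPartitionB ρ m)

partitions : ℕ → List (List ℕ)
partitions m = filter (λ ρ → T? (isPartitionB ρ m))
                      (concatMap (λ L → allLists (map suc (upTo m)) L) (upTo (suc m)))
  where open import Data.Bool.Properties using (T?)

conjugate : List ℕ → List ℕ
conjugate λs = map (λ j → length (filter (λ x → T? (suc j ≤ᵇ x)) λs)) (upTo (maxℕ λs))
  where open import Data.Bool.Properties using (T?)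

nStat : List ℕ → ℕ
nStat μ = go 0 μ
  where
  go : ℕ → List ℕ → ℕ
  go i []       = 0
  go i (x ∷ xs) = i ℕ.* x ℕ.+ go (suc i) xs

mult : ℕ → List ℕ → ℕ
mult i ρ = length (filter (λ x → T? (x ℕ.≡ᵇ i)) ρ)
  where open import Data.Bool.Properties using (T?)

z : List ℕ → ℕ
z ρ = foldr ℕ._*_ 1 (map (λ i → (suc i ℕ.^ mult (suc i) ρ) ℕ.* (mult (suc i) ρ) !) (upTo (sumℕ ρ)))
  where open import Data.Nat.Base using (_!)

ℕ→ℚ : ℕ → ℚ
ℕ→ℚ k = (+ k) / 1

-- total inverse (only ever applied to nonzero arguments here)
inv : ℚ → ℚ
inv p with p ℚ.≟ 0ℚ
... | yes _ = 0ℚ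
... | no p≢0 = ℚ.1/_ p {{ℚ.≢-nonZero p≢0}}

_^ℚ_ : ℚ → ℕ → ℚ
p ^ℚ zero  = 1ℚ
p ^ℚ suc k = p ℚ.* (p ^ℚ k)

prodℚ : List ℚ → ℚ
prodℚ = foldr ℚ._*_ 1ℚ

qFact : ℚ → ℕ → ℚ
qFact q m = prodℚ (map (λ j → ((q ^ℚ suc j) ℚ.- 1ℚ) ℚ.* inv (q ℚ.- 1ℚ)) (upTo m))

-- polynomials in w with rational coefficients (coefficient lists, constant first)

Poly : Set
Poly = List ℚ

coeff : Poly → ℕ → ℚ
coeff []       _       = 0ℚ
coeff (c ∷ p)  zero    = c
coeff (c ∷ p)  (suc i) = coeff p i

_≈ₚ_ : Poly → Poly → Set
p ≈ₚ r = ∀ i → coeff p i ≡ coeff r i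

_⊕_ : Poly → Poly → Poly
[] ⊕ r = r
p ⊕ [] = p
(a ∷ p) ⊕ (b ∷ r) = (a ℚ.+ b) ∷ (p ⊕ r)

scale : ℚ → Poly → Poly
scale c = map (c ℚ.*_)

shiftW : Poly → Poly
shiftW p = 0ℚ ∷ p

_⊗_ : Poly → Poly → Poly
[] ⊗ r = []
(a ∷ p) ⊗ r = scale a r ⊕ shiftW (p ⊗ r)

constP : ℚ → Poly
constP c = c ∷ []

sumP : List Poly → Poly
sumP = foldr _⊕_ []

prodP : List Poly → Poly
prodP = foldr _⊗_ (constP 1ℚ)

twoW : Poly → Poly
twoW p = scale (ℕ→ℚ 2) (shiftW p)

-- Chebyshev polynomials of the first kind (T_m(cos θ) = cos mθ), via the
-- standard recurrence T_0 = 1, T_1 = w, T_{m+2} = 2w T_{m+1} - T_m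
cheb : ℕ → Poly
cheb zero = constP 1ℚ
cheb (suc zero) = shiftW (constP 1ℚ)
cheb (suc (suc m)) = twoW (cheb (suc m)) ⊕ scale (ℚ.- 1ℚ) (cheb m)

chebP : List ℕ → Poly
chebP ρ = prodP (map cheb ρ)

-- continuous q-Hermite polynomials H_m(w | r):
-- H_0 = 1, H_{-1} = 0, H_{m+1} = 2w H_m + (r^m - 1) H_{m-1}
hermite : ℚ → ℕ → Poly
hermite r zero = constP 1ℚ
hermite r (suc zero) = twoW (constP 1ℚ)
hermite r (suc (suc m)) = twoW (hermite r (suc m)) ⊕ scale ((r ^ℚ suc m) ℚ.- 1ℚ) (hermite r m)

module _ (F : FiniteField) where
  open FiniteField F

  qℚ : ℚ
  qℚ = ℕ→ℚ order

  -- Σ_{k=0}^n a_{nk}(λ) q^{k(k-n)} H_{n-2k}(w | 1/q)   (H_m = 0 for m < 0)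
  lhs : ℕ → List ℕ → Poly
  lhs n λs = sumP (map term (upTo (suc n)))
    where
    hermTerm : ℕ → Poly
    hermTerm k = if (2 ℕ.* k) ≤ᵇ n then hermite (inv qℚ) (n ℕ.∸ 2 ℕ.* k) else []
    term : ℕ → Poly
    term k = scale (ℕ→ℚ (a F n k λs) ℚ.* inv (qℚ ^ℚ (k ℕ.* (n ℕ.∸ k)))) (hermTerm k)

  factor : ℕ → Poly
  factor m = sumP (map (λ ρ → scale (ℕ→ℚ (2 ℕ.^ length ρ) ℚ.*
                                     inv (ℕ→ℚ (z ρ) ℚ.* prodℚ (map (λ r → (qℚ ^ℚ r) ℚ.- 1ℚ) ρ)))
                                    (chebP ρ))
                       (partitions m))

  rhs : ℕ → List ℕ → Poly
  rhs n λs = scale (prodℚ (map (qFact qℚ) λs) ℚ.* ((qℚ ℚ.- 1ℚ) ^ℚ n) ℚ.* inv (qℚ ^ℚ nStat (conjugate λs)))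
                   (prodP (map factor λs))

{-# OPTIONS --safe #-}
-- Write H_m for H_m(w | 1/q) and φ_n(k) = q^(k(k−n)) H_{n−2k}. Both sides equal ∏ H_{λ_i}.
--
-- Left side. Build X column by column. Let A be the leading s × s corner at the start of a block and
-- k its rank. Every column of the block lies in ker A, which has dimension s − k and contains the span
-- of all earlier columns, since X² = 0. So if the earlier columns have rank r, then q^r choices keep
-- the rank and q^(s−k) − q^r raise it. The resulting operator
--   (T ψ)(r) = q^r ψ(r) + (q^(s−k) − q^r) ψ(r+1)
-- q-commutes with multiplication by q^(−r), and T φ_{n+1} is a combination of φ_n and φ_{n−1}; hence
-- (T^m φ_{s+m})(k) satisfies the three-term recurrence of φ_s(k) H_m in m.
--
-- Right side. h_m = Σ_ρ 2^ℓ(ρ) T_ρ / (z_ρ ∏ (q^ρ_j − 1)) is a complete homogeneous function of the power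
-- sums 2 T_j / (q^j − 1), so Newton's identities hold. They force (1 − 2wt + t²) h(qt) = h(t) for the
-- generating function h, which is the recurrence of H_m up to the factor ∏_{j≤m} (q^j − 1) q^(1−j).

module Submission where

open import Defs
open import Level using (0ℓ)
open import Function using (_∘_; id; case_of_)
open import Function.Bundles using (mk⇔)
open import Data.Bool using (Bool; true; false; if_then_else_; T; _∧_; _∨_; not)
open import Data.Bool.Properties using (T?)
open import Data.Empty using (⊥-elim)
open import Data.Fin using (Fin; zero; suc; toℕ)
open import Data.Integer as ℤ using (ℤ; +_; -[1+_]; _⊖_)
import Data.Integer.Properties as ℤₚ
open import Data.List as L using (List; []; _∷_; _++_; _∷ʳ_; map; concatMap; foldr; length; filter; allFin; upTo; applyUpTo; replicate)
import Data.List.Properties as Lₚ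
open import Data.List.Properties using (map-++; map-∘; map-cong; map-concatMap; concatMap-map; concatMap-cong; map-applyUpTo; map-tabulate; upTo-∷ʳ; length-++; length-map; length-replicate; ++-assoc; ++-identityʳ)
open import Data.List.Membership.Propositional using (_∈_; _∉_)
open import Data.List.Membership.Propositional.Properties using (∈-map⁺; ∈-map⁻; ∈-++⁻; ∈-++⁺ˡ; ∈-++⁺ʳ; ∈-filter⁺; ∈-filter⁻; ∈-allFin; ∈-concatMap⁺; ∈-concatMap⁻; ∈-upTo⁺; ∈-upTo⁻)
open import Data.List.Membership.Propositional.Properties.WithK using (unique∧set⇒bag)
open import Data.List.Relation.Binary.BagAndSetEquality using (∼bag⇒↭)
open import Data.List.Relation.Binary.Permutation.Propositional as Perm using (_↭_; ↭-trans; ↭-reflexive)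
open import Data.List.Relation.Unary.All as All using (All; []; _∷_)
import Data.List.Relation.Unary.All.Properties as Allₚ
open import Data.List.Relation.Unary.AllPairs using ([]; _∷_)
open import Data.List.Relation.Unary.Any as Any using (Any; here; there)
open import Data.List.Relation.Unary.Unique.Propositional using (Unique)
import Data.List.Relation.Unary.Unique.Propositional.Properties as Uniqueₚ
open import Data.Maybe using (Maybe; just; nothing)
open import Data.Nat as ℕ using (ℕ; zero; suc; _≤_; _<_; _≤ᵇ_; _<ᵇ_; _≡ᵇ_; _!)
import Data.Nat.Properties as ℕₚ
import Data.Nat.Solver as ℕSolver
open import Data.List.Membership.DecPropositional ℕ._≟_ using (_∈?_)
open import Data.Product using (_×_; _,_; proj₁; proj₂; ∃; Σ; map₂)
open import Data.Rational as ℚ using (ℚ; 0ℚ; 1ℚ)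
import Data.Rational.Properties as ℚₚ
open import Data.Rational.Solver using (module +-*-Solver)
import Data.Rational.Unnormalised as ℚᵘ
import Data.Rational.Unnormalised.Properties as ℚᵘₚ
open import Data.Sum using (_⊎_; inj₁; inj₂)
open import Data.Unit using (⊤; tt)
open import Data.Vec as V using (Vec; []; _∷_; lookup; tabulate; toList)
import Data.Vec.Properties as Vₚ
open import Relation.Binary.Definitions using (DecidableEquality)
open import Relation.Binary.PropositionalEquality as ≡ using (_≡_; _≢_; refl; sym; trans; cong; cong₂; subst)
open import Relation.Nullary using (Dec; yes; no; does; ¬_; contradiction)
open import Relation.Nullary.Decidable using (_×-dec_; map′)
open import Relation.Unary using (Decidable)
open import Algebra.Bundles using (CommutativeRing; CommutativeSemiring)
open import Algebra.Solver.Ring.AlmostCommutativeRing using (fromCommutativeRing; _-Raw-AlmostCommutative⟶_)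

-- Finite sums and enumerations

-- The obstacle on the left side is that the coefficients in the expansion of T φ_{n+1} depend on
-- the argument: with n = N + j, where N is the corner size minus its rank, the multiplier of
-- φ_{n-1}(r) is q^(-j) - q^(-r). The part q^(-r) does not pass through further applications of T,
-- and moving it past T^m leaves a remainder (1 - q^(-m)) T^(m-1); this remainder is the source of
-- the coefficient of H_{m-1}. The expansion itself is available only for 2r ≤ n, so ranks that
-- cannot occur must be kept out of the iteration. On the right side the prefactor is the product of
-- the normalising factors of the individual H_{λ_i}: [m]_q! (q-1)^m = ∏_{j≤m} (q^j - 1), and n(λ')
-- = Σ λ_i(λ_i - 1)/2 collects the powers q^(1-j). Both recurrences are established in a commutative
-- ring with an element p such that qp = 1, because they are applied to polynomials in w, where one
-- cannot divide.

unique-⊆⊇⇒↭ : ∀ {A : Set} {xs ys : List A} → Unique xs → Unique ys →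
             (∀ {x} → x ∈ xs → x ∈ ys) → (∀ {x} → x ∈ ys → x ∈ xs) → xs ↭ ys
unique-⊆⊇⇒↭ u v f g = ∼bag⇒↭ (unique∧set⇒bag u v (mk⇔ f g))

module Sum {c ℓ} (S : CommutativeSemiring c ℓ) where
  open CommutativeSemiring S renaming (refl to ≈-refl; sym to ≈-sym; trans to ≈-trans)
  open import Relation.Binary.Reasoning.Setoid setoid
  open import Algebra.Properties.CommutativeSemigroup +-commutativeSemigroup using (interchange; x∙yz≈y∙xz)

  ∑ : ∀ {A : Set} → List A → (A → Carrier) → Carrier
  ∑ xs f = foldr _+_ 0# (map f xs)

  -- Indicators replace filtered lists, so that the range of summation stays fixed and two sums can
  -- be exchanged.
  when : ∀ {P : Set} → Dec P → Carrier → Carrier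
  when d x = if does d then x else 0#

  when-yes : ∀ {P : Set} (d : Dec P) {x} → P → when d x ≈ x
  when-yes (yes _) p = ≈-refl
  when-yes (no ¬p) p = ⊥-elim (¬p p)

  when-no : ∀ {P : Set} (d : Dec P) {x} → ¬ P → when d x ≈ 0#
  when-no (yes p) ¬p = ⊥-elim (¬p p)
  when-no (no _)  ¬p = ≈-refl

  when-intro : ∀ {P : Set} (d : Dec P) {x} → (¬ P → x ≈ 0#) → x ≈ when d x
  when-intro (yes _) h = ≈-refl
  when-intro (no ¬p) h = h ¬p

  when-cong : ∀ {P Q : Set} (d : Dec P) (e : Dec Q) {x y} →
              (P → Q) → (Q → P) → (P → x ≈ y) → when d x ≈ when e y
  when-cong (yes p) e {x} f g h = ≈-trans (h p) (≈-sym (when-yes e (f p)))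
  when-cong (no ¬p) e f g h = ≈-sym (when-no e (¬p ∘ g))

  when-*ʳ : ∀ {P : Set} (d : Dec P) x y → when d x * y ≈ when d (x * y)
  when-*ʳ (yes _) x y = ≈-refl
  when-*ʳ (no _)  x y = zeroˡ y

  ∑-cong : ∀ {A : Set} (xs : List A) {f g : A → Carrier} →
           (∀ {x} → x ∈ xs → f x ≈ g x) → ∑ xs f ≈ ∑ xs g
  ∑-cong []       h = ≈-refl
  ∑-cong (x ∷ xs) h = +-cong (h (here refl)) (∑-cong xs (h ∘ there))

  ∑-cong′ : ∀ {A : Set} (xs : List A) {f g : A → Carrier} →
            (∀ x → f x ≈ g x) → ∑ xs f ≈ ∑ xs g
  ∑-cong′ xs h = ∑-cong xs (λ {x} _ → h x)

  ∑-zero : ∀ {A : Set} (xs : List A) {f : A → Carrier} →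
           (∀ {x} → x ∈ xs → f x ≈ 0#) → ∑ xs f ≈ 0#
  ∑-zero []       h = ≈-refl
  ∑-zero (x ∷ xs) h = ≈-trans (+-cong (h (here refl)) (∑-zero xs (h ∘ there))) (+-identityˡ 0#)

  when-× : ∀ {P Q : Set} (d : Dec P) (e : Dec Q) x → when (d ×-dec e) x ≈ when d (when e x)
  when-× (yes _) e x = ≈-refl
  when-× (no _)  e x = ≈-refl

  ∑-when : ∀ {A P : Set} (d : Dec P) (xs : List A) (f : A → Carrier) →
           ∑ xs (λ x → when d (f x)) ≈ when d (∑ xs f)
  ∑-when (yes _) xs f = ≈-refl
  ∑-when (no _)  xs f = ∑-zero xs (λ _ → ≈-refl)

  ∑-distrib-+ : ∀ {A : Set} (xs : List A) (f g : A → Carrier) →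
                ∑ xs (λ x → f x + g x) ≈ ∑ xs f + ∑ xs g
  ∑-distrib-+ []       f g = ≈-sym (+-identityˡ 0#)
  ∑-distrib-+ (x ∷ xs) f g =
    ≈-trans (+-congˡ (∑-distrib-+ xs f g)) (interchange (f x) (g x) (∑ xs f) (∑ xs g))

  *-distribˡ-∑ : ∀ {A : Set} (xs : List A) (f : A → Carrier) y →
                 y * ∑ xs f ≈ ∑ xs (λ x → y * f x)
  *-distribˡ-∑ []       f y = zeroʳ y
  *-distribˡ-∑ (x ∷ xs) f y = ≈-trans (distribˡ y (f x) (∑ xs f)) (+-congˡ (*-distribˡ-∑ xs f y))

  *-distribʳ-∑ : ∀ {A : Set} (xs : List A) (f : A → Carrier) y →
                 ∑ xs f * y ≈ ∑ xs (λ x → f x * y)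
  *-distribʳ-∑ []       f y = zeroˡ y
  *-distribʳ-∑ (x ∷ xs) f y = ≈-trans (distribʳ y (f x) (∑ xs f)) (+-congˡ (*-distribʳ-∑ xs f y))

  ∑-swap : ∀ {A B : Set} (xs : List A) (ys : List B) (f : A → B → Carrier) →
           ∑ xs (λ x → ∑ ys (f x)) ≈ ∑ ys (λ y → ∑ xs (λ x → f x y))
  ∑-swap []       ys f = ≈-sym (∑-zero ys (λ _ → ≈-refl))
  ∑-swap (x ∷ xs) ys f =
    ≈-trans (+-congˡ (∑-swap xs ys f)) (≈-sym (∑-distrib-+ ys (f x) (λ y → ∑ xs (λ x → f x y))))

  ∑-map : ∀ {A B : Set} (g : A → B) (xs : List A) (f : B → Carrier) →
          ∑ (map g xs) f ≈ ∑ xs (f ∘ g)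
  ∑-map g xs f = reflexive (cong (foldr _+_ 0#) (sym (map-∘ xs)))

  ∑-++ : ∀ {A : Set} (xs ys : List A) (f : A → Carrier) →
         ∑ (xs ++ ys) f ≈ ∑ xs f + ∑ ys f
  ∑-++ []       ys f = ≈-sym (+-identityˡ _)
  ∑-++ (x ∷ xs) ys f = ≈-trans (+-congˡ (∑-++ xs ys f)) (≈-sym (+-assoc _ _ _))

  ∑-concatMap : ∀ {A B : Set} (g : A → List B) (xs : List A) (f : B → Carrier) →
                ∑ (concatMap g xs) f ≈ ∑ xs (λ x → ∑ (g x) f)
  ∑-concatMap g []       f = ≈-refl
  ∑-concatMap g (x ∷ xs) f = ≈-trans (∑-++ (g x) (concatMap g xs) f) (+-congˡ (∑-concatMap g xs f))

  ∑-filter : ∀ {A : Set} {P : A → Set} (P? : Decidable P) (xs : List A) (f : A → Carrier) →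
             ∑ (filter P? xs) f ≈ ∑ xs (λ x → when (P? x) (f x))
  ∑-filter P? []       f = ≈-refl
  ∑-filter P? (x ∷ xs) f with does (P? x)
  ... | true  = +-congˡ (∑-filter P? xs f)
  ... | false = ≈-trans (∑-filter P? xs f) (≈-sym (+-identityˡ _))

  ∑-↭ : ∀ {A : Set} {xs ys : List A} (f : A → Carrier) → xs ↭ ys → ∑ xs f ≈ ∑ ys f
  ∑-↭ f Perm.refl         = ≈-refl
  ∑-↭ f (Perm.prep x p)   = +-congˡ (∑-↭ f p)
  ∑-↭ f (Perm.swap x y p) = ≈-trans (x∙yz≈y∙xz _ _ _) (+-congˡ (+-congˡ (∑-↭ f p)))
  ∑-↭ f (Perm.trans p r)  = ≈-trans (∑-↭ f p) (∑-↭ f r)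

  ∑-single : ∀ {A : Set} {xs : List A} {y : A} (f : A → Carrier) → Unique xs → y ∈ xs →
             (∀ {x} → x ∈ xs → x ≢ y → f x ≈ 0#) → ∑ xs f ≈ f y
  ∑-single {xs = x ∷ xs} f (x∉ ∷ u) (here refl) h =
    ≈-trans (+-congˡ (∑-zero xs (λ z∈ → h (there z∈) (λ z≡x → All.lookup x∉ z∈ (sym z≡x)))))
            (+-identityʳ _)
  ∑-single {xs = x ∷ xs} f (x∉ ∷ u) (there y∈) h =
    ≈-trans (+-cong (h (here refl) (All.lookup x∉ y∈)) (∑-single f u y∈ (h ∘ there)))
            (+-identityˡ _)

-- The first hypothesis recovers from an element the chunk it came from, hence chunks at distinct
-- arguments are disjoint.
concatMap-unique : ∀ {A B : Set} (f : A → List B) {xs : List A} →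
  (∀ {x x′ y} → y ∈ f x → y ∈ f x′ → x ≡ x′) → (∀ x → Unique (f x)) → Unique xs → Unique (concatMap f xs)
concatMap-unique f         key u []       = []
concatMap-unique f {x ∷ xs} key u (x∉ ∷ v) = Uniqueₚ.++⁺ (u x) (concatMap-unique f key u v)
  (λ (y∈ , y∈′) → let x≢ , y∈″ = All.lookupAny x∉ (∈-concatMap⁻ f {xs = xs} y∈′) in x≢ (key y∈ y∈″))

concatMap-∷-unique : ∀ {A B C : Set} (_∙_ : A → B → C) {xs : List A} {ys : List B} →
  (∀ {x x′ y y′} → x ∙ y ≡ x′ ∙ y′ → x ≡ x′ × y ≡ y′) →
  Unique xs → Unique ys → Unique (concatMap (λ x → map (x ∙_) ys) xs)
concatMap-∷-unique _∙_ {ys = ys} inj u v = concatMap-unique (λ x → map (x ∙_) ys)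
  (λ y∈ y∈′ → case ∈-map⁻ _ y∈ , ∈-map⁻ _ y∈′ of λ
    { ((_ , _ , refl) , (_ , _ , eq)) → proj₁ (inj eq) })
  (λ x → Uniqueₚ.map⁺ (proj₂ ∘ inj) v) u

-- Vectors stand in for the functions enumerated by `allFuns`: uniqueness and completeness of an
-- enumeration need an equality that pointwise equal entries imply, which functions do not have
-- here.
allVecs : ∀ {A : Set} → List A → (n : ℕ) → List (Vec A n)
allVecs xs zero    = [] ∷ []
allVecs xs (suc n) = concatMap (λ x → map (x ∷_) (allVecs xs n)) xs

allVecs-unique : ∀ {A : Set} {xs : List A} → Unique xs → ∀ n → Unique (allVecs xs n)
allVecs-unique u zero    = [] ∷ []
allVecs-unique u (suc n) = concatMap-∷-unique _∷_ Vₚ.∷-injective u (allVecs-unique u n)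

allVecs-complete : ∀ {A : Set} {xs : List A} → (∀ x → x ∈ xs) → ∀ {n} (v : Vec A n) → v ∈ allVecs xs n
allVecs-complete c []      = here refl
allVecs-complete {xs = xs} c (x ∷ v) =
  ∈-concatMap⁺ (λ x → map (x ∷_) (allVecs xs _)) (Any.map (λ { refl → ∈-map⁺ (x ∷_) (allVecs-complete c v) }) (c x))

map-tabulate-allFuns : ∀ {A : Set} (xs : List A) n → map V.tabulate (allFuns xs n) ≡ allVecs xs n
map-tabulate-allFuns xs zero    = refl
map-tabulate-allFuns xs (suc n) = begin
  map V.tabulate (concatMap _ xs) ≡⟨ map-concatMap V.tabulate _ xs ⟩
  concatMap _ xs  ≡⟨ concatMap-cong (λ x → trans (sym (map-∘ (allFuns xs n)))
                                       (trans (map-∘ (allFuns xs n)) (cong (map (x ∷_)) (map-tabulate-allFuns xs n)))) xs ⟩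
  concatMap (λ x → map (x ∷_) (allVecs xs n)) xs ∎
  where open ≡.≡-Reasoning

allVecs-map : ∀ {A B : Set} (h : A → B) (xs : List A) n → allVecs (map h xs) n ≡ map (V.map h) (allVecs xs n)
allVecs-map h xs zero    = refl
allVecs-map h xs (suc n) = begin
  concatMap (λ y → map (y ∷_) (allVecs (map h xs) n)) (map h xs)  ≡⟨ concatMap-map _ h xs ⟩
  concatMap (λ x → map (h x ∷_) (allVecs (map h xs) n)) xs
    ≡⟨ concatMap-cong (λ x → trans (cong (map (h x ∷_)) (allVecs-map h xs n))
          (trans (sym (map-∘ (allVecs xs n))) (map-∘ (allVecs xs n)))) xs ⟩
  concatMap (λ x → map (V.map h) (map (x ∷_) (allVecs xs n))) xs  ≡⟨ map-concatMap (V.map h) _ xs ⟨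
  map (V.map h) (concatMap (λ x → map (x ∷_) (allVecs xs n)) xs) ∎
  where open ≡.≡-Reasoning

-- A ring solver with integer coefficients for arbitrary commutative rings

module IntegerSolver {c ℓ} (R : CommutativeRing c ℓ) where
  open CommutativeRing R renaming (refl to ≈-refl; sym to ≈-sym; trans to ≈-trans)
  open import Relation.Binary.Reasoning.Setoid setoid
  open import Algebra.Properties.Semiring.Mult.TCOptimised semiring using (1+×; ×-homo-+; ×1-homo-*) renaming (_×_ to _⋆_)
  open import Algebra.Properties.Ring ring using (-‿distribˡ-*; -‿distribʳ-*; -0#≈0#; -‿involutive; -‿+-comm)
  open import Algebra.Properties.CommutativeSemigroup +-commutativeSemigroup using (interchange)

  -- Coefficients are integers because equality in the ring need not be decidable, while cancelling
  -- `x` against `- x` requires recognising the coefficient zero. With the optimised multiple, 1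
  -- denotes `1#` definitionally.
  ⟦_⟧ᶻ : ℤ → Carrier
  ⟦ + n ⟧ᶻ      = n ⋆ 1#
  ⟦ -[1+ n ] ⟧ᶻ = - (suc n ⋆ 1#)

  private
    ⊖-homo : ∀ m n → ⟦ m ⊖ n ⟧ᶻ ≈ m ⋆ 1# + - (n ⋆ 1#)
    ⊖-homo zero    zero    = ≈-sym (-‿inverseʳ _)
    ⊖-homo zero    (suc n) = ≈-sym (+-identityˡ _)
    ⊖-homo (suc m) zero    = ≈-sym (≈-trans (+-congˡ -0#≈0#) (+-identityʳ _))
    ⊖-homo (suc m) (suc n) = begin
      ⟦ suc m ⊖ suc n ⟧ᶻ  ≡⟨ cong ⟦_⟧ᶻ (ℤₚ.[1+m]⊖[1+n]≡m⊖n m n) ⟩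
      ⟦ m ⊖ n ⟧ᶻ  ≈⟨ ⊖-homo m n ⟩
      m ⋆ 1# + - (n ⋆ 1#)  ≈⟨ +-identityˡ _ ⟨
      0# + (m ⋆ 1# + - (n ⋆ 1#))  ≈⟨ +-congʳ (-‿inverseʳ 1#) ⟨
      (1# + - 1#) + (m ⋆ 1# + - (n ⋆ 1#))  ≈⟨ interchange _ _ _ _ ⟩
      (1# + m ⋆ 1#) + (- 1# + - (n ⋆ 1#))  ≈⟨ +-congˡ (-‿+-comm _ _) ⟩
      (1# + m ⋆ 1#) + - (1# + n ⋆ 1#)  ≈⟨ +-cong (1+× m 1#) (-‿cong (1+× n 1#)) ⟨
      suc m ⋆ 1# + - (suc n ⋆ 1#)  ∎

    +-homo : ∀ i j → ⟦ i ℤ.+ j ⟧ᶻ ≈ ⟦ i ⟧ᶻ + ⟦ j ⟧ᶻ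
    +-homo (+ m)      (+ n)      = ×-homo-+ 1# m n
    +-homo (+ m)      (-[1+ n ]) = ⊖-homo m (suc n)
    +-homo (-[1+ m ]) (+ n)      = ≈-trans (⊖-homo n (suc m)) (+-comm _ _)
    +-homo (-[1+ m ]) (-[1+ n ]) = begin
      - (suc (suc (m ℕ.+ n)) ⋆ 1#)  ≡⟨ cong (λ k → - (suc k ⋆ 1#)) (ℕₚ.+-suc m n) ⟨
      - (suc (m ℕ.+ suc n) ⋆ 1#)  ≈⟨ -‿cong (×-homo-+ 1# (suc m) (suc n)) ⟩
      - (suc m ⋆ 1# + suc n ⋆ 1#)  ≈⟨ -‿+-comm _ _ ⟨
      - (suc m ⋆ 1#) + - (suc n ⋆ 1#)  ∎

    neg-homo : ∀ i → ⟦ ℤ.- i ⟧ᶻ ≈ - ⟦ i ⟧ᶻ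
    neg-homo (+ zero)  = ≈-sym -0#≈0#
    neg-homo (+ suc n) = ≈-refl
    neg-homo -[1+ n ]  = ≈-sym (-‿involutive _)

    *-homo : ∀ i j → ⟦ i ℤ.* j ⟧ᶻ ≈ ⟦ i ⟧ᶻ * ⟦ j ⟧ᶻ
    *-homo (+ m) (+ n) = ≈-trans (reflexive (cong ⟦_⟧ᶻ (sym (ℤₚ.pos-* m n)))) (×1-homo-* m n)
    *-homo (+ m) (-[1+ n ]) = begin
      ⟦ + m ℤ.* -[1+ n ] ⟧ᶻ  ≡⟨ cong ⟦_⟧ᶻ (ℤₚ.neg-distribʳ-* (+ m) (+ suc n)) ⟨
      ⟦ ℤ.- (+ m ℤ.* + suc n) ⟧ᶻ  ≈⟨ neg-homo (+ m ℤ.* + suc n) ⟩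
      - ⟦ + m ℤ.* + suc n ⟧ᶻ  ≈⟨ -‿cong (*-homo (+ m) (+ suc n)) ⟩
      - (m ⋆ 1# * suc n ⋆ 1#)  ≈⟨ -‿distribʳ-* _ _ ⟩
      m ⋆ 1# * - (suc n ⋆ 1#)  ∎
    *-homo (-[1+ m ]) (+ n) = begin
      ⟦ -[1+ m ] ℤ.* + n ⟧ᶻ  ≡⟨ cong ⟦_⟧ᶻ (ℤₚ.neg-distribˡ-* (+ suc m) (+ n)) ⟨
      ⟦ ℤ.- (+ suc m ℤ.* + n) ⟧ᶻ  ≈⟨ neg-homo (+ suc m ℤ.* + n) ⟩
      - ⟦ + suc m ℤ.* + n ⟧ᶻ  ≈⟨ -‿cong (*-homo (+ suc m) (+ n)) ⟩
      - (suc m ⋆ 1# * n ⋆ 1#)  ≈⟨ -‿distribˡ-* _ _ ⟩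
      - (suc m ⋆ 1#) * n ⋆ 1#  ∎
    *-homo (-[1+ m ]) (-[1+ n ]) = begin
      ⟦ + suc m ℤ.* + suc n ⟧ᶻ  ≈⟨ *-homo (+ suc m) (+ suc n) ⟩
      suc m ⋆ 1# * suc n ⋆ 1#  ≈⟨ -‿involutive _ ⟨
      - - (suc m ⋆ 1# * suc n ⋆ 1#)  ≈⟨ -‿cong (-‿distribˡ-* _ _) ⟩
      - (- (suc m ⋆ 1#) * suc n ⋆ 1#)  ≈⟨ -‿distribʳ-* _ _ ⟩
      - (suc m ⋆ 1#) * - (suc n ⋆ 1#)  ∎

    morphism : ℤ.+-*-rawRing -Raw-AlmostCommutative⟶ fromCommutativeRing R
    morphism = record
      { ⟦_⟧    = ⟦_⟧ᶻ
      ; +-homo = +-homo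
      ; *-homo = *-homo
      ; -‿homo = neg-homo
      ; 0-homo = ≈-refl
      ; 1-homo = ≈-refl
      }

    _≟ᶻ_ : ∀ i j → Maybe (⟦ i ⟧ᶻ ≈ ⟦ j ⟧ᶻ)
    i ≟ᶻ j with i ℤ.≟ j
    ... | yes i≡j = just (reflexive (cong ⟦_⟧ᶻ i≡j))
    ... | no _    = nothing

  open import Algebra.Solver.Ring ℤ.+-*-rawRing (fromCommutativeRing R) morphism _≟ᶻ_ public
    using (solve; _:=_; _:+_; _:*_; :-_; _:-_; con)

module ℕ∑ = Sum ℕₚ.+-*-commutativeSemiring

∑-const : ∀ {A : Set} (xs : List A) k → ℕ∑.∑ xs (λ _ → k) ≡ length xs ℕ.* k
∑-const []       k = refl
∑-const (x ∷ xs) k = cong (k ℕ.+_) (∑-const xs k)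

-- Linear algebra over a finite field

module LinearAlgebra (F : FiniteField) where
  private module F = FiniteField F
  open F public using (order)
  open F using (elements)

  ringF : CommutativeRing 0ℓ 0ℓ
  ringF = record { isCommutativeRing = F.isCommutativeRing }

  open CommutativeRing ringF public using (_+_; _*_; -_; 0#; 1#) renaming (Carrier to K)
  open CommutativeRing ringF using (*-identityˡ; +-identityˡ)
  open IntegerSolver ringF
  open ℕ∑
  open ≡.≡-Reasoning

  infixl 6 _−[_]_
  infix  4 _≟ᵥ_

  -- The only vector operation, u - a·c. Adding a multiple is subtracting with coefficient `- a`, so
  -- no separate laws for addition and scaling are required.
  _−[_]_ : ∀ {n} → Vec K n → K → Vec K n → Vec K n
  u −[ a ] c = V.zipWith (λ x y → x + - (a * y)) u c

  0ᵥ : ∀ {n} → Vec K n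
  0ᵥ {n} = V.replicate n 0#

  −-−-same : ∀ {n} (u : Vec K n) a c b v a′ →
             (u −[ a ] c) −[ b ] (v −[ a′ ] c) ≡ (u −[ b ] v) −[ a + - (b * a′) ] c
  −-−-same []      a []      b []      a′ = refl
  −-−-same (x ∷ u) a (y ∷ c) b (z ∷ v) a′ = cong₂ _∷_
    (solve 6 (λ u a c b v a′ → ((u :+ :- (a :* c)) :+ :- (b :* (v :+ :- (a′ :* c)))) :=
                               ((u :+ :- (b :* v)) :+ :- ((a :+ :- (b :* a′)) :* c))) refl x a y b z a′)
    (−-−-same u a c b v a′)

  −-comm : ∀ {n} (u : Vec K n) a c b d → u −[ a ] c −[ b ] d ≡ u −[ b ] d −[ a ] c
  −-comm []      a []      b []      = refl
  −-comm (x ∷ u) a (y ∷ c) b (z ∷ d) = cong₂ _∷_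
    (solve 5 (λ u a c b v → (u :+ :- (a :* c)) :+ :- (b :* v) := (u :+ :- (b :* v)) :+ :- (a :* c)) refl x a y b z)
    (−-comm u a c b d)

  −-cancel : ∀ {n} (u : Vec K n) a c → u −[ a ] c −[ - a ] c ≡ u
  −-cancel []      a []      = refl
  −-cancel (x ∷ u) a (y ∷ c) = cong₂ _∷_
    (solve 3 (λ u a c → (u :+ :- (a :* c)) :+ :- (:- a :* c) := u) refl x a y) (−-cancel u a c)

  −-cancel′ : ∀ {n} (u : Vec K n) a c → u −[ - a ] c −[ a ] c ≡ u
  −-cancel′ u a c = trans (−-comm u (- a) c a c) (−-cancel u a c)

  −-0 : ∀ {n} (u : Vec K n) c → u −[ 0# ] c ≡ u
  −-0 []      []      = refl
  −-0 (x ∷ u) (y ∷ c) = cong₂ _∷_ (solve 2 (λ u c → u :+ :- (con (+ 0) :* c) := u) refl x y) (−-0 u c)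

  −-difference : ∀ {n} (u : Vec K n) a c a′ → (u −[ a ] c) −[ 1# ] (u −[ a′ ] c) ≡ 0ᵥ −[ a + - a′ ] c
  −-difference []      a []      a′ = refl
  −-difference (x ∷ u) a (y ∷ c) a′ = cong₂ _∷_
    (solve 4 (λ u a c a′ → (u :+ :- (a :* c)) :+ :- (con (+ 1) :* (u :+ :- (a′ :* c))) :=
                           con (+ 0) :+ :- ((a :+ :- a′) :* c)) refl x a y a′)
    (−-difference u a c a′)

  −-inverse : ∀ {n d e} (c : Vec K n) → d * e ≡ 1# → 0ᵥ −[ e ] (0ᵥ −[ d ] c) ≡ c
  −-inverse             []      de = refl
  −-inverse {d = d} {e} (y ∷ c) de = cong₂ _∷_
    (trans (solve 3 (λ d e y → con (+ 0) :+ :- (e :* (con (+ 0) :+ :- (d :* y))) := d :* e :* y) refl d e y)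
             (trans (cong (_* y) de) (*-identityˡ y)))
    (−-inverse c de)

  0−0 : ∀ {n} b → 0ᵥ {n} −[ b ] 0ᵥ ≡ 0ᵥ
  0−0 {zero}  b = refl
  0−0 {suc n} b = cong₂ _∷_ (solve 1 (λ b → con (+ 0) :+ :- (b :* con (+ 0)) := con (+ 0)) refl b) (0−0 b)

  -- Membership by elimination: coefficients are removed one vector at a time until zero is left.
  -- Decidability, rank and the fibre counts all follow this recursion.
  Span : ∀ {n} → List (Vec K n) → Vec K n → Set
  Span []      u = u ≡ 0ᵥ
  Span (c ∷ L) u = ∃ λ a → Span L (u −[ a ] c)

  _≟ᵥ_ : ∀ {n} → DecidableEquality (Vec K n)
  _≟ᵥ_ = Vₚ.≡-dec F._≟_

  span? : ∀ {n} (L : List (Vec K n)) → Decidable (Span L)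
  span? []      u = u ≟ᵥ 0ᵥ
  span? (c ∷ L) u = map′ Any.satisfied (λ (a , p) → Any.map (λ { refl → p }) (F.complete a))
                         (Any.any? (λ a → span? L (u −[ a ] c)) elements)

  Span-− : ∀ {n} (L : List (Vec K n)) {u v} b → Span L u → Span L v → Span L (u −[ b ] v)
  Span-− []      b refl    refl     = 0−0 b
  Span-− (c ∷ L) {u} {v} b (a , p) (a′ , p′) =
    a + - (b * a′) , subst (Span L) (−-−-same u a c b v a′) (Span-− L b p p′)

  Span-0 : ∀ {n} (L : List (Vec K n)) → Span L 0ᵥ
  Span-0 []      = refl
  Span-0 (c ∷ L) = 0# , subst (Span L) (sym (−-0 0ᵥ c)) (Span-0 L)

  Span-there : ∀ {n} {L : List (Vec K n)} {c u} → Span L u → Span (c ∷ L) u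
  Span-there {L = L} {c} {u} p = 0# , subst (Span L) (sym (−-0 u c)) p

  Span-shift : ∀ {n} (L : List (Vec K n)) {c u} a → Span L c → Span L (u −[ a ] c) → Span L u
  Span-shift L {c} {u} a p q = subst (Span L) (−-cancel u a c) (Span-− L (- a) q p)

  -- If the coefficients differed, the difference of the two memberships would put a nonzero
  -- multiple of `c` into the span, and inverting the scalar would put `c` itself there.
  Span-coefficient-unique : ∀ {n} (L : List (Vec K n)) {c u a a′} → ¬ Span L c →
                            Span L (u −[ a ] c) → Span L (u −[ a′ ] c) → a ≡ a′
  Span-coefficient-unique L {c} {u} {a} {a′} c∉ p p′ with (a + - a′) F.≟ 0#
  ... | yes a-a′≡0 = begin
    a  ≡⟨ solve 2 (λ a b → a := (a :+ :- b) :+ b) refl a a′ ⟩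
    (a + - a′) + a′  ≡⟨ cong (_+ a′) a-a′≡0 ⟩
    0# + a′  ≡⟨ +-identityˡ a′ ⟩
    a′  ∎
  ... | no a-a′≢0 with F.inverse _ a-a′≢0
  ... | e , de = ⊥-elim (c∉ (subst (Span L) (−-inverse c de)
                   (Span-− L e (Span-0 L) (subst (Span L) (−-difference u a c a′) (Span-− L 1# p p′)))))

  Span-∷ʳ⁺ : ∀ {n} (L : List (Vec K n)) {c u} → Span (c ∷ L) u → Span (L ∷ʳ c) u
  Span-∷ʳ⁺ []      p = p
  Span-∷ʳ⁺ (d ∷ L) {c} {u} (a , b , p) = b , Span-∷ʳ⁺ L (a , subst (Span L) (−-comm u a c b d) p)

  Span-∷ʳ⁻ : ∀ {n} (L : List (Vec K n)) {c u} → Span (L ∷ʳ c) u → Span (c ∷ L) u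
  Span-∷ʳ⁻ []      p = p
  Span-∷ʳ⁻ (d ∷ L) {c} {u} (b , p) with Span-∷ʳ⁻ L p
  ... | a , r = a , b , subst (Span L) (−-comm u b d a c) r

  Span-trans : ∀ {n} (M L : List (Vec K n)) {u} → All (Span L) M → Span M u → Span L u
  Span-trans []      L []       refl    = Span-0 L
  Span-trans (c ∷ M) L (h ∷ hs) (a , p) = Span-shift L a h (Span-trans M L hs p)

  -- Greedy rank. Unlike the maximum over sublists in `rank`, it recurses along with `Span`, so the
  -- size of a span can be found by induction on the list.
  rk : ∀ {n} → List (Vec K n) → ℕ
  rk []      = 0
  rk (c ∷ L) = if does (span? L c) then rk L else suc (rk L)

  rk-dependent : ∀ {n} (L : List (Vec K n)) {c} → Span L c → rk (c ∷ L) ≡ rk L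
  rk-dependent L {c} p with span? L c
  ... | yes _ = refl
  ... | no ¬p = contradiction p ¬p

  rk-independent : ∀ {n} (L : List (Vec K n)) {c} → ¬ Span L c → rk (c ∷ L) ≡ suc (rk L)
  rk-independent L {c} ¬p with span? L c
  ... | yes p = contradiction p ¬p
  ... | no _  = refl

  -- Number of coefficient vectors whose linear combination of the list is `u`.
  fibre : ∀ {n} → List (Vec K n) → Vec K n → ℕ
  fibre []      u = when (u ≟ᵥ 0ᵥ) 1
  fibre (c ∷ L) u = ∑ elements (λ a → fibre L (u −[ a ] c))

  -- All nonempty fibres of the linear map a ↦ Σ aᵢ cᵢ have the same size.
  fibre-*-^rk : ∀ {n} (L : List (Vec K n)) u →
                fibre L u ℕ.* order ℕ.^ rk L ≡ when (span? L u) (order ℕ.^ length L)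
  fibre-*-^rk []      u = trans (ℕₚ.*-identityʳ _) refl
  fibre-*-^rk (c ∷ L) u with span? L c
  -- Subtracting multiples of a dependent `c` does not affect membership, so all `order`
  -- coefficients contribute equally while the rank stays the same.
  ... | yes p = begin
    ∑ elements (λ a → fibre L (u −[ a ] c)) ℕ.* order ℕ.^ rk L  ≡⟨ *-distribʳ-∑ elements _ (order ℕ.^ rk L) ⟩
    ∑ elements (λ a → fibre L (u −[ a ] c) ℕ.* order ℕ.^ rk L)
      ≡⟨ ∑-cong′ elements (λ a → trans (fibre-*-^rk L (u −[ a ] c))
           (when-cong (span? L (u −[ a ] c)) (span? (c ∷ L) u) {order ℕ.^ length L} (λ q → a , q)
             (λ (b , q) → Span-− L a (Span-shift L b p q) p) (λ _ → refl))) ⟩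
    ∑ elements (λ a → when (span? (c ∷ L) u) (order ℕ.^ length L))  ≡⟨ ∑-const elements _ ⟩
    order ℕ.* when (span? (c ∷ L) u) (order ℕ.^ length L)  ≡⟨ ℕₚ.*-comm order _ ⟩
    when (span? (c ∷ L) u) (order ℕ.^ length L) ℕ.* order  ≡⟨ when-*ʳ (span? (c ∷ L) u) (order ℕ.^ length L) order ⟩
    when (span? (c ∷ L) u) (order ℕ.^ length L ℕ.* order)
      ≡⟨ cong (when (span? (c ∷ L) u)) (ℕₚ.*-comm (order ℕ.^ length L) order) ⟩
    when (span? (c ∷ L) u) (order ℕ.^ suc (length L))  ∎
  -- For an independent `c` at most one coefficient contributes; the missing factor `order` is
  -- supplied by the increase of the rank.
  ... | no ¬p = begin
    ∑ elements (λ a → fibre L (u −[ a ] c)) ℕ.* (order ℕ.* order ℕ.^ rk L)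
      ≡⟨ cong (∑ elements (λ a → fibre L (u −[ a ] c)) ℕ.*_) (ℕₚ.*-comm order (order ℕ.^ rk L)) ⟩
    ∑ elements (λ a → fibre L (u −[ a ] c)) ℕ.* (order ℕ.^ rk L ℕ.* order)
      ≡⟨ ℕₚ.*-assoc (∑ elements (λ a → fibre L (u −[ a ] c))) _ order ⟨
    ∑ elements (λ a → fibre L (u −[ a ] c)) ℕ.* order ℕ.^ rk L ℕ.* order
      ≡⟨ cong (ℕ._* order) (trans (*-distribʳ-∑ elements _ (order ℕ.^ rk L))
           (∑-cong′ elements (λ a → fibre-*-^rk L (u −[ a ] c)))) ⟩
    ∑ elements (λ a → when (span? L (u −[ a ] c)) (order ℕ.^ length L)) ℕ.* order
      ≡⟨ cong (ℕ._* order) single ⟩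
    when (span? (c ∷ L) u) (order ℕ.^ length L) ℕ.* order  ≡⟨ when-*ʳ (span? (c ∷ L) u) (order ℕ.^ length L) order ⟩
    when (span? (c ∷ L) u) (order ℕ.^ length L ℕ.* order)
      ≡⟨ cong (when (span? (c ∷ L) u)) (ℕₚ.*-comm (order ℕ.^ length L) order) ⟩
    when (span? (c ∷ L) u) (order ℕ.^ suc (length L))  ∎
    where
    single : ∑ elements (λ a → when (span? L (u −[ a ] c)) (order ℕ.^ length L)) ≡ when (span? (c ∷ L) u) (order ℕ.^ length L)
    single = case span? (c ∷ L) u of λ
      { (yes (a , q)) → trans (∑-single _ F.unique (F.complete a)
          (λ {b} _ b≢a → when-no (span? L (u −[ b ] c)) (λ q′ → b≢a (Span-coefficient-unique L ¬p q′ q))))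
          (trans (when-yes (span? L (u −[ a ] c)) q) (sym (when-yes (span? (c ∷ L) u) (a , q))))
      ; (no ¬q) → trans (∑-zero elements (λ {a} _ → when-no (span? L (u −[ a ] c)) (λ q → ¬q (a , q))))
          (sym (when-no (span? (c ∷ L) u) ¬q))
      }

  vecs : ∀ n → List (Vec K n)
  vecs = allVecs elements

  vecs-unique : ∀ n → Unique (vecs n)
  vecs-unique = allVecs-unique F.unique

  ∈-vecs : ∀ {n} (v : Vec K n) → v ∈ vecs n
  ∈-vecs = allVecs-complete F.complete

  ∑-translate : ∀ {n} (f : Vec K n → ℕ) a c → ∑ (vecs n) (λ v → f (v −[ a ] c)) ≡ ∑ (vecs n) f
  ∑-translate {n} f a c = trans (sym (∑-map (_−[ a ] c) (vecs n) f)) (∑-↭ f (unique-⊆⊇⇒↭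
    (Uniqueₚ.map⁺ (λ {u} {v} eq → trans (sym (−-cancel u a c)) (trans (cong (_−[ - a ] c) eq) (−-cancel v a c)))
      (vecs-unique n))
    (vecs-unique n)
    (λ {v} _ → ∈-vecs v)
    (λ {v} _ → subst (_∈ map (_−[ a ] c) (vecs n)) (−-cancel′ v a c) (∈-map⁺ (_−[ a ] c) (∈-vecs (v −[ - a ] c))))))

  ∑-fibre : ∀ {n} (L : List (Vec K n)) → ∑ (vecs n) (fibre L) ≡ order ℕ.^ length L
  ∑-fibre {n} []      = trans (∑-single _ (vecs-unique n) (∈-vecs 0ᵥ) (λ {v} _ → when-no (v ≟ᵥ 0ᵥ)))
                                (when-yes (0ᵥ {n} ≟ᵥ 0ᵥ) refl)
  ∑-fibre {n} (c ∷ L) = begin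
    ∑ (vecs n) (λ v → ∑ elements (λ a → fibre L (v −[ a ] c)))  ≡⟨ ∑-swap (vecs n) elements _ ⟩
    ∑ elements (λ a → ∑ (vecs n) (λ v → fibre L (v −[ a ] c)))
      ≡⟨ ∑-cong′ elements (λ a → trans (∑-translate (fibre L) a c) (∑-fibre L)) ⟩
    ∑ elements (λ _ → order ℕ.^ length L)  ≡⟨ ∑-const elements _ ⟩
    order ℕ.^ suc (length L)  ∎

  order>1 : 1 < order
  order>1 = two-elements F.0≢1 (F.complete 0#) (F.complete 1#)
    where
    two-elements : ∀ {A : Set} {x y : A} {xs} → x ≢ y → x ∈ xs → y ∈ xs → 1 < length xs
    two-elements x≢y (here refl) (here refl) = ⊥-elim (x≢y refl)
    two-elements x≢y (here refl) (there {xs = _ ∷ _} q) = ℕ.s≤s (ℕ.s≤s ℕ.z≤n)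
    two-elements x≢y (there {xs = _ ∷ _} p) _ = ℕ.s≤s (ℕ.s≤s ℕ.z≤n)

  instance
    order-nonZero : ℕ.NonZero order
    order-nonZero = ℕ.>-nonZero (ℕₚ.<-trans (ℕ.s≤s ℕ.z≤n) order>1)

  order^-nonZero : ∀ m → ℕ.NonZero (order ℕ.^ m)
  order^-nonZero m = ℕₚ.m^n≢0 order m

  -- The fibres partition the q^length coefficient vectors and the nonempty ones share a size.
  -- Summing `fibre-*-^rk` over all vectors and cancelling q^length leaves the number of nonempty
  -- fibres.
  card-Span : ∀ {n} (L : List (Vec K n)) → ∑ (vecs n) (λ v → when (span? L v) 1) ≡ order ℕ.^ rk L
  card-Span {n} L = ℕₚ.*-cancelˡ-≡ _ _ (order ℕ.^ length L) {{order^-nonZero (length L)}} (begin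
    order ℕ.^ length L ℕ.* ∑ (vecs n) (λ v → when (span? L v) 1)  ≡⟨ ℕₚ.*-comm (order ℕ.^ length L) _ ⟩
    ∑ (vecs n) (λ v → when (span? L v) 1) ℕ.* order ℕ.^ length L  ≡⟨ *-distribʳ-∑ (vecs n) _ _ ⟩
    ∑ (vecs n) (λ v → when (span? L v) 1 ℕ.* order ℕ.^ length L)
      ≡⟨ ∑-cong′ (vecs n) (λ v → trans (when-*ʳ (span? L v) 1 (order ℕ.^ length L))
          (trans (cong (when (span? L v)) (ℕₚ.*-identityˡ _)) (sym (fibre-*-^rk L v)))) ⟩
    ∑ (vecs n) (λ v → fibre L v ℕ.* order ℕ.^ rk L)  ≡⟨ *-distribʳ-∑ (vecs n) _ _ ⟨
    ∑ (vecs n) (fibre L) ℕ.* order ℕ.^ rk L  ≡⟨ cong (ℕ._* order ℕ.^ rk L) (∑-fibre L) ⟩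
    order ℕ.^ length L ℕ.* order ℕ.^ rk L ∎)

  ∑-mono-≤ : ∀ {A : Set} (xs : List A) {f g : A → ℕ} → (∀ x → f x ≤ g x) → ∑ xs f ≤ ∑ xs g
  ∑-mono-≤ []       h = ℕ.z≤n
  ∑-mono-≤ (x ∷ xs) h = ℕₚ.+-mono-≤ (h x) (∑-mono-≤ xs h)

  when-mono-≤ : ∀ {P Q : Set} (d : Dec P) (e : Dec Q) {x} → (P → Q) → when d x ≤ when e x
  when-mono-≤ (yes p) e h = ℕₚ.≤-reflexive (sym (when-yes e (h p)))
  when-mono-≤ (no ¬p) e h = ℕ.z≤n

  order^-cancel-≤ : ∀ {m n} → order ℕ.^ m ≤ order ℕ.^ n → m ≤ n
  order^-cancel-≤ {m} {n} h with m ℕ.≤? n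
  ... | yes m≤n = m≤n
  ... | no  m≰n = contradiction h (ℕₚ.<⇒≱ (ℕₚ.^-monoʳ-< order order>1 (ℕₚ.≰⇒> m≰n)))

  -- This takes the place of an exchange lemma: nested spans have q^rk elements each, and powers of
  -- q > 1 increase strictly.
  rk-mono : ∀ {n} (L M : List (Vec K n)) → (∀ {u} → Span L u → Span M u) → rk L ≤ rk M
  rk-mono {n} L M h = order^-cancel-≤ (≡.subst₂ _≤_ (card-Span L) (card-Span M)
    (∑-mono-≤ (vecs n) (λ v → when-mono-≤ (span? L v) (span? M v) h)))

  -- `rk` peels the left end, whereas columns are appended on the right. The two lists have the same
  -- span, and the rank depends on nothing else.
  rk-∷ʳ : ∀ {n} (L : List (Vec K n)) c → rk (L ∷ʳ c) ≡ rk (c ∷ L)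
  rk-∷ʳ L c = ℕₚ.≤-antisym (rk-mono (L ∷ʳ c) (c ∷ L) (Span-∷ʳ⁻ L)) (rk-mono (c ∷ L) (L ∷ʳ c) (Span-∷ʳ⁺ L))

  rk≤length : ∀ {n} (L : List (Vec K n)) → rk L ≤ length L
  rk≤length []      = ℕ.z≤n
  rk≤length (c ∷ L) with does (span? L c)
  ... | true  = ℕₚ.m≤n⇒m≤1+n (rk≤length L)
  ... | false = ℕ.s≤s (rk≤length L)

  -- Rank and nullity: the fibre over zero is the kernel of the matrix with columns `L`.
  fibre-0 : ∀ {n} (L : List (Vec K n)) → fibre L 0ᵥ ≡ order ℕ.^ (length L ℕ.∸ rk L)
  fibre-0 L = ℕₚ.*-cancelʳ-≡ _ _ (order ℕ.^ rk L) {{order^-nonZero (rk L)}} (begin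
    fibre L 0ᵥ ℕ.* order ℕ.^ rk L  ≡⟨ fibre-*-^rk L 0ᵥ ⟩
    when (span? L 0ᵥ) (order ℕ.^ length L)  ≡⟨ when-yes (span? L 0ᵥ) (Span-0 L) ⟩
    order ℕ.^ length L  ≡⟨ cong (order ℕ.^_) (ℕₚ.m∸n+n≡m (rk≤length L)) ⟨
    order ℕ.^ (length L ℕ.∸ rk L ℕ.+ rk L)  ≡⟨ ℕₚ.^-distribˡ-+-* order (length L ℕ.∸ rk L) (rk L) ⟩
    order ℕ.^ (length L ℕ.∸ rk L) ℕ.* order ℕ.^ rk L  ∎)

-- Boolean tests and list enumerations as propositions

T-does : ∀ {P : Set} (d : Dec P) → T (does d) → P
T-does (yes p) _ = p

does-T : ∀ {P : Set} (d : Dec P) → P → T (does d)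
does-T (yes _) p = tt
does-T (no ¬p) p = ¬p p

T-∧⁻ : ∀ b {c} → T (b ∧ c) → T b × T c
T-∧⁻ true t = tt , t

T-∧⁺ : ∀ b {c} → T b → T c → T (b ∧ c)
T-∧⁺ true _ t = t

T-∨⁻ : ∀ b {c} → T (b ∨ c) → T b ⊎ T c
T-∨⁻ true  t = inj₁ t
T-∨⁻ false t = inj₂ t

T-∨⁺ : ∀ b {c} → T b ⊎ T c → T (b ∨ c)
T-∨⁺ true  _        = tt
T-∨⁺ false (inj₂ t) = t

T-⇒⁻ : ∀ b {c} → T (not b ∨ c) → T b → T c
T-⇒⁻ true t _ = t

T-⇒⁺ : ∀ b {c} → (T b → T c) → T (not b ∨ c)
T-⇒⁺ true  f = f tt
T-⇒⁺ false f = tt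

allB-⁻ : ∀ {A : Set} (p : A → Bool) (xs : List A) → T (allB p xs) → ∀ {x} → x ∈ xs → T (p x)
allB-⁻ p (x ∷ xs) t (here refl) = proj₁ (T-∧⁻ (p x) t)
allB-⁻ p (x ∷ xs) t (there x∈)  = allB-⁻ p xs (proj₂ (T-∧⁻ (p x) t)) x∈

allB-⁺ : ∀ {A : Set} (p : A → Bool) (xs : List A) → (∀ {x} → x ∈ xs → T (p x)) → T (allB p xs)
allB-⁺ p []       h = tt
allB-⁺ p (x ∷ xs) h = T-∧⁺ (p x) (h (here refl)) (allB-⁺ p xs (h ∘ there))

allB-cong : ∀ {A : Set} {p r : A → Bool} → (∀ x → p x ≡ r x) → (xs : List A) → allB p xs ≡ allB r xs
allB-cong h []       = refl
allB-cong h (x ∷ xs) = cong₂ _∧_ (h x) (allB-cong h xs)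

allLists-complete : ∀ {A : Set} {xs : List A} {ys} → All (_∈ xs) ys → ys ∈ allLists xs (length ys)
allLists-complete []       = here refl
allLists-complete {xs = xs} {y ∷ ys} (y∈ ∷ ys∈) =
  ∈-concatMap⁺ (λ x → map (x ∷_) (allLists xs (length ys)))
    (Any.map (λ { refl → ∈-map⁺ (y ∷_) (allLists-complete ys∈) }) y∈)

allLists-length : ∀ {A : Set} (xs : List A) n {ys} → ys ∈ allLists xs n → length ys ≡ n
allLists-length xs zero    (here refl) = refl
allLists-length xs (suc n) {ys} p
  with x , q ← Any.satisfied (∈-concatMap⁻ (λ x → map (x ∷_) (allLists xs n)) {xs = xs} p)
  with zs , zs∈ , refl ← ∈-map⁻ (x ∷_) q = cong suc (allLists-length xs n zs∈)

≤-maxℕ : ∀ {x} (xs : List ℕ) → x ∈ xs → x ≤ maxℕ xs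
≤-maxℕ (x ∷ xs) (here refl) = ℕₚ.m≤m⊔n x (maxℕ xs)
≤-maxℕ (x ∷ xs) (there x∈)  = ℕₚ.≤-trans (≤-maxℕ xs x∈) (ℕₚ.m≤n⊔m x (maxℕ xs))

maxℕ-≤ : ∀ {m} (xs : List ℕ) → (∀ {x} → x ∈ xs → x ≤ m) → maxℕ xs ≤ m
maxℕ-≤ []       h = ℕ.z≤n
maxℕ-≤ (x ∷ xs) h = ℕₚ.⊔-lub (h (here refl)) (maxℕ-≤ xs (h ∘ there))

∈-sublists-∷⁻ : ∀ {A : Set} (x : A) xs {s} → s ∈ sublists (x ∷ xs) →
                s ∈ sublists xs ⊎ ∃ λ s′ → s ≡ x ∷ s′ × s′ ∈ sublists xs
∈-sublists-∷⁻ x xs p with ∈-++⁻ (sublists xs) p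
... | inj₁ q = inj₁ q
... | inj₂ q with ∈-map⁻ (x ∷_) q
... | s′ , s′∈ , refl = inj₂ (s′ , refl , s′∈)

tabulate-injective : ∀ {A : Set} {n} {f g : Fin n → A} → tabulate f ≡ tabulate g → ∀ i → f i ≡ g i
tabulate-injective {f = f} {g} eq i =
  trans (sym (Vₚ.lookup∘tabulate f i)) (trans (cong (λ v → lookup v i) eq) (Vₚ.lookup∘tabulate g i))

-- Agreement of the maximal independent column sets with the greedy rank

module Rank (F : FiniteField) where
  private module F = FiniteField F
  open F using (elements)
  open LinearAlgebra F
  open CommutativeRing ringF using (zeroˡ; +-identityʳ; -‿inverseʳ)
  open IntegerSolver ringF

  combine : ∀ {n} → List K → List (Fin n → K) → Fin n → K
  combine (a ∷ as) (v ∷ vs) i = a * v i + combine as vs i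
  combine _        _        i = 0#

  vanishing⇒trivial : ∀ {n} → List (Fin n → K) → List K → Bool
  vanishing⇒trivial {n} vs as =
    not (allB (λ i → eqB F (combine as vs i) 0#) (allFin n)) ∨ allB (λ a → eqB F a 0#) as

  private
    -- Stated for an arbitrary `g` so that it can be applied to the function local to `linIndep`,
    -- which satisfies these equations by `refl`.
    combine-unique : ∀ {n} (g : List K → List (Fin n → K) → Fin n → K) →
                     (∀ a as v vs i → g (a ∷ as) (v ∷ vs) i ≡ a * v i + g as vs i) →
                     (∀ vs i → g [] vs i ≡ 0#) → (∀ a as i → g (a ∷ as) [] i ≡ 0#) →
                     ∀ as vs i → g as vs i ≡ combine as vs i
    combine-unique g c n₁ n₂ []       vs       i = n₁ vs i
    combine-unique g c n₁ n₂ (a ∷ as) []       i = n₂ a as i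
    combine-unique g c n₁ n₂ (a ∷ as) (v ∷ vs) i =
      trans (c a as v vs i) (cong (λ e → a * v i + e) (combine-unique g c n₁ n₂ as vs i))

    -- The existential gives the predicate hidden inside `linIndep` a name, as its first projection.
    check : ∀ {n} (vs : List (Fin n → K)) →
            Σ (List K → Bool) λ p → linIndep F vs ≡ allB p (allLists elements (length vs))
    check vs = _ , refl

    -- The local function comb of linIndep carries the whole list vs as a hidden parameter.
    -- Abstracting v ∷ vs generalises that parameter only, so that unification can name comb.
    mutual
      comb≗combine : ∀ {n} (ws : List (Fin n → K)) as vs i → _ ≡ combine as vs i
      comb≗combine ws = combine-unique _ (λ _ _ _ _ _ → refl) (λ _ _ → refl) (λ _ _ _ → refl)

      check-∷ : ∀ {n} (v : Fin n → K) vs a as →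
                proj₁ (check (v ∷ vs)) (a ∷ as) ≡ vanishing⇒trivial (v ∷ vs) (a ∷ as)
      check-∷ {n} v vs a as with v ∷ vs
      ... | ws = cong (λ b → not b ∨ allB (λ a → eqB F a 0#) (a ∷ as))
                   (allB-cong (λ i → cong (λ e → eqB F (a * v i + e) 0#) (comb≗combine ws as vs i)) (allFin n))

  Independent : ∀ {n} → List (Fin n → K) → Set
  Independent vs = ∀ as → length as ≡ length vs → (∀ i → combine as vs i ≡ 0#) → All (_≡ 0#) as

  linIndep⇒Independent : ∀ {n} (vs : List (Fin n → K)) → T (linIndep F vs) → Independent vs
  linIndep⇒Independent vs       t []       len zeros = []
  linIndep⇒Independent {n} (v ∷ vs) t (a ∷ as) len zeros =
    All.tabulate (λ {x} x∈ → T-does (x F.≟ 0#) (allB-⁻ (λ a → eqB F a 0#) (a ∷ as) all-zero x∈))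
    where
    checked : T (vanishing⇒trivial (v ∷ vs) (a ∷ as))
    checked = subst T (check-∷ v vs a as) (allB-⁻ (proj₁ (check (v ∷ vs))) (allLists elements (length (v ∷ vs)))
      (subst T (proj₂ (check (v ∷ vs))) t)
      (subst (λ m → (a ∷ as) ∈ allLists elements m) len (allLists-complete (All.tabulate (λ {x} _ → F.complete x)))))
    all-zero : T (allB (λ a → eqB F a 0#) (a ∷ as))
    all-zero = T-⇒⁻ (allB (λ i → eqB F (combine (a ∷ as) (v ∷ vs) i) 0#) (allFin n)) checked
      (allB-⁺ _ (allFin n) (λ {i} _ → does-T (_ F.≟ 0#) (zeros i)))

  Independent⇒linIndep : ∀ {n} (vs : List (Fin n → K)) → Independent vs → T (linIndep F vs)
  Independent⇒linIndep {n} [] ind = T-∧⁺ (proj₁ (check {n} []) [])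
    (T-⇒⁺ (allB (λ i → eqB F (combine {n} [] [] i) 0#) (allFin n)) (λ _ → tt)) tt
  Independent⇒linIndep {n} (v ∷ vs) ind = subst T (sym (proj₂ (check (v ∷ vs))))
    (allB-⁺ (proj₁ (check (v ∷ vs))) (allLists elements (suc (length vs))) checks)
    where
    checks : ∀ {as} → as ∈ allLists elements (suc (length vs)) → T (proj₁ (check (v ∷ vs)) as)
    checks {[]}     as∈ = case allLists-length elements (suc (length vs)) as∈ of λ ()
    checks {a ∷ as} as∈ = subst T (sym (check-∷ v vs a as))
      (T-⇒⁺ (allB (λ i → eqB F (combine (a ∷ as) (v ∷ vs) i) 0#) (allFin n)) (λ zeros →
        allB-⁺ (λ a → eqB F a 0#) (a ∷ as) (λ {x} x∈ → does-T (x F.≟ 0#) (All.lookup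
          (ind (a ∷ as) (allLists-length elements (suc (length vs)) as∈)
            (λ i → T-does (_ F.≟ 0#) (allB-⁻ _ (allFin n) zeros (∈-allFin i)))) x∈))))

  tabulate-0 : ∀ n → tabulate {n = n} (λ _ → 0#) ≡ 0ᵥ
  tabulate-0 zero    = refl
  tabulate-0 (suc n) = cong (0# ∷_) (tabulate-0 n)

  tabulate-− : ∀ {n} (g h : Fin n → K) a → tabulate g −[ a ] tabulate h ≡ tabulate (λ i → g i + - (a * h i))
  tabulate-− {zero}  g h a = refl
  tabulate-− {suc n} g h a = cong₂ _∷_ refl (tabulate-− (g ∘ suc) (h ∘ suc) a)

  combine-∷-− : ∀ {n} a as (v : Fin n → K) vs →
                tabulate (combine (a ∷ as) (v ∷ vs)) −[ a ] tabulate v ≡ tabulate (combine as vs)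
  combine-∷-− a as v vs = trans (tabulate-− _ v a) (Vₚ.tabulate-cong (λ i →
    solve 3 (λ a v e → (a :* v :+ e) :+ :- (a :* v) := e) refl a (v i) (combine as vs i)))

  Span⇒combine : ∀ {n} (vs : List (Fin n → K)) {u} → Span (map tabulate vs) u →
                 ∃ λ as → length as ≡ length vs × u ≡ tabulate (combine as vs)
  Span⇒combine []       refl    = [] , refl , sym ((tabulate-0 _))
  Span⇒combine (v ∷ vs) {u} (a , p) with Span⇒combine vs p
  ... | as , len , eq = a ∷ as , cong suc len , (begin
    u  ≡⟨ −-cancel u a (tabulate v) ⟨
    u −[ a ] tabulate v −[ - a ] tabulate v  ≡⟨ cong (_−[ - a ] tabulate v) (trans eq (sym (combine-∷-− a as v vs))) ⟩
    tabulate (combine (a ∷ as) (v ∷ vs)) −[ a ] tabulate v −[ - a ] tabulate v  ≡⟨ −-cancel _ a (tabulate v) ⟩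
    tabulate (combine (a ∷ as) (v ∷ vs))  ∎)
    where open ≡.≡-Reasoning

  combine∈Span : ∀ {n} (vs : List (Fin n → K)) as → length as ≡ length vs →
                 Span (map tabulate vs) (tabulate (combine as vs))
  combine∈Span []       []       len = (tabulate-0 _)
  combine∈Span (v ∷ vs) (a ∷ as) len = a ,
    subst (Span (map tabulate vs)) (sym (combine-∷-− a as v vs)) (combine∈Span vs as (ℕₚ.suc-injective len))

  Independent⇒rk : ∀ {n} (vs : List (Fin n → K)) → Independent vs → rk (map tabulate vs) ≡ length vs
  Independent⇒rk []       ind = refl
  Independent⇒rk (v ∷ vs) ind = trans (rk-independent (map tabulate vs) v∉) (cong suc (Independent⇒rk vs ind-tail))
    where
    ind-tail : Independent vs
    ind-tail as len zeros with ind (0# ∷ as) (cong suc len)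
      (λ i → trans (cong (λ e → 0# * v i + e) (zeros i)) (trans (+-identityʳ _) (zeroˡ (v i))))
    ... | _ ∷ all-zero = all-zero
    v∉ : ¬ Span (map tabulate vs) (tabulate v)
    v∉ p with Span⇒combine vs p
    -- Writing `v` as a combination of `vs` gives a vanishing combination with leading coefficient
    -- -1, which independence would force to be zero.
    ... | as , len , eq with ind (- 1# ∷ as) (cong suc len)
      (λ i → trans (cong (λ e → - 1# * v i + e) (sym (tabulate-injective eq i)))
                     (solve 1 (λ v → :- con (+ 1) :* v :+ v := con (+ 0)) refl (v i)))
    ... | -1≡0 ∷ _ = F.0≢1 (trans (sym (-‿inverseʳ 1#)) (trans (cong (λ e → 1# + e) -1≡0) (+-identityʳ 1#)))

  -- Full rank places every vector outside the span of the later ones. A nonzero leading coefficient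
  -- of a vanishing combination could be inverted, which would place its vector inside.
  rk⇒Independent : ∀ {n} (vs : List (Fin n → K)) → rk (map tabulate vs) ≡ length vs → Independent vs
  rk⇒Independent []       eq []       len zeros = []
  rk⇒Independent (v ∷ vs) eq (a ∷ as) len zeros with span? (map tabulate vs) (tabulate v)
  ... | yes _ = contradiction (ℕₚ.≤-trans (ℕₚ.≤-reflexive (sym eq))
                  (ℕₚ.≤-trans (rk≤length (map tabulate vs)) (ℕₚ.≤-reflexive (length-map tabulate vs)))) (ℕₚ.<-irrefl refl)
  ... | no v∉ with a F.≟ 0#
  ... | yes refl = refl ∷ rk⇒Independent vs (ℕₚ.suc-injective eq) as (ℕₚ.suc-injective len)
                     (λ i → trans (solve 2 (λ v e → e := con (+ 0) :* v :+ e) refl (v i) _) (zeros i))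
  ... | no a≢0 with F.inverse a a≢0
  ... | e , ae = contradiction (subst (Span (map tabulate vs)) (−-inverse (tabulate v) ae)
                   (Span-− (map tabulate vs) e (Span-0 (map tabulate vs))
                     (subst (Span (map tabulate vs)) lin (combine∈Span vs as (ℕₚ.suc-injective len))))) v∉
    where
    lin : tabulate (combine as vs) ≡ 0ᵥ −[ a ] tabulate v
    lin = sym (trans (cong (_−[ a ] tabulate v) (sym ((tabulate-0 _))))
            (trans (tabulate-− (λ _ → 0#) v a) (Vₚ.tabulate-cong (λ i →
              trans (cong (_+ - (a * v i)) (sym (zeros i)))
                (solve 3 (λ a v e → (a :* v :+ e) :+ :- (a :* v) := e) refl a (v i) (combine as vs i))))))

  module _ {A : Set} {n} (col : A → Vec K n) where
    Span-sublist : ∀ xs {s} → s ∈ sublists xs → ∀ {u} → Span (map col s) u → Span (map col xs) u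
    Span-sublist []       (here refl) p = p
    Span-sublist (x ∷ xs) s∈ p with ∈-sublists-∷⁻ x xs s∈
    ... | inj₁ s∈′                 = Span-there {L = map col xs} (Span-sublist xs s∈′ p)
    ... | inj₂ (s′ , refl , s′∈)   = map₂ (Span-sublist xs s′∈) p

    -- Selects exactly the entries that `rk` counts. Equality of the two spans is carried along,
    -- since a discarded vector must be recovered from the selected ones.
    basis : ∀ xs → ∃ λ s → s ∈ sublists xs × rk (map col s) ≡ length s × length s ≡ rk (map col xs)
                            × (∀ {u} → Span (map col xs) u → Span (map col s) u)
    basis []       = [] , here refl , refl , refl , id
    basis (x ∷ xs) with basis xs | span? (map col xs) (col x)
    ... | s , s∈ , rk-s , len , spans | yes x∈ =
      s , ∈-++⁺ˡ s∈ , rk-s , len , (λ (a , p) → Span-shift (map col s) a (spans x∈) (spans p))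
    ... | s , s∈ , rk-s , len , spans | no x∉ =
      x ∷ s , ∈-++⁺ʳ (sublists xs) (∈-map⁺ (x ∷_) s∈) ,
      trans (rk-independent (map col s) (x∉ ∘ Span-sublist xs s∈)) (cong suc rk-s) ,
      cong suc len , map₂ spans

  -- An independent set of columns has at most `rk` members by monotonicity of the rank, and `basis`
  -- provides one that attains the bound.
  rank≡rk : ∀ {n} (X : Fin n → Fin n → K) → rank F X ≡ rk (map (λ j → tabulate (column F X j)) (allFin n))
  rank≡rk {n} X = ℕₚ.≤-antisym
    (maxℕ-≤ (map length candidates) (λ x∈ → upper x∈))
    (lower (basis col (allFin n)))
    where
    col : Fin n → Vec K n
    col j = tabulate (column F X j)
    indep? : Decidable (λ s → T (linIndep F (map (column F X) s)))
    indep? s = T? (linIndep F (map (column F X) s))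
    candidates = filter indep? (sublists (allFin n))
    length-col : ∀ s → length (map (column F X) s) ≡ length s
    length-col s = length-map (column F X) s
    upper : ∀ {x} → x ∈ map length candidates → x ≤ rk (map col (allFin n))
    upper x∈ with ∈-map⁻ length x∈
    ... | s , s∈ , refl with ∈-filter⁻ indep? {xs = sublists (allFin n)} s∈
    ... | s∈′ , ind = ℕₚ.≤-trans
      (ℕₚ.≤-reflexive (sym (trans (cong rk (map-∘ s))
        (trans (Independent⇒rk (map (column F X) s) (linIndep⇒Independent (map (column F X) s) ind)) (length-col s)))))
      (rk-mono (map col s) (map col (allFin n)) (Span-sublist col (allFin n) s∈′))
    lower : (∃ λ s → s ∈ sublists (allFin n) × rk (map col s) ≡ length s × length s ≡ rk (map col (allFin n))
               × (∀ {u} → Span (map col (allFin n)) u → Span (map col s) u)) →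
            rk (map col (allFin n)) ≤ maxℕ (map length candidates)
    lower (s , s∈ , rk-s , len , _) = subst (_≤ maxℕ (map length candidates)) len
      (≤-maxℕ (map length candidates) (∈-map⁺ length (∈-filter⁺ indep? s∈ (Independent⇒linIndep (map (column F X) s)
        (rk⇒Independent (map (column F X) s)
          (trans (cong rk (sym (map-∘ s))) (trans rk-s (sym (length-col s)))))))))

-- Products of q-Hermite polynomials

module HermiteProducts {c ℓ} (R : CommutativeRing c ℓ) (q p W : CommutativeRing.Carrier R)
  (qp≈1 : CommutativeRing._≈_ R (CommutativeRing._*_ R q p) (CommutativeRing.1# R)) where
  open CommutativeRing R renaming (refl to ≈-refl; sym to ≈-sym; trans to ≈-trans) hiding (_-_)
  open import Relation.Binary.Reasoning.Setoid setoid
  open import Algebra.Properties.Semiring.Exp semiring using (_^_; ^-homo-*; ^-congˡ; ^-congʳ) public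
  open import Algebra.Properties.CommutativeSemiring.Exp commutativeSemiring using (^-distrib-*)
  open IntegerSolver R
  open ℕSolver.+-*-Solver using () renaming (solve to solveℕ; con to con′; _:+_ to _:+′_; _:*_ to _:*′_; _:=_ to _:=′_)

  1^≈1 : ∀ n → 1# ^ n ≈ 1#
  1^≈1 zero    = ≈-refl
  1^≈1 (suc n) = ≈-trans (*-identityˡ _) (1^≈1 n)

  q^*p^ : ∀ n → q ^ n * p ^ n ≈ 1#
  q^*p^ n = ≈-trans (≈-sym (^-distrib-* q p n)) (≈-trans (^-congˡ n qp≈1) (1^≈1 n))

  H : ℕ → Carrier
  H zero          = 1#
  H (suc zero)    = W
  H (suc (suc m)) = W * H (suc m) + (p ^ suc m + - 1#) * H m

  -- For p = 1/q and W = 2w this is q^(k(k−n)) H_{n−2k}(w | 1/q), with H_m = 0 for m < 0.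
  φ : ℕ → ℕ → Carrier
  φ n k = p ^ (k ℕ.* (n ℕ.∸ k)) * (if (2 ℕ.* k) ≤ᵇ n then H (n ℕ.∸ 2 ℕ.* k) else 0#)

  φ-large : ∀ {n k} → n < 2 ℕ.* k → φ n k ≈ 0#
  φ-large {n} {k} n<2k with (2 ℕ.* k) ≤ᵇ n in eq
  ... | false = zeroʳ _
  ... | true  = contradiction (ℕₚ.≤ᵇ⇒≤ (2 ℕ.* k) n (subst T (sym eq) _)) (ℕₚ.<⇒≱ n<2k)

  -- The parametrisation n = 2r + d removes both the truncated subtractions and the Boolean test.
  φ-+ : ∀ r d → φ (2 ℕ.* r ℕ.+ d) r ≈ p ^ (r ℕ.* (r ℕ.+ d)) * H d
  φ-+ r d with (2 ℕ.* r) ≤ᵇ (2 ℕ.* r ℕ.+ d) in eq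
  ... | true  = *-cong
    (reflexive (cong (λ e → p ^ (r ℕ.* e)) (trans
      (cong (ℕ._∸ r) (solveℕ 2 (λ r d → con′ 2 :*′ r :+′ d :=′ r :+′ (r :+′ d)) refl r d)) (ℕₚ.m+n∸m≡n r (r ℕ.+ d)))))
    (reflexive (cong H (ℕₚ.m+n∸m≡n (2 ℕ.* r) d)))
  ... | false = ⊥-elim (subst T eq (ℕₚ.≤⇒≤ᵇ (ℕₚ.m≤m+n (2 ℕ.* r) d)))

  module _ (N : ℕ) where

    -- Appending a column: q^r columns keep the rank r, the other q^N − q^r raise it.
    step : (ℕ → Carrier) → ℕ → Carrier
    step ψ r = q ^ r * ψ r + (q ^ N + - (q ^ r)) * ψ (suc r)

    steps : ℕ → (ℕ → Carrier) → ℕ → Carrier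
    steps zero    ψ = ψ
    steps (suc m) ψ = step (steps m ψ)

    step-cong : ∀ {ψ χ} → (∀ r → ψ r ≈ χ r) → ∀ r → step ψ r ≈ step χ r
    step-cong h r = +-cong (*-congˡ (h r)) (*-congˡ (h (suc r)))

    -- Moves one application to the innermost place, where it meets φ and can be expanded by
    -- `step-φ`.
    steps-suc : ∀ m ψ r → steps (suc m) ψ r ≈ steps m (step ψ) r
    steps-suc zero    ψ r = ≈-refl
    steps-suc (suc m) ψ r = step-cong (steps-suc m ψ) r

    -- Ranks above N are never reached, since q ^ N + - (q ^ r) vanishes at r = N.
    steps-cong-≤ : ∀ m {ψ χ} r → r ≤ N → (∀ t → t ≤ r ℕ.+ m → t ≤ N → ψ t ≈ χ t) → steps m ψ r ≈ steps m χ r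
    steps-cong-≤ zero    r r≤N h = h r (ℕₚ.≤-reflexive (sym (ℕₚ.+-identityʳ r))) r≤N
    steps-cong-≤ (suc m) {ψ} {χ} r r≤N h with ℕₚ.m≤n⇒m<n∨m≡n r≤N
    ... | inj₁ r<N = +-cong
      (*-congˡ (steps-cong-≤ m r r≤N (λ t t≤ → h t (ℕₚ.≤-trans t≤ (ℕₚ.+-monoʳ-≤ r (ℕₚ.n≤1+n m))))))
      (*-congˡ (steps-cong-≤ m (suc r) r<N (λ t t≤ → h t (ℕₚ.≤-trans t≤ (ℕₚ.≤-reflexive (sym (ℕₚ.+-suc r m)))))))
    ... | inj₂ refl = +-cong
      (*-congˡ (steps-cong-≤ m r r≤N (λ t t≤ → h t (ℕₚ.≤-trans t≤ (ℕₚ.+-monoʳ-≤ r (ℕₚ.n≤1+n m))))))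
      (≈-trans (vanish (steps m ψ (suc r))) (≈-sym (vanish (steps m χ (suc r)))))
      where
      vanish : ∀ x → (q ^ r + - (q ^ r)) * x ≈ 0#
      vanish x = ≈-trans (*-congʳ (-‿inverseʳ _)) (zeroˡ x)

    steps-linear : ∀ m x y ψ χ r → steps m (λ t → x * ψ t + y * χ t) r ≈ x * steps m ψ r + y * steps m χ r
    steps-linear zero    x y ψ χ r = ≈-refl
    steps-linear (suc m) x y ψ χ r = ≈-trans (step-cong (steps-linear m x y ψ χ) r)
      (solve 8 (λ a b x y ψ χ ψ′ χ′ → a :* (x :* ψ :+ y :* χ) :+ b :* (x :* ψ′ :+ y :* χ′) :=
                                  x :* (a :* ψ :+ b :* ψ′) :+ y :* (a :* χ :+ b :* χ′)) ≈-refl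
        (q ^ r) (q ^ N + - (q ^ r)) x y (steps m ψ r) (steps m χ r) (steps m ψ (suc r)) (steps m χ (suc r)))

    twist : (ℕ → Carrier) → ℕ → Carrier
    twist ψ r = p ^ r * ψ r

    -- The shifted term gains a factor p from p^(r+1) = p · p^r, but the diagonal term does not.
    -- Since q^r p^r = 1, the discrepancy is the plain multiple (1 - p) ψ(r).
    step-twist : ∀ ψ r → step (twist ψ) r ≈ p * twist (step ψ) r + (1# + - p) * ψ r
    step-twist ψ r = begin
      q ^ r * (p ^ r * ψ r) + (q ^ N + - (q ^ r)) * (p * p ^ r * ψ (suc r))
        ≈⟨ solve 6 (λ x y z p u v → x :* (y :* u) :+ (z :+ :- x) :* (p :* y :* v) :=
              (x :* y) :* u :+ (p :* (y :* (x :* u :+ (z :+ :- x) :* v)) :+ :- (p :* u :* (x :* y)))) ≈-refl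
              (q ^ r) (p ^ r) (q ^ N) p (ψ r) (ψ (suc r)) ⟩
      (q ^ r * p ^ r) * ψ r + (p * (p ^ r * step ψ r) + - (p * ψ r * (q ^ r * p ^ r)))
        ≈⟨ +-cong (*-congʳ (q^*p^ r)) (+-congˡ (-‿cong (*-congˡ (q^*p^ r)))) ⟩
      1# * ψ r + (p * (p ^ r * step ψ r) + - (p * ψ r * 1#))
        ≈⟨ solve 3 (λ p u w → con (+ 1) :* u :+ (p :* w :+ :- (p :* u :* con (+ 1))) := p :* w :+ (con (+ 1) :+ :- p) :* u)
             ≈-refl p (ψ r) (p ^ r * step ψ r) ⟩
      p * twist (step ψ) r + (1# + - p) * ψ r ∎

    -- The remainders of the single commutations form the geometric sum (1 - p)(1 + p + ... + p^m) =
    -- 1 - p^(m+1), up to sign the coefficient in the recurrence of `H`.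
    steps-twist : ∀ m ψ r → steps (suc m) (twist ψ) r ≈
                  p ^ suc m * twist (steps (suc m) ψ) r + (1# + - (p ^ suc m)) * steps m ψ r
    steps-twist zero    ψ r = ≈-trans (step-twist ψ r) (≈-sym (+-cong (*-congʳ (*-identityʳ p))
                                (*-congʳ (+-congˡ (-‿cong (*-identityʳ p))))))
    steps-twist (suc m) ψ r = begin
      step (steps (suc m) (twist ψ)) r
        ≈⟨ step-cong (steps-twist m ψ) r ⟩
      step (λ t → p ^ suc m * twist (steps (suc m) ψ) t + (1# + - (p ^ suc m)) * steps m ψ t) r
        ≈⟨ steps-linear 1 (p ^ suc m) (1# + - (p ^ suc m)) (twist (steps (suc m) ψ)) (steps m ψ) r ⟩
      p ^ suc m * step (twist (steps (suc m) ψ)) r + (1# + - (p ^ suc m)) * steps (suc m) ψ r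
        ≈⟨ +-congʳ (*-congˡ (step-twist (steps (suc m) ψ) r)) ⟩
      p ^ suc m * (p * twist (steps (suc (suc m)) ψ) r + (1# + - p) * steps (suc m) ψ r) + (1# + - (p ^ suc m)) * steps (suc m) ψ r
        ≈⟨ solve 4 (λ x p u v → x :* (p :* u :+ (con (+ 1) :+ :- p) :* v) :+ (con (+ 1) :+ :- x) :* v :=
              p :* x :* u :+ (con (+ 1) :+ :- (p :* x)) :* v) ≈-refl (p ^ suc m) p (twist (steps (suc (suc m)) ψ) r) (steps (suc m) ψ r) ⟩
      p ^ suc (suc m) * twist (steps (suc (suc m)) ψ) r + (1# + - (p ^ suc (suc m))) * steps (suc m) ψ r ∎

    -- For n = 2r + d + 1 the recurrence rewrites H_{d+2} in the unshifted term. Its p^(d+1) part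
    -- cancels against the -q^r part of the shifted term, and q^N times the remaining powers of p
    -- becomes p^j because 2r + d + 1 = N + j.
    step-φ : ∀ {n j} → N ℕ.+ j ≡ n → ∀ r → 2 ℕ.* r ≤ n →
             step (φ (suc n)) r ≈ W * φ n r + (p ^ j + - (p ^ r)) * φ (n ℕ.∸ 1) r
    step-φ {n} {j} N+j≡n r 2r≤n with ℕₚ.m≤n⇒∃[o]m+o≡n 2r≤n
    ... | zero , refl = begin
      q ^ r * φ (suc (2 ℕ.* r ℕ.+ 0)) r + (q ^ N + - (q ^ r)) * φ (suc (2 ℕ.* r ℕ.+ 0)) (suc r)
        ≈⟨ +-cong (*-congˡ (≈-trans (reflexive (cong (λ e → φ e r) (sym (ℕₚ.+-suc (2 ℕ.* r) 0)))) (φ-+ r 1)))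
                  (≈-trans (*-congˡ (φ-large {suc (2 ℕ.* r ℕ.+ 0)} {suc r} (ℕₚ.≤-reflexive (solveℕ 1 (λ r → con′ 1 :+′ (con′ 1 :+′ (con′ 2 :*′ r :+′ con′ 0)) :=′ con′ 2 :*′ (con′ 1 :+′ r)) refl r)))) (zeroʳ _)) ⟩
      q ^ r * (p ^ (r ℕ.* (r ℕ.+ 1)) * W) + 0#
        ≈⟨ +-congʳ (*-congˡ (*-congʳ (≈-trans (reflexive (cong (p ^_) (solveℕ 1 (λ r → r :*′ (r :+′ con′ 1) :=′ r :+′ r :*′ (r :+′ con′ 0)) refl r)))
              (^-homo-* p r (r ℕ.* (r ℕ.+ 0)))))) ⟩
      q ^ r * (p ^ r * p ^ (r ℕ.* (r ℕ.+ 0)) * W) + 0#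
        ≈⟨ solve 4 (λ x y z w → x :* (y :* z :* w) :+ con (+ 0) := (x :* y) :* (w :* (z :* con (+ 1)))) ≈-refl (q ^ r) (p ^ r) (p ^ (r ℕ.* (r ℕ.+ 0))) W ⟩
      (q ^ r * p ^ r) * (W * (p ^ (r ℕ.* (r ℕ.+ 0)) * 1#))
        ≈⟨ ≈-trans (*-congʳ (q^*p^ r)) (≈-trans (*-identityˡ _) (≈-sym (+-identityʳ _))) ⟩
      W * (p ^ (r ℕ.* (r ℕ.+ 0)) * 1#) + 0#
        ≈⟨ +-cong (*-congˡ (≈-sym (φ-+ r 0))) (≈-sym (vanish r N+j≡n)) ⟩
      W * φ (2 ℕ.* r ℕ.+ 0) r + (p ^ j + - (p ^ r)) * φ (2 ℕ.* r ℕ.+ 0 ℕ.∸ 1) r ∎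
      where
      vanish : ∀ r → N ℕ.+ j ≡ 2 ℕ.* r ℕ.+ 0 → (p ^ j + - (p ^ r)) * φ (2 ℕ.* r ℕ.+ 0 ℕ.∸ 1) r ≈ 0#
      -- For r = 0 the truncated n - 1 is 0 and φ_0(0) = 1 does not vanish. The coefficient does: n
      -- = 0 forces j = 0.
      vanish zero    eq = ≈-trans (*-congʳ (≈-trans (+-congʳ (reflexive (cong (p ^_) (ℕₚ.m+n≡0⇒n≡0 N eq)))) (-‿inverseʳ _))) (zeroˡ _)
      vanish (suc r) eq = ≈-trans (*-congˡ (φ-large {2 ℕ.* suc r ℕ.+ 0 ℕ.∸ 1} {suc r} (ℕₚ.≤-reflexive (ℕₚ.+-identityʳ (2 ℕ.* suc r))))) (zeroʳ _)
    ... | suc d , refl = begin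
      q ^ r * φ (suc (2 ℕ.* r ℕ.+ suc d)) r + (q ^ N + - (q ^ r)) * φ (suc (2 ℕ.* r ℕ.+ suc d)) (suc r)
        ≈⟨ +-cong (*-congˡ (≈-trans (reflexive (cong (λ e → φ e r) (sym (ℕₚ.+-suc (2 ℕ.* r) (suc d))))) (φ-+ r (suc (suc d)))))
                  (*-congˡ (≈-trans (reflexive (cong (λ e → φ e (suc r)) (solveℕ 2 (λ r d → con′ 1 :+′ (con′ 2 :*′ r :+′ (con′ 1 :+′ d)) :=′ con′ 2 :*′ (con′ 1 :+′ r) :+′ d) refl r d))) (φ-+ (suc r) d))) ⟩
      q ^ r * (p ^ (r ℕ.* (r ℕ.+ suc (suc d))) * (W * H (suc d) + (p ^ suc d + - 1#) * H d)) + (q ^ N + - (q ^ r)) * (p ^ (suc r ℕ.* (suc r ℕ.+ d)) * H d)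
        ≈⟨ +-cong (*-congˡ (*-congʳ e₁)) (*-congˡ (*-congʳ e₂)) ⟩
      x * ((y * (y * b)) * (W * h₁ + (pd + - 1#) * h₀)) + (q ^ N + - x) * ((y * b) * (y * pd) * h₀)
        ≈⟨ solve 8 (λ x y b W h₁ pd h₀ qN →
              x :* ((y :* (y :* b)) :* (W :* h₁ :+ (pd :+ :- con (+ 1)) :* h₀)) :+ (qN :+ :- x) :* ((y :* b) :* (y :* pd) :* h₀) :=
              (x :* y) :* (y :* b :* (W :* h₁ :+ (pd :+ :- con (+ 1)) :* h₀)) :+ b :* (y :* y :* pd :* qN) :* h₀ :+ :- ((x :* y) :* (y :* b) :* pd :* h₀))
              ≈-refl x y b W h₁ pd h₀ (q ^ N) ⟩
      (x * y) * (y * b * (W * h₁ + (pd + - 1#) * h₀)) + b * (y * y * pd * q ^ N) * h₀ + - ((x * y) * (y * b) * pd * h₀)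
        ≈⟨ +-cong (+-cong (*-congʳ (q^*p^ r)) (*-congʳ (*-congˡ e₃))) (-‿cong (*-congʳ (*-congʳ (*-congʳ (q^*p^ r))))) ⟩
      1# * (y * b * (W * h₁ + (pd + - 1#) * h₀)) + b * p ^ j * h₀ + - (1# * (y * b) * pd * h₀)
        ≈⟨ solve 7 (λ y b W h₁ pd h₀ pj →
              con (+ 1) :* (y :* b :* (W :* h₁ :+ (pd :+ :- con (+ 1)) :* h₀)) :+ b :* pj :* h₀ :+ :- (con (+ 1) :* (y :* b) :* pd :* h₀) :=
              W :* (y :* b :* h₁) :+ (pj :+ :- y) :* (b :* h₀)) ≈-refl y b W h₁ pd h₀ (p ^ j) ⟩
      W * (y * b * h₁) + (p ^ j + - y) * (b * h₀)
        ≈⟨ +-cong (*-congˡ (≈-trans (*-congʳ (≈-sym e₄)) (≈-sym (φ-+ r (suc d)))))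
                  (*-congˡ (≈-trans (≈-sym (φ-+ r d)) (reflexive (cong (λ e → φ (e ℕ.∸ 1) r) (sym (ℕₚ.+-suc (2 ℕ.* r) d)))))) ⟩
      W * φ (2 ℕ.* r ℕ.+ suc d) r + (p ^ j + - (p ^ r)) * φ (2 ℕ.* r ℕ.+ suc d ℕ.∸ 1) r ∎
      where
      x = q ^ r
      y = p ^ r
      b = p ^ (r ℕ.* (r ℕ.+ d))
      pd = p ^ suc d
      h₀ = H d
      h₁ = H (suc d)
      e₄ : p ^ (r ℕ.* (r ℕ.+ suc d)) ≈ y * b
      e₄ = ≈-trans (^-congʳ p (solveℕ 2 (λ r d → r :*′ (r :+′ (con′ 1 :+′ d)) :=′ r :+′ r :*′ (r :+′ d)) refl r d)) (^-homo-* p r _)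
      e₁ : p ^ (r ℕ.* (r ℕ.+ suc (suc d))) ≈ y * (y * b)
      e₁ = ≈-trans (^-congʳ p (solveℕ 2 (λ r d → r :*′ (r :+′ (con′ 1 :+′ (con′ 1 :+′ d))) :=′ r :+′ r :*′ (r :+′ (con′ 1 :+′ d))) refl r d))
             (≈-trans (^-homo-* p r _) (*-congˡ e₄))
      e₂ : p ^ (suc r ℕ.* (suc r ℕ.+ d)) ≈ (y * b) * (y * pd)
      e₂ = ≈-trans (^-congʳ p (solveℕ 2 (λ r d → (con′ 1 :+′ r) :*′ ((con′ 1 :+′ r) :+′ d) :=′ r :*′ (r :+′ (con′ 1 :+′ d)) :+′ (r :+′ (con′ 1 :+′ d))) refl r d))
             (≈-trans (^-homo-* p (r ℕ.* (r ℕ.+ suc d)) _) (*-cong e₄ (^-homo-* p r (suc d))))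
      e₃ : y * y * pd * q ^ N ≈ p ^ j
      e₃ = begin
        y * y * pd * q ^ N  ≈⟨ *-congʳ (*-assoc y y pd) ⟩
        y * (y * pd) * q ^ N  ≈⟨ *-congʳ (≈-trans (*-congˡ (≈-sym (^-homo-* p r (suc d)))) (≈-sym (^-homo-* p r _))) ⟩
        p ^ (r ℕ.+ (r ℕ.+ suc d)) * q ^ N  ≈⟨ *-congʳ (^-congʳ p (trans (solveℕ 2 (λ r d → r :+′ (r :+′ (con′ 1 :+′ d)) :=′ con′ 2 :*′ r :+′ (con′ 1 :+′ d)) refl r d) (sym N+j≡n))) ⟩
        p ^ (N ℕ.+ j) * q ^ N  ≈⟨ *-congʳ (^-homo-* p N j) ⟩
        p ^ N * p ^ j * q ^ N  ≈⟨ solve 3 (λ x y z → x :* y :* z := (z :* x) :* y) ≈-refl (p ^ N) (p ^ j) (q ^ N) ⟩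
        (q ^ N * p ^ N) * p ^ j  ≈⟨ ≈-trans (*-congʳ (q^*p^ N)) (*-identityˡ _) ⟩
        p ^ j ∎

    -- The recurrence step meets `X`, which has one application too many for the induction
    -- hypothesis. It occurs once with p^(k+m+1) and once, through the twist evaluated at rank k,
    -- with p^(m+1) p^k, so it cancels.
    steps-φ : ∀ {k} → k ≤ N → ∀ m → steps m (φ (N ℕ.+ k ℕ.+ m)) k ≈ φ (N ℕ.+ k) k * H m
    steps-φ {k} k≤N zero = ≈-trans (reflexive (cong (λ e → φ e k) (ℕₚ.+-identityʳ (N ℕ.+ k)))) (≈-sym (*-identityʳ _))
    -- Here n = N + k, so j = k, and the second coefficient of `step-φ` is zero at rank k.
    steps-φ {k} k≤N (suc zero) = begin
      step (φ (N ℕ.+ k ℕ.+ 1)) k  ≡⟨ cong (λ e → step (φ e) k) (ℕₚ.+-comm (N ℕ.+ k) 1) ⟩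
      step (φ (suc (N ℕ.+ k))) k  ≈⟨ step-φ refl k (ℕₚ.+-mono-≤ k≤N (ℕₚ.≤-reflexive (ℕₚ.+-identityʳ k))) ⟩
      W * φ (N ℕ.+ k) k + (p ^ k + - (p ^ k)) * φ (N ℕ.+ k ℕ.∸ 1) k
        ≈⟨ solve 4 (λ w u x y → w :* u :+ (x :+ :- x) :* y := u :* w) ≈-refl W (φ (N ℕ.+ k) k) (p ^ k) (φ (N ℕ.+ k ℕ.∸ 1) k) ⟩
      φ (N ℕ.+ k) k * W ∎
    steps-φ {k} k≤N (suc (suc m)) = begin
      steps (suc (suc m)) (φ (N ℕ.+ k ℕ.+ suc (suc m))) k
        ≈⟨ steps-suc (suc m) _ k ⟩
      steps (suc m) (step (φ (N ℕ.+ k ℕ.+ suc (suc m)))) k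
        ≈⟨ steps-cong-≤ (suc m) k k≤N expand ⟩
      steps (suc m) (λ r → 1# * (W * φ n₁ r + p ^ (k ℕ.+ suc m) * φ n₀ r) + - 1# * twist (φ n₀) r) k
        ≈⟨ steps-linear (suc m) 1# (- 1#) (λ r → W * φ n₁ r + p ^ (k ℕ.+ suc m) * φ n₀ r) (twist (φ n₀)) k ⟩
      1# * steps (suc m) (λ r → W * φ n₁ r + p ^ (k ℕ.+ suc m) * φ n₀ r) k + - 1# * steps (suc m) (twist (φ n₀)) k
        ≈⟨ +-cong (*-congˡ (steps-linear (suc m) W (p ^ (k ℕ.+ suc m)) (φ n₁) (φ n₀) k)) (*-congˡ (steps-twist m (φ n₀) k)) ⟩
      1# * (W * steps (suc m) (φ n₁) k + p ^ (k ℕ.+ suc m) * X) + - 1# * (p ^ suc m * (p ^ k * X) + (1# + - (p ^ suc m)) * steps m (φ n₀) k)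
        ≈⟨ +-cong (*-congˡ (+-cong (*-congˡ (steps-φ k≤N (suc m))) (*-congʳ (^-homo-* p k (suc m)))))
                  (*-congˡ (+-congˡ (*-congˡ (steps-φ k≤N m)))) ⟩
      1# * (W * (Φ * H (suc m)) + p ^ k * p ^ suc m * X) + - 1# * (p ^ suc m * (p ^ k * X) + (1# + - (p ^ suc m)) * (Φ * H m))
        ≈⟨ solve 7 (λ W Φ h₁ h₀ y z X → con (+ 1) :* (W :* (Φ :* h₁) :+ y :* z :* X) :+ :- con (+ 1) :* (z :* (y :* X) :+ (con (+ 1) :+ :- z) :* (Φ :* h₀)) :=
               Φ :* (W :* h₁ :+ (z :+ :- con (+ 1)) :* h₀)) ≈-refl W Φ (H (suc m)) (H m) (p ^ k) (p ^ suc m) X ⟩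
      φ (N ℕ.+ k) k * H (suc (suc m)) ∎
      where
      n₁ = N ℕ.+ k ℕ.+ suc m
      n₀ = N ℕ.+ k ℕ.+ m
      X = steps (suc m) (φ n₀) k
      Φ = φ (N ℕ.+ k) k
      -- Adding the two bounds on r gives 2r ≤ N + k + m + 1, exactly the range in which `step-φ`
      -- applies.
      expand : ∀ r → r ≤ k ℕ.+ suc m → r ≤ N → step (φ (N ℕ.+ k ℕ.+ suc (suc m))) r ≈
               1# * (W * φ n₁ r + p ^ (k ℕ.+ suc m) * φ n₀ r) + - 1# * twist (φ n₀) r
      expand r r≤k+m r≤N = begin
        step (φ (N ℕ.+ k ℕ.+ suc (suc m))) r  ≡⟨ cong (λ e → step (φ e) r) (ℕₚ.+-suc (N ℕ.+ k) (suc m)) ⟩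
        step (φ (suc n₁)) r
          ≈⟨ step-φ {n₁} {k ℕ.+ suc m} (sym (ℕₚ.+-assoc N k (suc m))) r
               (ℕₚ.≤-trans (ℕₚ.+-mono-≤ r≤N (ℕₚ.≤-trans (ℕₚ.≤-reflexive (ℕₚ.+-identityʳ r)) r≤k+m)) (ℕₚ.≤-reflexive (sym (ℕₚ.+-assoc N k (suc m))))) ⟩
        W * φ n₁ r + (p ^ (k ℕ.+ suc m) + - (p ^ r)) * φ (n₁ ℕ.∸ 1) r
          ≡⟨ cong (λ e → W * φ n₁ r + (p ^ (k ℕ.+ suc m) + - (p ^ r)) * φ (e ℕ.∸ 1) r) (ℕₚ.+-suc (N ℕ.+ k) m) ⟩
        W * φ n₁ r + (p ^ (k ℕ.+ suc m) + - (p ^ r)) * φ n₀ r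
          ≈⟨ solve 5 (λ W u v x y → W :* u :+ (x :+ :- y) :* v := con (+ 1) :* (W :* u :+ x :* v) :+ :- con (+ 1) :* (y :* v))
               ≈-refl W (φ n₁ r) (φ n₀ r) (p ^ (k ℕ.+ suc m)) (p ^ r) ⟩
        1# * (W * φ n₁ r + p ^ (k ℕ.+ suc m) * φ n₀ r) + - 1# * (p ^ r * φ n₀ r) ∎

-- Counting square-zero matrices column by column

module Kernel (F : FiniteField) where
  private module F = FiniteField F
  open F using (elements)
  open LinearAlgebra F
  open IntegerSolver ringF
  open ℕ∑
  open ≡.≡-Reasoning

  -- A matrix, of which only the columns `L` are known so far, times a vector. Entries of the vector
  -- beyond these columns are ignored.
  mulL : ∀ {m n} → List (Vec K n) → Vec K m → Vec K n
  mulL (c ∷ L) (a ∷ v) = mulL L v −[ - a ] c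
  mulL _       _       = 0ᵥ

  Supported : ∀ {m} → ℕ → Vec K m → Set
  Supported s       []      = ⊤
  Supported zero    (a ∷ v) = a ≡ 0# × Supported zero v
  Supported (suc s) (a ∷ v) = Supported s v

  supported? : ∀ {m} s → Decidable (Supported {m} s)
  supported? s       []      = yes tt
  supported? zero    (a ∷ v) = (a F.≟ 0#) ×-dec supported? zero v
  supported? (suc s) (a ∷ v) = supported? s v

  Supported-0ᵥ : ∀ {m} s → Supported {m} s 0ᵥ
  Supported-0ᵥ {zero}  s       = tt
  Supported-0ᵥ {suc m} zero    = refl , Supported-0ᵥ {m} zero
  Supported-0ᵥ {suc m} (suc s) = Supported-0ᵥ {m} s

  Supported-zero : ∀ {m} {v : Vec K m} → Supported 0 v → v ≡ 0ᵥ
  Supported-zero {v = []}    _          = refl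
  Supported-zero {v = a ∷ v} (refl , p) = cong (0# ∷_) (Supported-zero p)

  Supported-mono : ∀ {m s t} (v : Vec K m) → s ≤ t → Supported s v → Supported t v
  Supported-mono {s = s} {t} []      s≤t         p       = tt
  Supported-mono {s = zero} {zero}  (a ∷ v) s≤t p       = p
  Supported-mono {s = zero} {suc t} (a ∷ v) s≤t (_ , p) = Supported-mono v ℕ.z≤n p
  Supported-mono {s = suc s} {suc t} (a ∷ v) (ℕ.s≤s s≤t) p = Supported-mono v s≤t p

  Supported-− : ∀ {m} s (u v : Vec K m) b → Supported s u → Supported s v → Supported s (u −[ b ] v)
  Supported-− s       []      []      b p q = tt
  Supported-− zero    (a ∷ u) (c ∷ v) b (refl , p) (refl , q) =
    solve 1 (λ b → con (+ 0) :+ :- (b :* con (+ 0)) := con (+ 0)) refl b , Supported-− zero u v b p q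
  Supported-− (suc s) (a ∷ u) (c ∷ v) b p q = Supported-− s u v b p q

  mulL-0ᵥ : ∀ {m n} (L : List (Vec K n)) → mulL L (0ᵥ {m}) ≡ 0ᵥ
  mulL-0ᵥ {zero}  []      = refl
  mulL-0ᵥ {zero}  (c ∷ L) = refl
  mulL-0ᵥ {suc m} []      = refl
  mulL-0ᵥ {suc m} (c ∷ L) = trans (cong₂ (λ u a → u −[ a ] c) (mulL-0ᵥ {m} L)
    (solve 0 (:- con (+ 0) := con (+ 0)) refl)) (−-0 0ᵥ c)

  mulL-− : ∀ {m n} (L : List (Vec K n)) (u v : Vec K m) b → mulL L (u −[ b ] v) ≡ mulL L u −[ b ] mulL L v
  mulL-− []      []      []      b = sym (0−0 b)
  mulL-− []      (_ ∷ _) (_ ∷ _) b = sym (0−0 b)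
  mulL-− (c ∷ L) []      []      b = sym (0−0 b)
  mulL-− (c ∷ L) (x ∷ u) (y ∷ v) b = begin
    mulL L (u −[ b ] v) −[ - (x + - (b * y)) ] c
      ≡⟨ cong₂ (λ w a → w −[ a ] c) (mulL-− L u v b)
           (solve 3 (λ x b y → :- (x :+ :- (b :* y)) := :- x :+ :- (b :* :- y)) refl x b y) ⟩
    (mulL L u −[ b ] mulL L v) −[ - x + - (b * - y) ] c
      ≡⟨ −-−-same (mulL L u) (- x) c b (mulL L v) (- y) ⟨
    (mulL L u −[ - x ] c) −[ b ] (mulL L v −[ - y ] c) ∎

  -- The columns of `M` meet only zero entries of `v`. Hence the condition X² = 0 at a column
  -- involves columns of earlier blocks alone, and the matrix can be built from left to right.
  mulL-++ : ∀ {m n s} (L M : List (Vec K n)) (v : Vec K m) → s ≤ length L → Supported s v →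
            mulL (L ++ M) v ≡ mulL L v
  mulL-++ [] M v ℕ.z≤n p = trans (cong (mulL M) (Supported-zero p)) (trans (mulL-0ᵥ M) (sym (mulL-[] v)))
    where
    mulL-[] : ∀ {m n} (v : Vec K m) → mulL {n = n} [] v ≡ 0ᵥ
    mulL-[] []      = refl
    mulL-[] (_ ∷ _) = refl
  mulL-++                (c ∷ L) M []      s≤          p       = refl
  mulL-++ {s = zero}     (c ∷ L) M (a ∷ v) s≤          (_ , p) = cong (_−[ - a ] c) (mulL-++ L M v ℕ.z≤n p)
  mulL-++ {s = suc s}    (c ∷ L) M (a ∷ v) (ℕ.s≤s s≤) p       = cong (_−[ - a ] c) (mulL-++ L M v s≤ p)

  -- A vector supported on the first `length L` entries is a coefficient vector for `L` padded with
  -- zeros.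
  ∑-kernel : ∀ {n} (L : List (Vec K n)) {m} → length L ≤ m → ∀ u →
             ∑ (vecs m) (λ v → when (supported? (length L) v ×-dec (mulL L v ≟ᵥ u)) 1) ≡ fibre L u
  ∑-kernel []      {m} _ u = trans
    (∑-single _ (vecs-unique m) (∈-vecs 0ᵥ)
      (λ {v} _ v≢0 → when-no (supported? 0 v ×-dec (mulL [] v ≟ᵥ u)) (λ (p , _) → v≢0 (Supported-zero p))))
    (when-cong (supported? {m} 0 0ᵥ ×-dec (mulL [] (0ᵥ {m}) ≟ᵥ u)) (u ≟ᵥ 0ᵥ)
      (λ (_ , eq) → trans (sym eq) (mulL-0ᵥ {m} []))
      (λ eq → Supported-0ᵥ {m} 0 , trans (mulL-0ᵥ {m} []) (sym eq)) (λ _ → refl))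
  ∑-kernel (c ∷ L) {suc m} (ℕ.s≤s len) u = begin
    ∑ (vecs (suc m)) _
      ≡⟨ ∑-concatMap (λ a → map (a ∷_) (vecs m)) elements _ ⟩
    ∑ elements (λ a → ∑ (map (a ∷_) (vecs m)) _)
      ≡⟨ ∑-cong′ elements (λ a → trans (∑-map (a ∷_) (vecs m) _) (trans
          (∑-cong′ (vecs m) (λ v → when-cong (supported? (length L) v ×-dec (mulL L v −[ - a ] c ≟ᵥ u))
            (supported? (length L) v ×-dec (mulL L v ≟ᵥ u −[ a ] c))
            (map₂ (λ { refl → sym (−-cancel′ (mulL L v) a c) }))
            (map₂ (λ eq → trans (cong (_−[ - a ] c) eq) (−-cancel u a c)))
            (λ _ → refl)))
          (∑-kernel L len (u −[ a ] c)))) ⟩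
    ∑ elements (λ a → fibre L (u −[ a ] c)) ∎

  -- v may follow the columns L inside a block starting at index s: it lives on the rows of the
  -- earlier blocks and is annihilated by the matrix.
  Admissible : ∀ {n} → List (Vec K n) → ℕ → Vec K n → Set
  Admissible L s v = Supported s v × mulL L v ≡ 0ᵥ

  admissible? : ∀ {n} (L : List (Vec K n)) s → Decidable (Admissible L s)
  admissible? L s v = supported? s v ×-dec (mulL L v ≟ᵥ 0ᵥ)

  card-Admissible : ∀ {n} (L : List (Vec K n)) → length L ≤ n →
                    ∑ (vecs n) (λ v → when (admissible? L (length L) v) 1) ≡ order ℕ.^ (length L ℕ.∸ rk L)
  card-Admissible L len = trans (∑-kernel L len 0ᵥ) (fibre-0 L)

  -- Admissible vectors form a subspace. This is why all q^r vectors in the span of the earlier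
  -- columns are permitted as the next column.
  Span-Admissible : ∀ {n} {L : List (Vec K n)} {s} M → All (Admissible L s) M →
                    ∀ {u} → Span M u → Admissible L s u
  Span-Admissible {n} {L} {s} []      []       refl    = Supported-0ᵥ {n} s , mulL-0ᵥ {n} L
  Span-Admissible {n} {L} {s} (c ∷ M) ((p , q) ∷ hs) {u} (a , r) with Span-Admissible {L = L} M hs r
  ... | p′ , q′ = subst (Admissible L s) (−-cancel u a c)
    (Supported-− s (u −[ a ] c) c (- a) p′ p ,
     trans (mulL-− L (u −[ a ] c) c (- a)) (trans (cong₂ (λ x y → x −[ - a ] y) q′ q) (0−0 (- a))))

  Admissible-++⁺ : ∀ {n} (L M : List (Vec K n)) {s v} → s ≤ length L → Admissible L s v → Admissible (L ++ M) s v
  Admissible-++⁺ L M {v = v} s≤ (p , q) = p , trans (mulL-++ L M v s≤ p) q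

  Admissible-++⁻ : ∀ {n} (L M : List (Vec K n)) {s v} → s ≤ length L → Admissible (L ++ M) s v → Admissible L s v
  Admissible-++⁻ L M {v = v} s≤ (p , q) = p , trans (sym (mulL-++ L M v s≤ p)) q

  -- The column space lies in the kernel because the matrix squares to zero; comparing sizes gives
  -- the bound k ≤ N on which `steps-φ` relies.
  2rk≤length : ∀ {n} (L : List (Vec K n)) → length L ≤ n → All (Admissible L (length L)) L → rk L ≤ length L ℕ.∸ rk L
  2rk≤length {n} L len adm = order^-cancel-≤ (≡.subst₂ _≤_ (card-Span L) (card-Admissible L len)
    (∑-mono-≤ (vecs n) (λ v → when-mono-≤ (span? L v) (admissible? L (length L) v) (Span-Admissible {L = L} L adm))))

  Admissibles : ∀ {n} (L : List (Vec K n)) (bs : List ℕ) → Vec (Vec K n) (length bs) → Set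
  Admissibles L []       []       = ⊤
  Admissibles L (s ∷ bs) (y ∷ ys) = Admissible L s y × Admissibles (L ∷ʳ y) bs ys

  admissibles? : ∀ {n} (L : List (Vec K n)) bs → Decidable (Admissibles L bs)
  admissibles? L []       []       = yes tt
  admissibles? L (s ∷ bs) (y ∷ ys) = admissible? L s y ×-dec admissibles? (L ∷ʳ y) bs ys

-- For every column, the index at which its block starts.
starts : ℕ → List ℕ → List ℕ
starts s []       = []
starts s (l ∷ ls) = replicate l s ++ starts (s ℕ.+ l) ls

-- Sums over the choices of successive columns

module ColumnSums (F : FiniteField) {c ℓ} (R : CommutativeRing c ℓ) where
  private module F = FiniteField F
  open LinearAlgebra F using (K; span?; rk; vecs; order; card-Span; rk-∷ʳ; rk-dependent; rk-independent; rk≤length)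
  open Kernel F
  open CommutativeRing R renaming (refl to ≈-refl; sym to ≈-sym; trans to ≈-trans) hiding (_-_)
  open import Relation.Binary.Reasoning.Setoid setoid
  open import Algebra.Properties.Semiring.Mult semiring using (×1-homo-*) renaming (_×_ to _⋆_)
  open IntegerSolver R using (solve; _:+_; _:*_; :-_; _:=_; con)
  open Sum commutativeSemiring

  ∑-count : ∀ {A : Set} {P : A → Set} (P? : Decidable P) (xs : List A) x →
            ∑ xs (λ v → when (P? v) x) ≈ (ℕ∑.∑ xs (λ v → ℕ∑.when (P? v) 1) ⋆ 1#) * x
  ∑-count P? []       x = ≈-sym (zeroˡ x)
  ∑-count P? (v ∷ xs) x with does (P? v)
  ... | true  = ≈-trans (+-cong (≈-sym (*-identityˡ x)) (∑-count P? xs x)) (≈-sym (distribʳ x 1# _))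
  ... | false = ≈-trans (+-identityˡ _) (∑-count P? xs x)

  module _ (q p W : Carrier) (qp≈1 : q * p ≈ 1#) (q≈order : q ≈ order ⋆ 1#) where
    open HermiteProducts R q p W qp≈1

    order^⋆1 : ∀ m → (order ℕ.^ m) ⋆ 1# ≈ q ^ m
    order^⋆1 zero    = +-identityʳ 1#
    order^⋆1 (suc m) = ≈-trans (×1-homo-* order (order ℕ.^ m)) (*-cong (≈-sym q≈order) (order^⋆1 m))

    module _ {n : ℕ} where

      -- `L` is the corner at the start of the block and `M` holds the columns already appended to
      -- it. The function `χ` depends on the new column only through the resulting rank.
      ∑-next-column : ∀ (L M : List (Vec K n)) → length L ≤ n → All (Admissible L (length L)) (L ++ M) →
        (χ : Vec K n → Carrier) (g : ℕ → Carrier) →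
        (∀ v → Admissible L (length L) v → χ v ≈ g (rk ((L ++ M) ∷ʳ v))) →
        ∑ (vecs n) (λ v → when (admissible? (L ++ M) (length L) v) (χ v)) ≈ step (length L ℕ.∸ rk L) g (rk (L ++ M))
      ∑-next-column L M len adm χ g h = begin
        -- Adding the span once more at rank r + 1 replaces the difference of kernel and span by
        -- sums over two full subspaces of known size.
        S  ≈⟨ solve 2 (λ s t → s := (s :+ t) :+ :- t) ≈-refl S (q ^ r * g (suc r)) ⟩
        (S + q ^ r * g (suc r)) + - (q ^ r * g (suc r))  ≈⟨ +-congʳ key ⟩
        (q ^ r * g r + q ^ N * g (suc r)) + - (q ^ r * g (suc r))
          ≈⟨ solve 4 (λ x y a b → (x :* a :+ y :* b) :+ :- (x :* b) := x :* a :+ (y :+ :- x) :* b) ≈-refl (q ^ r) (q ^ N) (g r) (g (suc r)) ⟩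
        q ^ r * g r + (q ^ N + - (q ^ r)) * g (suc r)  ∎
        where
        r = rk (L ++ M)
        N = length L ℕ.∸ rk L
        adm? = admissible? L (length L)
        S = ∑ (vecs n) (λ v → when (admissible? (L ++ M) (length L) v) (χ v))
        in-span : ∀ x → ∑ (vecs n) (λ v → when (span? (L ++ M) v) x) ≈ q ^ r * x
        in-span x = ≈-trans (∑-count (span? (L ++ M)) (vecs n) x)
          (*-congʳ (≈-trans (reflexive (cong (_⋆ 1#) (card-Span (L ++ M)))) (order^⋆1 r)))
        in-kernel : ∀ x → ∑ (vecs n) (λ v → when (adm? v) x) ≈ q ^ N * x
        in-kernel x = ≈-trans (∑-count adm? (vecs n) x)
          (*-congʳ (≈-trans (reflexive (cong (_⋆ 1#) (card-Admissible L len))) (order^⋆1 N)))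
        pointwise : ∀ v → when (admissible? (L ++ M) (length L) v) (χ v) + when (span? (L ++ M) v) (g (suc r)) ≈
                          when (span? (L ++ M) v) (g r) + when (adm? v) (g (suc r))
        pointwise v with span? (L ++ M) v
        ... | yes v∈ = +-cong
          (≈-trans (when-yes (admissible? (L ++ M) (length L) v) (Admissible-++⁺ L M ℕₚ.≤-refl adm-v))
            (≈-trans (h v adm-v) (reflexive (cong g (trans (rk-∷ʳ (L ++ M) v) (rk-dependent (L ++ M) v∈))))))
          (≈-sym (when-yes (adm? v) adm-v))
          where
          adm-v : Admissible L (length L) v
          adm-v = Span-Admissible {L = L} (L ++ M) adm v∈
        ... | no v∉ = ≈-trans (+-comm _ _) (+-congˡ
          (when-cong (admissible? (L ++ M) (length L) v) (adm? v)
            (Admissible-++⁻ L M ℕₚ.≤-refl) (Admissible-++⁺ L M ℕₚ.≤-refl)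
            (λ adm-v → ≈-trans (h v (Admissible-++⁻ L M ℕₚ.≤-refl adm-v))
              (reflexive (cong g (trans (rk-∷ʳ (L ++ M) v) (rk-independent (L ++ M) v∉)))))))
        key : S + q ^ r * g (suc r) ≈ q ^ r * g r + q ^ N * g (suc r)
        key = begin
          S + q ^ r * g (suc r)  ≈⟨ +-congˡ (in-span (g (suc r))) ⟨
          S + ∑ (vecs n) (λ v → when (span? (L ++ M) v) (g (suc r)))  ≈⟨ ∑-distrib-+ (vecs n) _ _ ⟨
          ∑ (vecs n) (λ v → when (admissible? (L ++ M) (length L) v) (χ v) + when (span? (L ++ M) v) (g (suc r)))
            ≈⟨ ∑-cong′ (vecs n) pointwise ⟩
          ∑ (vecs n) (λ v → when (span? (L ++ M) v) (g r) + when (adm? v) (g (suc r)))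
            ≈⟨ ∑-distrib-+ (vecs n) _ _ ⟩
          ∑ (vecs n) (λ v → when (span? (L ++ M) v) (g r)) + ∑ (vecs n) (λ v → when (adm? v) (g (suc r)))
            ≈⟨ +-cong (in-span (g r)) (in-kernel (g (suc r))) ⟩
          q ^ r * g r + q ^ N * g (suc r) ∎

      columnSum : (ℕ → Carrier) → List (Vec K n) → List ℕ → Carrier
      columnSum ψ L []       = ψ (rk L)
      columnSum ψ L (s ∷ bs) = ∑ (vecs n) (λ v → when (admissible? L s v) (columnSum ψ (L ∷ʳ v) bs))

      -- `M` grows while `L` stays fixed: the columns of one block share a start and hence a kernel,
      -- so a single operator is iterated. The function `g` is the value once the block is complete.
      columnSum-block : ∀ ψ bs (g : ℕ → Carrier) (L : List (Vec K n)) → length L ≤ n → ∀ j M →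
        All (Admissible L (length L)) (L ++ M) →
        (∀ M′ → length M′ ≡ length M ℕ.+ j → All (Admissible L (length L)) (L ++ M′) →
          columnSum ψ (L ++ M′) bs ≈ g (rk (L ++ M′))) →
        columnSum ψ (L ++ M) (replicate j (length L) ++ bs) ≈ steps (length L ℕ.∸ rk L) j g (rk (L ++ M))
      columnSum-block ψ bs g L len zero    M adm h = h M (sym (ℕₚ.+-identityʳ _)) adm
      columnSum-block ψ bs g L len (suc j) M adm h = ∑-next-column L M len adm _ (steps (length L ℕ.∸ rk L) j g) (λ v adm-v → ≈-trans
        (reflexive (cong (λ X → columnSum ψ X (replicate j (length L) ++ bs)) (++-assoc L M (v ∷ []))))
        (≈-trans
          (columnSum-block ψ bs g L len j (M ∷ʳ v)
            (subst (All (Admissible L (length L))) (++-assoc L M (v ∷ [])) (Allₚ.∷ʳ⁺ adm adm-v))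
            (λ M′ len′ → h M′ (trans len′ (trans (cong (ℕ._+ j) (trans (length-++ M) (ℕₚ.+-comm (length M) 1)))
               (sym (ℕₚ.+-suc (length M) j))))))
          (reflexive (cong (λ X → steps (length L ℕ.∸ rk L) j g (rk X)) (sym (++-assoc L M (v ∷ [])))))))

      hermiteProduct : List ℕ → Carrier
      hermiteProduct ls = foldr _*_ 1# (map H ls)

      -- The sum over all completions sees only the size and the rank of the corner. This form
      -- survives a block, since `steps-φ` returns φ of the old corner times `H l`, and induction on
      -- the remaining blocks applies.
      columnSum-starts : ∀ ls (L : List (Vec K n)) → length L ℕ.+ sumℕ ls ≡ n → All (Admissible L (length L)) L →
        columnSum (φ n) L (starts (length L) ls) ≈ φ (length L) (rk L) * hermiteProduct ls
      columnSum-starts []       L len adm = ≈-trans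
        (reflexive (cong (λ m → φ m (rk L)) (trans (sym len) (ℕₚ.+-identityʳ _)))) (≈-sym (*-identityʳ _))
      columnSum-starts (l ∷ ls) L len adm = begin
        columnSum (φ n) L (replicate l s ++ starts (s ℕ.+ l) ls)
          ≡⟨ cong (λ X → columnSum (φ n) X (replicate l s ++ starts (s ℕ.+ l) ls)) (++-identityʳ L) ⟨
        columnSum (φ n) (L ++ []) (replicate l s ++ starts (s ℕ.+ l) ls)
          -- The summand `0# * 0#` brings a scalar multiple into the two-term form that
          -- `steps-linear` expects.
          ≈⟨ columnSum-block (φ n) (starts (s ℕ.+ l) ls) (λ r → P * φ (s ℕ.+ l) r + 0# * 0#) L s≤n l []
               (subst (All (Admissible L s)) (sym (++-identityʳ L)) adm) after ⟩
        steps N l (λ r → P * φ (s ℕ.+ l) r + 0# * 0#) (rk (L ++ []))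
          ≡⟨ cong (λ X → steps N l (λ r → P * φ (s ℕ.+ l) r + 0# * 0#) (rk X)) (++-identityʳ L) ⟩
        steps N l (λ r → P * φ (s ℕ.+ l) r + 0# * 0#) k
          ≈⟨ steps-linear N l P 0# (φ (s ℕ.+ l)) (λ _ → 0#) k ⟩
        P * steps N l (φ (s ℕ.+ l)) k + 0# * steps N l (λ _ → 0#) k
          ≈⟨ ≈-trans (+-congˡ (zeroˡ _)) (+-identityʳ _) ⟩
        P * steps N l (φ (s ℕ.+ l)) k
          ≡⟨ cong (λ m → P * steps N l (φ (m ℕ.+ l)) k) N+k≡s ⟨
        P * steps N l (φ (N ℕ.+ k ℕ.+ l)) k
          ≈⟨ *-congˡ (steps-φ N (2rk≤length L s≤n adm) l) ⟩
        P * (φ (N ℕ.+ k) k * H l)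
          ≡⟨ cong (λ m → P * (φ m k * H l)) N+k≡s ⟩
        P * (φ s k * H l)
          ≈⟨ solve 3 (λ x y z → x :* (y :* z) := y :* (z :* x)) ≈-refl P (φ s k) (H l) ⟩
        φ s k * (H l * P) ∎
        where
        s = length L
        k = rk L
        N = s ℕ.∸ k
        P = hermiteProduct ls
        s≤n : s ≤ n
        s≤n = ℕₚ.m+n≤o⇒m≤o s (ℕₚ.≤-reflexive len)
        N+k≡s : N ℕ.+ k ≡ s
        N+k≡s = ℕₚ.m∸n+n≡m (rk≤length L)
        after : ∀ M′ → length M′ ≡ 0 ℕ.+ l → All (Admissible L s) (L ++ M′) →
                columnSum (φ n) (L ++ M′) (starts (s ℕ.+ l) ls) ≈ P * φ (s ℕ.+ l) (rk (L ++ M′)) + 0# * 0#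
        after M′ refl adm′ = begin
          columnSum (φ n) (L ++ M′) (starts (s ℕ.+ length M′) ls)
            ≡⟨ cong (λ m → columnSum (φ n) (L ++ M′) (starts m ls)) (length-++ L) ⟨
          columnSum (φ n) (L ++ M′) (starts (length (L ++ M′)) ls)
            ≈⟨ columnSum-starts ls (L ++ M′) (trans (cong (ℕ._+ sumℕ ls) (length-++ L)) (trans (ℕₚ.+-assoc s _ _) len))
                 -- Columns admissible for the old corner remain so for the enlarged one: the
                 -- allowed support grows, and the new columns meet only zero entries.
                 (All.map (λ { {v} (p , q) → Supported-mono v (ℕₚ.≤-trans (ℕₚ.m≤m+n s (length M′)) (ℕₚ.≤-reflexive (sym (length-++ L)))) p
                                          , trans (mulL-++ L M′ v ℕₚ.≤-refl p) q }) adm′) ⟩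
          φ (length (L ++ M′)) (rk (L ++ M′)) * P
            ≡⟨ cong (λ m → φ m (rk (L ++ M′)) * P) (length-++ L) ⟩
          φ (s ℕ.+ length M′) (rk (L ++ M′)) * P
            ≈⟨ solve 2 (λ x y → x :* y := y :* x :+ con (+ 0) :* con (+ 0)) ≈-refl _ P ⟩
          P * φ (s ℕ.+ length M′) (rk (L ++ M′)) + 0# * 0# ∎

      ∑-Admissibles : ∀ ψ bs L →
        ∑ (allVecs (vecs n) (length bs)) (λ Y → when (admissibles? L bs Y) (ψ (rk (L ++ V.toList Y)))) ≈ columnSum ψ L bs
      ∑-Admissibles ψ []       L = ≈-trans (+-identityʳ _) (reflexive (cong (λ X → ψ (rk X)) (++-identityʳ L)))
      ∑-Admissibles ψ (s ∷ bs) L = begin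
        ∑ (allVecs (vecs n) (suc (length bs))) _
          ≈⟨ ∑-concatMap (λ y → map (y ∷_) (allVecs (vecs n) (length bs))) (vecs n) _ ⟩
        ∑ (vecs n) (λ y → ∑ (map (y ∷_) (allVecs (vecs n) (length bs))) _)
          ≈⟨ ∑-cong′ (vecs n) (λ y → ≈-trans (∑-map (y ∷_) (allVecs (vecs n) (length bs)) _) (first y)) ⟩
        ∑ (vecs n) (λ y → when (admissible? L s y) (columnSum ψ (L ∷ʳ y) bs)) ∎
        where
        first : ∀ y → ∑ (allVecs (vecs n) (length bs)) (λ Y →
                   when (admissible? L s y ×-dec admissibles? (L ∷ʳ y) bs Y) (ψ (rk (L ++ y ∷ V.toList Y)))) ≈
                 when (admissible? L s y) (columnSum ψ (L ∷ʳ y) bs)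
        first y = begin
          ∑ (allVecs (vecs n) (length bs)) (λ Y →
            when (admissible? L s y ×-dec admissibles? (L ∷ʳ y) bs Y) (ψ (rk (L ++ y ∷ V.toList Y))))
            ≈⟨ ∑-cong′ (allVecs (vecs n) (length bs)) (λ Y → ≈-trans
                 (when-× (admissible? L s y) (admissibles? (L ∷ʳ y) bs Y) _)
                 (reflexive (cong (λ X → when (admissible? L s y) (when (admissibles? (L ∷ʳ y) bs Y) (ψ (rk X))))
                   (sym (++-assoc L (y ∷ []) (V.toList Y)))))) ⟩
          ∑ (allVecs (vecs n) (length bs)) (λ Y →
            when (admissible? L s y) (when (admissibles? (L ∷ʳ y) bs Y) (ψ (rk ((L ∷ʳ y) ++ V.toList Y)))))
            ≈⟨ ∑-when (admissible? L s y) (allVecs (vecs n) (length bs)) _ ⟩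
          when (admissible? L s y) (∑ (allVecs (vecs n) (length bs)) (λ Y →
            when (admissibles? (L ∷ʳ y) bs Y) (ψ (rk ((L ∷ʳ y) ++ V.toList Y)))))
            ≈⟨ when-cong (admissible? L s y) (admissible? L s y) id id (λ _ → ∑-Admissibles ψ bs (L ∷ʳ y)) ⟩
          when (admissible? L s y) (columnSum ψ (L ∷ʳ y) bs) ∎

-- Polynomials

private
  ℕ→ℚᵘ : ℕ → ℚᵘ.ℚᵘ
  ℕ→ℚᵘ n = ℚᵘ.mkℚᵘ (+ n) 0

  toℚᵘ-ℕ→ℚ : ∀ n → ℚ.toℚᵘ (ℕ→ℚ n) ℚᵘ.≃ ℕ→ℚᵘ n
  toℚᵘ-ℕ→ℚ n = ℚₚ.toℚᵘ-fromℚᵘ (ℕ→ℚᵘ n)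

-- Computed with unnormalised rationals, where adding fractions with denominator 1 involves no
-- division by a gcd.
ℕ→ℚ-+ : ∀ m n → ℕ→ℚ (m ℕ.+ n) ≡ ℕ→ℚ m ℚ.+ ℕ→ℚ n
ℕ→ℚ-+ m n = ℚₚ.toℚᵘ-injective (begin
  ℚ.toℚᵘ (ℕ→ℚ (m ℕ.+ n))  ≈⟨ toℚᵘ-ℕ→ℚ (m ℕ.+ n) ⟩
  ℕ→ℚᵘ (m ℕ.+ n)  ≡⟨ cong (λ i → ℚᵘ.mkℚᵘ i 0) (trans (ℤₚ.pos-+ m n) (sym (cong₂ ℤ._+_ (ℤₚ.*-identityʳ (+ m)) (ℤₚ.*-identityʳ (+ n))))) ⟩
  ℕ→ℚᵘ m ℚᵘ.+ ℕ→ℚᵘ n  ≈⟨ ℚᵘₚ.+-cong (toℚᵘ-ℕ→ℚ m) (toℚᵘ-ℕ→ℚ n) ⟨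
  ℚ.toℚᵘ (ℕ→ℚ m) ℚᵘ.+ ℚ.toℚᵘ (ℕ→ℚ n)  ≈⟨ ℚₚ.toℚᵘ-homo-+ (ℕ→ℚ m) (ℕ→ℚ n) ⟨
  ℚ.toℚᵘ (ℕ→ℚ m ℚ.+ ℕ→ℚ n)  ∎)
  where open ℚᵘₚ.≃-Reasoning

ℕ→ℚ-* : ∀ m n → ℕ→ℚ (m ℕ.* n) ≡ ℕ→ℚ m ℚ.* ℕ→ℚ n
ℕ→ℚ-* zero    n = sym (ℚₚ.*-zeroˡ (ℕ→ℚ n))
ℕ→ℚ-* (suc m) n = begin
  ℕ→ℚ (n ℕ.+ m ℕ.* n)  ≡⟨ ℕ→ℚ-+ n (m ℕ.* n) ⟩
  ℕ→ℚ n ℚ.+ ℕ→ℚ (m ℕ.* n)  ≡⟨ cong₂ ℚ._+_ (sym (ℚₚ.*-identityˡ (ℕ→ℚ n))) (ℕ→ℚ-* m n) ⟩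
  1ℚ ℚ.* ℕ→ℚ n ℚ.+ ℕ→ℚ m ℚ.* ℕ→ℚ n ≡⟨ ℚₚ.*-distribʳ-+ (ℕ→ℚ n) 1ℚ (ℕ→ℚ m) ⟨
  (1ℚ ℚ.+ ℕ→ℚ m) ℚ.* ℕ→ℚ n  ≡⟨ cong (ℚ._* ℕ→ℚ n) (ℕ→ℚ-+ 1 m) ⟨
  ℕ→ℚ (suc m) ℚ.* ℕ→ℚ n  ∎
  where open ≡.≡-Reasoning

ℕ→ℚ-injective : ∀ {m n} → ℕ→ℚ m ≡ ℕ→ℚ n → m ≡ n
ℕ→ℚ-injective {m} {n} eq with ℚᵘₚ.≃-trans (ℚᵘₚ.≃-sym (toℚᵘ-ℕ→ℚ m)) (ℚᵘₚ.≃-trans (ℚᵘₚ.≃-reflexive (cong ℚ.toℚᵘ eq)) (toℚᵘ-ℕ→ℚ n))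
... | ℚᵘ.*≡* e = ℤₚ.+-injective (trans (sym (ℤₚ.*-identityʳ (+ m))) (trans e (ℤₚ.*-identityʳ (+ n))))

*-inv : ∀ {x} → x ≢ 0ℚ → x ℚ.* inv x ≡ 1ℚ
*-inv {x} x≢0 with x ℚ.≟ 0ℚ
... | yes x≡0  = ⊥-elim (x≢0 x≡0)
... | no x≢0′ = ℚₚ.*-inverseʳ x {{ℚ.≢-nonZero x≢0′}}

*-nonzero : ∀ {x y} → x ≢ 0ℚ → y ≢ 0ℚ → x ℚ.* y ≢ 0ℚ
*-nonzero {x} {y} x≢0 y≢0 xy≡0 = y≢0 (begin
  y  ≡⟨ ℚₚ.*-identityˡ y ⟨
  1ℚ ℚ.* y  ≡⟨ cong (ℚ._* y) (trans (sym (*-inv x≢0)) (ℚₚ.*-comm x (inv x))) ⟩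
  (inv x ℚ.* x) ℚ.* y  ≡⟨ ℚₚ.*-assoc (inv x) x y ⟩
  inv x ℚ.* (x ℚ.* y)  ≡⟨ cong (inv x ℚ.*_) xy≡0 ⟩
  inv x ℚ.* 0ℚ  ≡⟨ ℚₚ.*-zeroʳ (inv x) ⟩
  0ℚ  ∎)
  where open ≡.≡-Reasoning

*-cancelˡ : ∀ {x y z} → x ≢ 0ℚ → x ℚ.* y ≡ x ℚ.* z → y ≡ z
*-cancelˡ {x} {y} {z} x≢0 eq = begin
  y  ≡⟨ ℚₚ.*-identityˡ y ⟨
  1ℚ ℚ.* y  ≡⟨ cong (ℚ._* y) (trans (sym (*-inv x≢0)) (ℚₚ.*-comm x (inv x))) ⟩
  (inv x ℚ.* x) ℚ.* y  ≡⟨ ℚₚ.*-assoc (inv x) x y ⟩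
  inv x ℚ.* (x ℚ.* y)  ≡⟨ cong (inv x ℚ.*_) eq ⟩
  inv x ℚ.* (x ℚ.* z)  ≡⟨ ℚₚ.*-assoc (inv x) x z ⟨
  (inv x ℚ.* x) ℚ.* z  ≡⟨ cong (ℚ._* z) (trans (ℚₚ.*-comm (inv x) x) (*-inv x≢0)) ⟩
  1ℚ ℚ.* z  ≡⟨ ℚₚ.*-identityˡ z ⟩
  z  ∎
  where open ≡.≡-Reasoning

inv-unique : ∀ {x y} → x ℚ.* y ≡ 1ℚ → inv x ≡ y
inv-unique {x} {y} xy≡1 = *-cancelˡ x≢0 (trans (*-inv x≢0) (sym xy≡1))
  where
  x≢0 : x ≢ 0ℚ
  x≢0 refl = case trans (sym (ℚₚ.*-zeroˡ y)) xy≡1 of λ ()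

inv-* : ∀ {x y} → x ≢ 0ℚ → y ≢ 0ℚ → inv (x ℚ.* y) ≡ inv x ℚ.* inv y
inv-* {x} {y} x≢0 y≢0 = inv-unique {x ℚ.* y} (begin
  (x ℚ.* y) ℚ.* (inv x ℚ.* inv y)
    ≡⟨ solve 4 (λ a b c d → (a :* b) :* (c :* d) := (a :* c) :* (b :* d)) refl x y (inv x) (inv y) ⟩
  (x ℚ.* inv x) ℚ.* (y ℚ.* inv y)  ≡⟨ cong₂ ℚ._*_ (*-inv x≢0) (*-inv y≢0) ⟩
  1ℚ ℚ.* 1ℚ  ≡⟨ ℚₚ.*-identityˡ 1ℚ ⟩
  1ℚ  ∎)
  where
  open ≡.≡-Reasoning
  open +-*-Solver

infix 4 _≋_
-- The record keeps both polynomials visible to unification; `_≈ₚ_` by itself unfolds to equations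
-- between coefficients, from which they cannot be inferred.
record _≋_ (p r : Poly) : Set where
  constructor coefficientwise
  field at : p ≈ₚ r
open _≋_

negP : Poly → Poly
negP = scale (ℚ.- 1ℚ)

coeff-⊕ : ∀ p r i → coeff (p ⊕ r) i ≡ coeff p i ℚ.+ coeff r i
coeff-⊕ []      r       i       = sym (ℚₚ.+-identityˡ _)
coeff-⊕ (a ∷ p) []      i       = sym (ℚₚ.+-identityʳ _)
coeff-⊕ (a ∷ p) (b ∷ r) zero    = refl
coeff-⊕ (a ∷ p) (b ∷ r) (suc i) = coeff-⊕ p r i

coeff-scale : ∀ c p i → coeff (scale c p) i ≡ c ℚ.* coeff p i
coeff-scale c []      i       = sym (ℚₚ.*-zeroʳ c)
coeff-scale c (a ∷ p) zero    = refl
coeff-scale c (a ∷ p) (suc i) = coeff-scale c p i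

≋-refl : ∀ {p} → p ≋ p
≋-refl = coefficientwise (λ _ → refl)

≋-sym : ∀ {p r} → p ≋ r → r ≋ p
≋-sym (coefficientwise h) = coefficientwise (λ i → sym (h i))

≋-trans : ∀ {p r s} → p ≋ r → r ≋ s → p ≋ s
≋-trans (coefficientwise h) (coefficientwise k) = coefficientwise (λ i → trans (h i) (k i))

∷-cong : ∀ {a b p r} → a ≡ b → p ≋ r → (a ∷ p) ≋ (b ∷ r)
∷-cong a≡b (coefficientwise h) = coefficientwise (λ { zero → a≡b ; (suc i) → h i })

⊕-cong : ∀ {p p′ r r′} → p ≋ p′ → r ≋ r′ → p ⊕ r ≋ p′ ⊕ r′
⊕-cong {p} {p′} {r} {r′} (coefficientwise h) (coefficientwise k) = coefficientwise (λ i →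
  trans (coeff-⊕ p r i) (trans (cong₂ ℚ._+_ (h i) (k i)) (sym (coeff-⊕ p′ r′ i))))

⊕-congˡ : ∀ p {r r′} → r ≋ r′ → p ⊕ r ≋ p ⊕ r′
⊕-congˡ p = ⊕-cong (≋-refl {p})

⊕-comm : ∀ p r → p ⊕ r ≋ r ⊕ p
⊕-comm p r = coefficientwise (λ i →
  trans (coeff-⊕ p r i) (trans (ℚₚ.+-comm (coeff p i) (coeff r i)) (sym (coeff-⊕ r p i))))

⊕-assoc : ∀ p r s → (p ⊕ r) ⊕ s ≋ p ⊕ (r ⊕ s)
⊕-assoc p r s = coefficientwise (λ i → begin
  coeff ((p ⊕ r) ⊕ s) i  ≡⟨ trans (coeff-⊕ (p ⊕ r) s i) (cong (ℚ._+ coeff s i) (coeff-⊕ p r i)) ⟩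
  (coeff p i ℚ.+ coeff r i) ℚ.+ coeff s i  ≡⟨ ℚₚ.+-assoc (coeff p i) (coeff r i) (coeff s i) ⟩
  coeff p i ℚ.+ (coeff r i ℚ.+ coeff s i)  ≡⟨ trans (coeff-⊕ p (r ⊕ s) i) (cong (coeff p i ℚ.+_) (coeff-⊕ r s i)) ⟨
  coeff (p ⊕ (r ⊕ s)) i  ∎)
  where open ≡.≡-Reasoning

⊕-identityʳ : ∀ p → p ⊕ [] ≋ p
⊕-identityʳ p = ⊕-comm p []

scale-cong : ∀ c {p r} → p ≋ r → scale c p ≋ scale c r
scale-cong c {p} {r} (coefficientwise h) = coefficientwise (λ i →
  trans (coeff-scale c p i) (trans (cong (c ℚ.*_) (h i)) (sym (coeff-scale c r i))))

scale-⊕ : ∀ c p r → scale c (p ⊕ r) ≋ scale c p ⊕ scale c r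
scale-⊕ c p r = coefficientwise (λ i → begin
  coeff (scale c (p ⊕ r)) i  ≡⟨ trans (coeff-scale c (p ⊕ r) i) (cong (c ℚ.*_) (coeff-⊕ p r i)) ⟩
  c ℚ.* (coeff p i ℚ.+ coeff r i)  ≡⟨ ℚₚ.*-distribˡ-+ c (coeff p i) (coeff r i) ⟩
  c ℚ.* coeff p i ℚ.+ c ℚ.* coeff r i  ≡⟨ trans (coeff-⊕ (scale c p) (scale c r) i) (cong₂ ℚ._+_ (coeff-scale c p i) (coeff-scale c r i)) ⟨
  coeff (scale c p ⊕ scale c r) i  ∎)
  where open ≡.≡-Reasoning

scale-scale : ∀ c d p → scale c (scale d p) ≋ scale (c ℚ.* d) p
scale-scale c d p = coefficientwise (λ i → begin
  coeff (scale c (scale d p)) i  ≡⟨ trans (coeff-scale c (scale d p) i) (cong (c ℚ.*_) (coeff-scale d p i)) ⟩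
  c ℚ.* (d ℚ.* coeff p i)  ≡⟨ ℚₚ.*-assoc c d (coeff p i) ⟨
  (c ℚ.* d) ℚ.* coeff p i  ≡⟨ coeff-scale (c ℚ.* d) p i ⟨
  coeff (scale (c ℚ.* d) p) i  ∎)
  where open ≡.≡-Reasoning

scale-1 : ∀ p → scale 1ℚ p ≋ p
scale-1 p = coefficientwise (λ i → trans (coeff-scale 1ℚ p i) (ℚₚ.*-identityˡ (coeff p i)))

scale-0 : ∀ p → scale 0ℚ p ≋ []
scale-0 p = coefficientwise (λ i → trans (coeff-scale 0ℚ p i) (ℚₚ.*-zeroˡ (coeff p i)))

shift-[] : shiftW [] ≋ []
shift-[] = coefficientwise (λ { zero → refl ; (suc i) → refl })

shift-⊕ : ∀ p r → shiftW (p ⊕ r) ≋ shiftW p ⊕ shiftW r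
shift-⊕ p r = ∷-cong (sym (ℚₚ.+-identityˡ 0ℚ)) ≋-refl

shift-scale : ∀ c p → shiftW (scale c p) ≋ scale c (shiftW p)
shift-scale c p = ∷-cong (sym (ℚₚ.*-zeroʳ c)) ≋-refl

⊕-interchange : ∀ p r s t → (p ⊕ r) ⊕ (s ⊕ t) ≋ (p ⊕ s) ⊕ (r ⊕ t)
⊕-interchange p r s t =
  ≋-trans (⊕-assoc p r (s ⊕ t)) (≋-trans (⊕-congˡ p
    (≋-trans (≋-sym (⊕-assoc r s t)) (≋-trans (⊕-cong (⊕-comm r s) ≋-refl) (⊕-assoc s r t))))
    (≋-sym (⊕-assoc p s (r ⊕ t))))

⊗-zeroʳ : ∀ p → p ⊗ [] ≋ []
⊗-zeroʳ []      = ≋-refl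
⊗-zeroʳ (a ∷ p) = ≋-trans (∷-cong refl (⊗-zeroʳ p)) shift-[]

⊗-congʳ : ∀ p {r s} → r ≋ s → p ⊗ r ≋ p ⊗ s
⊗-congʳ []      h = ≋-refl
⊗-congʳ (a ∷ p) h = ⊕-cong (scale-cong a h) (∷-cong refl (⊗-congʳ p h))

-- `_⊗_` recurses on its left factor. This is the mirrored recursion on the right factor, from which
-- commutativity follows.
⊗-∷ʳ : ∀ p b r → p ⊗ (b ∷ r) ≋ scale b p ⊕ shiftW (p ⊗ r)
⊗-∷ʳ []      b r = ≋-sym shift-[]
⊗-∷ʳ (a ∷ p) b r = ∷-cong
  (trans (ℚₚ.+-identityʳ _) (trans (ℚₚ.*-comm a b) (sym (ℚₚ.+-identityʳ _))))
  (≋-trans (⊕-congˡ (scale a r) (⊗-∷ʳ p b r))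
    (≋-trans (≋-sym (⊕-assoc (scale a r) (scale b p) (shiftW (p ⊗ r))))
      (≋-trans (⊕-cong (⊕-comm (scale a r) (scale b p)) ≋-refl) (⊕-assoc (scale b p) (scale a r) (shiftW (p ⊗ r))))))

⊗-comm : ∀ p r → p ⊗ r ≋ r ⊗ p
⊗-comm []      r = ≋-sym (⊗-zeroʳ r)
⊗-comm (a ∷ p) r = ≋-trans (⊕-congˡ (scale a r) (∷-cong refl (⊗-comm p r))) (≋-sym (⊗-∷ʳ r a p))

⊗-cong : ∀ {p p′ r r′} → p ≋ p′ → r ≋ r′ → p ⊗ r ≋ p′ ⊗ r′
⊗-cong {p} {p′} {r} {r′} h k =
  ≋-trans (⊗-congʳ p k) (≋-trans (⊗-comm p r′) (≋-trans (⊗-congʳ r′ h) (⊗-comm r′ p′)))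

⊗-distribˡ : ∀ p r s → p ⊗ (r ⊕ s) ≋ (p ⊗ r) ⊕ (p ⊗ s)
⊗-distribˡ []      r s = ≋-refl
⊗-distribˡ (a ∷ p) r s =
  ≋-trans (⊕-cong (scale-⊕ a r s) (≋-trans (∷-cong refl (⊗-distribˡ p r s)) (shift-⊕ (p ⊗ r) (p ⊗ s))))
          (⊕-interchange (scale a r) (scale a s) (shiftW (p ⊗ r)) (shiftW (p ⊗ s)))

⊗-distribʳ : ∀ p r s → (r ⊕ s) ⊗ p ≋ (r ⊗ p) ⊕ (s ⊗ p)
⊗-distribʳ p r s =
  ≋-trans (⊗-comm (r ⊕ s) p) (≋-trans (⊗-distribˡ p r s) (⊕-cong (⊗-comm p r) (⊗-comm p s)))

scale-⊗ : ∀ c p r → scale c p ⊗ r ≋ scale c (p ⊗ r)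
scale-⊗ c []      r = ≋-refl
scale-⊗ c (a ∷ p) r =
  ≋-trans (⊕-cong (≋-sym (scale-scale c a r)) (≋-trans (∷-cong refl (scale-⊗ c p r)) (shift-scale c (p ⊗ r))))
          (≋-sym (scale-⊕ c (scale a r) (shiftW (p ⊗ r))))

shift-⊗ : ∀ p r → shiftW p ⊗ r ≋ shiftW (p ⊗ r)
shift-⊗ p r = ⊕-cong (scale-0 r) ≋-refl

⊗-assoc : ∀ p r s → (p ⊗ r) ⊗ s ≋ p ⊗ (r ⊗ s)
⊗-assoc []      r s = ≋-refl
⊗-assoc (a ∷ p) r s =
  ≋-trans (⊗-distribʳ s (scale a r) (shiftW (p ⊗ r)))
    (⊕-cong (scale-⊗ a r s) (≋-trans (shift-⊗ (p ⊗ r) s) (∷-cong refl (⊗-assoc p r s))))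

⊗-identityˡ : ∀ p → constP 1ℚ ⊗ p ≋ p
⊗-identityˡ p = ≋-trans (⊕-cong (scale-1 p) shift-[]) (⊕-identityʳ p)

negP-inverseˡ : ∀ p → negP p ⊕ p ≋ []
negP-inverseˡ p = coefficientwise (λ i → trans (coeff-⊕ (negP p) p i)
  (trans (cong (ℚ._+ coeff p i) (coeff-scale (ℚ.- 1ℚ) p i))
    (solve 1 (λ x → con (ℚ.- 1ℚ) :* x :+ x := con 0ℚ) refl (coeff p i))))
  where open +-*-Solver

polyRing : CommutativeRing 0ℓ 0ℓ
polyRing = record
  { Carrier = Poly
  ; _≈_ = _≋_
  ; _+_ = _⊕_
  ; _*_ = _⊗_
  ; -_  = negP
  ; 0#  = []
  ; 1#  = constP 1ℚ
  ; isCommutativeRing = record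
    { isRing = record
      { +-isAbelianGroup = record
        { isGroup = record
          { isMonoid = record
            { isSemigroup = record
              { isMagma = record
                { isEquivalence = record { refl = ≋-refl ; sym = ≋-sym ; trans = ≋-trans }
                ; ∙-cong = ⊕-cong
                }
              ; assoc = ⊕-assoc
              }
            ; identity = (λ _ → ≋-refl) , ⊕-identityʳ
            }
          ; inverse = negP-inverseˡ , (λ p → ≋-trans (⊕-comm p (negP p)) (negP-inverseˡ p))
          ; ⁻¹-cong = scale-cong (ℚ.- 1ℚ)
          }
        ; comm = ⊕-comm
        }
      ; *-cong = ⊗-cong
      ; *-assoc = ⊗-assoc
      ; *-identity = ⊗-identityˡ , (λ p → ≋-trans (⊗-comm p (constP 1ℚ)) (⊗-identityˡ p))
      ; distrib = ⊗-distribˡ , ⊗-distribʳ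
      }
    ; *-comm = ⊗-comm
    }
  }

scale≋constP-⊗ : ∀ c p → scale c p ≋ constP c ⊗ p
scale≋constP-⊗ c p = ≋-sym (≋-trans (⊕-congˡ (scale c p) shift-[]) (⊕-identityʳ (scale c p)))

constP-+ : ∀ a b → constP (a ℚ.+ b) ≋ constP a ⊕ constP b
constP-+ a b = ≋-refl

constP-* : ∀ a b → constP (a ℚ.* b) ≋ constP a ⊗ constP b
constP-* a b = scale≋constP-⊗ a (constP b)

constP-neg : ∀ a → constP (ℚ.- a) ≋ negP (constP a)
constP-neg a = ∷-cong (solve 1 (λ a → :- a := con (ℚ.- 1ℚ) :* a) refl a) ≋-refl
  where open +-*-Solver

-- Newton's identities

module PowerSums {c ℓ} (R : CommutativeRing c ℓ) where
  open CommutativeRing R renaming (refl to ≈-refl; sym to ≈-sym; trans to ≈-trans) hiding (_-_)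
  open import Relation.Binary.Reasoning.Setoid setoid
  open import Algebra.Properties.Semiring.Mult semiring using () renaming (_×_ to _⋆_)
  open import Algebra.Properties.Semiring.Exp semiring using (_^_)
  open IntegerSolver R
  open Sum commutativeSemiring

  -- The Cauchy product of coefficient sequences, with the recursion chosen to avoid the truncated
  -- index m - j.
  conv : (ℕ → Carrier) → (ℕ → Carrier) → ℕ → Carrier
  conv f g zero    = f 0 * g 0
  conv f g (suc m) = f 0 * g (suc m) + conv (f ∘ suc) g m

  -- Peels the opposite end. It is used where the first entries of the right-hand sequence are
  -- exceptional.
  conv-suc : ∀ f g m → conv f g (suc m) ≈ f (suc m) * g 0 + conv f (g ∘ suc) m
  conv-suc f g zero    = +-comm _ _
  conv-suc f g (suc m) = ≈-trans (+-congˡ (conv-suc (f ∘ suc) g m))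
    (solve 3 (λ a b c → a :+ (b :+ c) := b :+ (a :+ c)) ≈-refl _ _ _)

  conv-cong : ∀ {f f′ g g′} m → (∀ j → f j ≈ f′ j) → (∀ j → j ≤ m → g j ≈ g′ j) → conv f g m ≈ conv f′ g′ m
  conv-cong zero    h k = *-cong (h 0) (k 0 ℕ.z≤n)
  conv-cong (suc m) h k = +-cong (*-cong (h 0) (k (suc m) ℕₚ.≤-refl))
    (conv-cong m (h ∘ suc) (λ j j≤m → k j (ℕₚ.m≤n⇒m≤1+n j≤m)))

  conv-linearʳ : ∀ f x y (g k l : ℕ → Carrier) m →
                 conv f (λ j → g j + x * k j + y * l j) m ≈ conv f g m + x * conv f k m + y * conv f l m
  conv-linearʳ f x y g k l zero =
    solve 6 (λ f x y g k l → f :* (g :+ x :* k :+ y :* l) := f :* g :+ x :* (f :* k) :+ y :* (f :* l)) ≈-refl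
      (f 0) x y (g 0) (k 0) (l 0)
  conv-linearʳ f x y g k l (suc m) = ≈-trans (+-congˡ (conv-linearʳ (f ∘ suc) x y g k l m))
    (solve 9 (λ f x y g k l a b c → f :* (g :+ x :* k :+ y :* l) :+ (a :+ x :* b :+ y :* c) :=
                (f :* g :+ a) :+ x :* (f :* k :+ b) :+ y :* (f :* l :+ c)) ≈-refl
      (f 0) x y (g (suc m)) (k (suc m)) (l (suc m)) (conv (f ∘ suc) g m) (conv (f ∘ suc) k m) (conv (f ∘ suc) l m))

  conv-linearˡ : ∀ x y (g k l : ℕ → Carrier) f m →
                 conv (λ j → g j + x * k j + y * l j) f m ≈ conv g f m + x * conv k f m + y * conv l f m
  conv-linearˡ x y g k l f zero =
    solve 6 (λ f x y g k l → (g :+ x :* k :+ y :* l) :* f := g :* f :+ x :* (k :* f) :+ y :* (l :* f)) ≈-refl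
      (f 0) x y (g 0) (k 0) (l 0)
  conv-linearˡ x y g k l f (suc m) = ≈-trans (+-congˡ (conv-linearˡ x y (g ∘ suc) (k ∘ suc) (l ∘ suc) f m))
    (solve 9 (λ f x y g k l a b c → (g :+ x :* k :+ y :* l) :* f :+ (a :+ x :* b :+ y :* c) :=
                (g :* f :+ a) :+ x :* (k :* f :+ b) :+ y :* (l :* f :+ c)) ≈-refl
      (f (suc m)) x y (g 0) (k 0) (l 0) (conv (g ∘ suc) f m) (conv (k ∘ suc) f m) (conv (l ∘ suc) f m))

  ∑≈conv : ∀ f g m → ∑ (upTo (suc m)) (λ j → f j * g (m ℕ.∸ j)) ≈ conv f g m
  ∑≈conv f g zero    = +-identityʳ _
  ∑≈conv f g (suc m) = +-congˡ (≈-trans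
    (≈-trans (reflexive (cong (λ xs → ∑ xs (λ j → f j * g (suc m ℕ.∸ j))) (sym (map-applyUpTo id suc (suc m)))))
             (∑-map suc (upTo (suc m)) _))
    (∑≈conv (f ∘ suc) g m))

  -- In each product the power splits as q^(m+1) = q^(j+1) q^(m-j).
  conv-^ : ∀ q f g m → q ^ suc m * conv f g m ≈ conv (λ j → q ^ suc j * f j) (λ j → q ^ j * g j) m
  conv-^ q f g zero    = solve 3 (λ q f g → q :* con (+ 1) :* (f :* g) := (q :* con (+ 1) :* f) :* (con (+ 1) :* g)) ≈-refl q (f 0) (g 0)
  conv-^ q f g (suc m) = begin
    q ^ suc (suc m) * (f 0 * g (suc m) + conv (f ∘ suc) g m)
      ≈⟨ solve 5 (λ q qm f g c → q :* qm :* (f :* g :+ c) := (q :* con (+ 1) :* f) :* (qm :* g) :+ q :* (qm :* c)) ≈-refl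
           q (q ^ suc m) (f 0) (g (suc m)) (conv (f ∘ suc) g m) ⟩
    (q ^ 1 * f 0) * (q ^ suc m * g (suc m)) + q * (q ^ suc m * conv (f ∘ suc) g m)
      ≈⟨ +-congˡ (≈-trans (*-congˡ (conv-^ q (f ∘ suc) g m)) (scale-conv q _ _ m)) ⟩
    (q ^ 1 * f 0) * (q ^ suc m * g (suc m)) + conv (λ j → q * (q ^ suc j * f (suc j))) (λ j → q ^ j * g j) m
      ≈⟨ +-congˡ (conv-cong m (λ j → ≈-sym (*-assoc q (q ^ suc j) (f (suc j)))) (λ _ _ → ≈-refl)) ⟩
    (q ^ 1 * f 0) * (q ^ suc m * g (suc m)) + conv (λ j → q ^ suc (suc j) * f (suc j)) (λ j → q ^ j * g j) m ∎
    where
    scale-conv : ∀ x f g m → x * conv f g m ≈ conv (λ j → x * f j) g m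
    scale-conv x f g zero    = ≈-sym (*-assoc x (f 0) (g 0))
    scale-conv x f g (suc m) = ≈-trans (distribˡ x _ _) (+-cong (≈-sym (*-assoc x (f 0) (g (suc m)))) (scale-conv x (f ∘ suc) g m))

  denominator : Carrier → Carrier → ℕ → Carrier
  denominator q p zero    = 1#
  denominator q p (suc m) = denominator q p m * ((q ^ suc m + - 1#) * p ^ m)

  -- In generating functions: h(t) = exp(Σ P_j t^j / j), and (1 - W t + t²) h(qt) satisfies the same
  -- differential equation as h(t), hence equals it.
  module _ (q W : Carrier) (P c h : ℕ → Carrier)
           (⋆-cancel : ∀ m {x y} → (suc m ⋆ 1#) * x ≈ (suc m ⋆ 1#) * y → x ≈ y)
           (newton : ∀ m → (suc m ⋆ 1#) * h (suc m) ≈ conv P h m)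
           (q^*P : ∀ j → q ^ suc j * P j ≈ P j + c j)
           (c-0 : c 0 ≈ W) (c-1 : c 1 ≈ W * W + - (1# + 1#))
           (c-suc : ∀ j → c (suc (suc j)) ≈ W * c (suc j) + - c j)
           where

    private
      k : ℕ → Carrier
      k m = q ^ m * h m

      g : ℕ → Carrier
      g zero          = k 0
      g (suc zero)    = k 1 + - W * k 0
      g (suc (suc m)) = k (suc (suc m)) + - W * k (suc m) + 1# * k m

      -- Passing from h(t) to h(qt) multiplies each power sum by q^(j+1), that is, adds c_j to P_j.
      newton-k : ∀ m → (suc m ⋆ 1#) * k (suc m) ≈ conv P k m + conv c k m
      newton-k m = begin
        (suc m ⋆ 1#) * (q ^ suc m * h (suc m))  ≈⟨ solve 3 (λ a b c → a :* (b :* c) := b :* (a :* c)) ≈-refl _ _ _ ⟩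
        q ^ suc m * ((suc m ⋆ 1#) * h (suc m))  ≈⟨ *-congˡ (newton m) ⟩
        q ^ suc m * conv P h m  ≈⟨ conv-^ q P h m ⟩
        conv (λ j → q ^ suc j * P j) k m
          ≈⟨ conv-cong m (λ j → ≈-trans (q^*P j) (solve 2 (λ p c → p :+ c := p :+ con (+ 1) :* c :+ con (+ 0) :* p) ≈-refl (P j) (c j))) (λ _ _ → ≈-refl) ⟩
        conv (λ j → P j + 1# * c j + 0# * P j) k m ≈⟨ conv-linearˡ 1# 0# P c P k m ⟩
        conv P k m + 1# * conv c k m + 0# * conv P k m
          ≈⟨ solve 2 (λ p c → p :+ con (+ 1) :* c :+ con (+ 0) :* p := p :+ c) ≈-refl _ _ ⟩
        conv P k m + conv c k m ∎

      conv-g-1 : ∀ f → conv f g 1 ≈ conv f k 1 + - W * conv f k 0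
      conv-g-1 f = solve 5 (λ f₀ f₁ k₀ k₁ W → f₀ :* (k₁ :+ :- W :* k₀) :+ f₁ :* k₀ :=
        (f₀ :* k₁ :+ f₁ :* k₀) :+ :- W :* (f₀ :* k₀)) ≈-refl (f 0) (f 1) (k 0) (k 1) W

      conv-g : ∀ f m → conv f g (suc (suc m)) ≈ conv f k (suc (suc m)) + - W * conv f k (suc m) + 1# * conv f k m
      conv-g f m = begin
        conv f g (suc (suc m))
          ≈⟨ ≈-trans (conv-suc f g (suc m)) (+-congˡ (conv-suc f (g ∘ suc) m)) ⟩
        f (suc (suc m)) * k 0 + (f (suc m) * (k 1 + - W * k 0) + conv f (λ j → g (suc (suc j))) m)
          ≈⟨ +-congˡ (+-congˡ (conv-linearʳ f (- W) 1# (λ j → k (suc (suc j))) (k ∘ suc) k m)) ⟩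
        f (suc (suc m)) * k 0 + (f (suc m) * (k 1 + - W * k 0) +
          (conv f (λ j → k (suc (suc j))) m + - W * conv f (k ∘ suc) m + 1# * conv f k m))
          ≈⟨ solve 8 (λ f₂ f₁ k₀ k₁ W a b c → f₂ :* k₀ :+ (f₁ :* (k₁ :+ :- W :* k₀) :+ (a :+ :- W :* b :+ con (+ 1) :* c)) :=
               (f₂ :* k₀ :+ (f₁ :* k₁ :+ a)) :+ :- W :* (f₁ :* k₀ :+ b) :+ con (+ 1) :* c) ≈-refl
               (f (suc (suc m))) (f (suc m)) (k 0) (k 1) W (conv f (λ j → k (suc (suc j))) m) (conv f (k ∘ suc) m) (conv f k m) ⟩
        (f (suc (suc m)) * k 0 + (f (suc m) * k 1 + conv f (λ j → k (suc (suc j))) m)) + - W * (f (suc m) * k 0 + conv f (k ∘ suc) m) + 1# * conv f k m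
          ≈⟨ +-congʳ (+-cong (≈-trans (conv-suc f k (suc m)) (+-congˡ (conv-suc f (k ∘ suc) m))) (*-congˡ (conv-suc f k m))) ⟨
        conv f k (suc (suc m)) + - W * conv f k (suc m) + 1# * conv f k m ∎

      conv-c-1 : conv c k 1 + - W * conv c k 0 ≈ W * k 1 + - (k 0 + k 0)
      conv-c-1 = begin
        (c 0 * k 1 + c 1 * k 0) + - W * (c 0 * k 0)
          ≈⟨ +-cong (+-cong (*-congʳ c-0) (*-congʳ c-1)) (*-congˡ (*-congʳ c-0)) ⟩
        (W * k 1 + (W * W + - (1# + 1#)) * k 0) + - W * (W * k 0)
          ≈⟨ solve 3 (λ W k₁ k₀ → (W :* k₁ :+ (W :* W :+ :- (con (+ 1) :+ con (+ 1))) :* k₀) :+ :- W :* (W :* k₀) :=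
               W :* k₁ :+ :- (k₀ :+ k₀)) ≈-refl W (k 1) (k 0) ⟩
        W * k 1 + - (k 0 + k 0) ∎

      -- The recurrence and initial values of c say that (1 - W t + t²) Σ c_j t^j = W - 2t, so only
      -- two entries of k survive.
      conv-c : ∀ m → conv c k (suc (suc m)) + - W * conv c k (suc m) + 1# * conv c k m ≈
                     W * k (suc (suc m)) + - (k (suc m) + k (suc m))
      conv-c m = begin
        (c 0 * k₂ + (c 1 * k₁ + conv c″ k m)) + - W * (c 0 * k₁ + conv c′ k m) + 1# * conv c k m
          ≈⟨ +-congʳ (+-cong (+-cong (*-congʳ c-0) (+-congʳ (*-congʳ c-1))) (*-congˡ (+-congʳ (*-congʳ c-0)))) ⟩
        (W * k₂ + ((W * W + - (1# + 1#)) * k₁ + conv c″ k m)) + - W * (W * k₁ + conv c′ k m) + 1# * conv c k m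
          ≈⟨ solve 6 (λ W k₂ k₁ a b d → (W :* k₂ :+ ((W :* W :+ :- (con (+ 1) :+ con (+ 1))) :* k₁ :+ a)) :+ :- W :* (W :* k₁ :+ b) :+ con (+ 1) :* d :=
               (W :* k₂ :+ :- (k₁ :+ k₁)) :+ (a :+ :- W :* b :+ con (+ 1) :* d)) ≈-refl W k₂ k₁ (conv c″ k m) (conv c′ k m) (conv c k m) ⟩
        (W * k₂ + - (k₁ + k₁)) + (conv c″ k m + - W * conv c′ k m + 1# * conv c k m)
          ≈⟨ +-congˡ (conv-linearˡ (- W) 1# c″ c′ c k m) ⟨
        (W * k₂ + - (k₁ + k₁)) + conv (λ j → c″ j + - W * c′ j + 1# * c j) k m
          ≈⟨ +-congˡ (≈-trans (conv-cong m (λ j → ≈-trans (+-congʳ (+-congʳ (c-suc j)))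
               (solve 3 (λ W a b → W :* a :+ :- b :+ :- W :* a :+ con (+ 1) :* b := con (+ 0)) ≈-refl W (c (suc j)) (c j))) (λ _ _ → ≈-refl)) (conv-0 m)) ⟩
        (W * k₂ + - (k₁ + k₁)) + 0#
          ≈⟨ +-identityʳ _ ⟩
        W * k₂ + - (k₁ + k₁) ∎
        where
        k₂ = k (suc (suc m))
        k₁ = k (suc m)
        c′ = c ∘ suc
        c″ : ℕ → Carrier
        c″ j = c (suc (suc j))
        conv-0 : ∀ m → conv (λ _ → 0#) k m ≈ 0#
        conv-0 zero    = zeroˡ _
        conv-0 (suc m) = ≈-trans (+-cong (zeroˡ _) (conv-0 m)) (+-identityˡ 0#)

      -- Differentiating the factor 1 - W t + t² contributes -W + 2t. This is the negative of the
      -- polynomial found in `conv-c`, so the extra convolution of `newton-k` disappears.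
      newton-g : ∀ m → (suc m ⋆ 1#) * g (suc m) ≈ conv P g m
      newton-g zero = begin
        (1# + 0#) * (k 1 + - W * k 0)  ≈⟨ solve 3 (λ k₁ W k₀ → (con (+ 1) :+ con (+ 0)) :* (k₁ :+ :- W :* k₀) := (con (+ 1) :+ con (+ 0)) :* k₁ :+ :- W :* k₀) ≈-refl (k 1) W (k 0) ⟩
        (1# + 0#) * k 1 + - W * k 0  ≈⟨ +-congʳ (≈-trans (newton-k 0) (+-congˡ (*-congʳ c-0))) ⟩
        (P 0 * k 0 + W * k 0) + - W * k 0  ≈⟨ solve 3 (λ p W k₀ → (p :* k₀ :+ W :* k₀) :+ :- W :* k₀ := p :* k₀) ≈-refl (P 0) W (k 0) ⟩
        P 0 * k 0  ∎
      newton-g (suc zero) = begin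
        n₂ * (k 2 + - W * k 1 + 1# * k 0)
          ≈⟨ solve 4 (λ k₂ k₁ k₀ W → let n₁ = con (+ 1) :+ con (+ 0) ; n₂ = con (+ 1) :+ n₁ in
               n₂ :* (k₂ :+ :- W :* k₁ :+ con (+ 1) :* k₀) := n₂ :* k₂ :+ :- W :* (n₁ :* k₁) :+ (:- W :* k₁ :+ (k₀ :+ k₀)))
               ≈-refl (k 2) (k 1) (k 0) W ⟩
        n₂ * k 2 + - W * (n₁ * k 1) + (- W * k 1 + (k 0 + k 0))
          ≈⟨ +-congʳ (+-cong (newton-k 1) (*-congˡ (newton-k 0))) ⟩
        (conv P k 1 + conv c k 1) + - W * (conv P k 0 + conv c k 0) + (- W * k 1 + (k 0 + k 0))
          ≈⟨ solve 7 (λ a b d e W k₁ k₀ → (a :+ b) :+ :- W :* (d :+ e) :+ (:- W :* k₁ :+ (k₀ :+ k₀)) :=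
               (a :+ :- W :* d) :+ (b :+ :- W :* e) :+ (:- W :* k₁ :+ (k₀ :+ k₀))) ≈-refl
               (conv P k 1) (conv c k 1) (conv P k 0) (conv c k 0) W (k 1) (k 0) ⟩
        (conv P k 1 + - W * conv P k 0) + (conv c k 1 + - W * conv c k 0) + (- W * k 1 + (k 0 + k 0))
          ≈⟨ +-congʳ (+-cong (≈-sym (conv-g-1 P)) conv-c-1) ⟩
        conv P g 1 + (W * k 1 + - (k 0 + k 0)) + (- W * k 1 + (k 0 + k 0))
          ≈⟨ solve 4 (λ a W k₁ k₀ → a :+ (W :* k₁ :+ :- (k₀ :+ k₀)) :+ (:- W :* k₁ :+ (k₀ :+ k₀)) := a) ≈-refl (conv P g 1) W (k 1) (k 0) ⟩
        conv P g 1 ∎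
        where
        n₁ = 1# + 0#
        n₂ = 1# + n₁
      newton-g (suc (suc m)) = begin
        (1# + (1# + n₁)) * (k₃ + - W * k₂ + 1# * k₁)
          ≈⟨ solve 5 (λ n₁ k₃ k₂ k₁ W → (con (+ 1) :+ (con (+ 1) :+ n₁)) :* (k₃ :+ :- W :* k₂ :+ con (+ 1) :* k₁) :=
               (con (+ 1) :+ (con (+ 1) :+ n₁)) :* k₃ :+ :- W :* ((con (+ 1) :+ n₁) :* k₂) :+ n₁ :* k₁ :+ (:- W :* k₂ :+ (k₁ :+ k₁)))
               ≈-refl n₁ k₃ k₂ k₁ W ⟩
        (1# + (1# + n₁)) * k₃ + - W * ((1# + n₁) * k₂) + n₁ * k₁ + (- W * k₂ + (k₁ + k₁))
          ≈⟨ +-congʳ (+-cong (+-cong (newton-k (suc (suc m))) (*-congˡ (newton-k (suc m)))) (newton-k m)) ⟩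
        (conv P k (suc (suc m)) + conv c k (suc (suc m))) + - W * (conv P k (suc m) + conv c k (suc m)) + (conv P k m + conv c k m) + (- W * k₂ + (k₁ + k₁))
          ≈⟨ solve 9 (λ a₂ b₂ a₁ b₁ a₀ b₀ W k₂ k₁ → (a₂ :+ b₂) :+ :- W :* (a₁ :+ b₁) :+ (a₀ :+ b₀) :+ (:- W :* k₂ :+ (k₁ :+ k₁)) :=
               (a₂ :+ :- W :* a₁ :+ con (+ 1) :* a₀) :+ (b₂ :+ :- W :* b₁ :+ con (+ 1) :* b₀) :+ (:- W :* k₂ :+ (k₁ :+ k₁))) ≈-refl
               (conv P k (suc (suc m))) (conv c k (suc (suc m))) (conv P k (suc m)) (conv c k (suc m)) (conv P k m) (conv c k m) W k₂ k₁ ⟩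
        (conv P k (suc (suc m)) + - W * conv P k (suc m) + 1# * conv P k m) +
        (conv c k (suc (suc m)) + - W * conv c k (suc m) + 1# * conv c k m) + (- W * k₂ + (k₁ + k₁))
          ≈⟨ +-congʳ (+-cong (≈-sym (conv-g P m)) (conv-c m)) ⟩
        conv P g (suc (suc m)) + (W * k₂ + - (k₁ + k₁)) + (- W * k₂ + (k₁ + k₁))
          ≈⟨ solve 4 (λ a W k₁ k₀ → a :+ (W :* k₁ :+ :- (k₀ :+ k₀)) :+ (:- W :* k₁ :+ (k₀ :+ k₀)) := a) ≈-refl (conv P g (suc (suc m))) W k₂ k₁ ⟩
        conv P g (suc (suc m)) ∎
        where
        n₁ = suc m ⋆ 1#
        k₃ = k (suc (suc (suc m)))
        k₂ = k (suc (suc m))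
        k₁ = k (suc m)

      -- Newton's identities with given power sums determine a sequence from its initial entry once
      -- positive integers can be cancelled. The bound m turns this into a course-of-values
      -- induction.
      g≈h : ∀ m j → j ≤ m → g j ≈ h j
      g≈h m       zero    _           = *-identityˡ (h 0)
      g≈h (suc m) (suc j) (ℕ.s≤s j≤m) = ⋆-cancel j (≈-trans (newton-g j)
        (≈-trans (conv-cong j (λ _ → ≈-refl) (λ i i≤j → g≈h m i (ℕₚ.≤-trans i≤j j≤m))) (≈-sym (newton j))))

    module _ (p : Carrier) (qp≈1 : q * p ≈ 1#) (h-0 : h 0 ≈ 1#) where
      open HermiteProducts R q p W qp≈1 using (H; q^*p^)

      -- The equation g = h reads (q^(m+2) - 1) h_{m+2} = W q^(m+1) h_{m+1} - q^m h_m. Multiplying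
      -- by p^(m+1) normalises the coefficient of h_{m+1} to W, which explains the powers of p in
      -- `denominator`.
      H≈denominator*h : ∀ m → H m ≈ denominator q p m * h m
      H≈denominator*h zero       = ≈-sym (≈-trans (*-identityˡ _) h-0)
      H≈denominator*h (suc zero) = begin
        W  ≈⟨ *-identityʳ W ⟨
        W * 1#  ≈⟨ *-congˡ h-0 ⟨
        W * h 0  ≈⟨ solve 4 (λ W h₀ q h₁ → W :* h₀ := q :* con (+ 1) :* h₁ :+ :- (q :* con (+ 1) :* h₁ :+ :- W :* (con (+ 1) :* h₀))) ≈-refl W (h 0) q (h 1) ⟩
        q ^ 1 * h 1 + - (k 1 + - W * k 0)  ≈⟨ +-congˡ (-‿cong (g≈h 1 1 ℕₚ.≤-refl)) ⟩
        q ^ 1 * h 1 + - h 1  ≈⟨ solve 2 (λ x h₁ → x :* h₁ :+ :- h₁ := con (+ 1) :* ((x :+ :- con (+ 1)) :* con (+ 1)) :* h₁) ≈-refl (q ^ 1) (h 1) ⟩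
        1# * ((q ^ 1 + - 1#) * 1#) * h 1  ∎
      H≈denominator*h (suc (suc m)) = ≈-sym (begin
        D * ((x + - 1#) * b) * ((q * x + - 1#) * (p * b)) * h₂
          ≈⟨ solve 7 (λ D x b q p h₂ q₂ → D :* ((x :+ :- con (+ 1)) :* b) :* ((q₂ :+ :- con (+ 1)) :* (p :* b)) :* h₂ :=
               D :* ((x :+ :- con (+ 1)) :* b) :* (p :* b) :* (q₂ :* h₂ :+ :- h₂)) ≈-refl D x b q p h₂ (q * x) ⟩
        D * ((x + - 1#) * b) * (p * b) * (q * x * h₂ + - h₂)
          ≈⟨ *-congˡ (+-congˡ (-‿cong (g≈h (suc (suc m)) (suc (suc m)) ℕₚ.≤-refl))) ⟨
        D * ((x + - 1#) * b) * (p * b) * (q * x * h₂ + - (q * x * h₂ + - W * (x * h₁) + 1# * (q ^ m * h₀)))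
          ≈⟨ solve 10 (λ D x b q p h₂ h₁ h₀ W y →
               D :* ((x :+ :- con (+ 1)) :* b) :* (p :* b) :* (q :* x :* h₂ :+ :- (q :* x :* h₂ :+ :- W :* (x :* h₁) :+ con (+ 1) :* (y :* h₀))) :=
               D :* ((x :+ :- con (+ 1)) :* b) :* W :* h₁ :* (x :* (p :* b)) :+ D :* h₀ :* (p :* b) :* (y :* b) :+ :- (D :* h₀ :* (y :* b) :* (x :* (p :* b))))
               ≈-refl D x b q p h₂ h₁ h₀ W (q ^ m) ⟩
        D * ((x + - 1#) * b) * W * h₁ * (x * (p * b)) + D * h₀ * (p * b) * (q ^ m * b) + - (D * h₀ * (q ^ m * b) * (x * (p * b)))
          ≈⟨ +-cong (+-cong (*-congˡ (q^*p^ (suc m))) (*-congˡ (q^*p^ m))) (-‿cong (*-cong (*-congˡ (q^*p^ m)) (q^*p^ (suc m)))) ⟩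
        D * ((x + - 1#) * b) * W * h₁ * 1# + D * h₀ * (p * b) * 1# + - (D * h₀ * 1# * 1#)
          ≈⟨ solve 7 (λ D x b p h₁ h₀ W →
               D :* ((x :+ :- con (+ 1)) :* b) :* W :* h₁ :* con (+ 1) :+ D :* h₀ :* (p :* b) :* con (+ 1) :+ :- (D :* h₀ :* con (+ 1) :* con (+ 1)) :=
               W :* (D :* ((x :+ :- con (+ 1)) :* b) :* h₁) :+ (p :* b :+ :- con (+ 1)) :* (D :* h₀)) ≈-refl D x b p h₁ h₀ W ⟩
        W * (D * ((x + - 1#) * b) * h₁) + (p * b + - 1#) * (D * h₀)
          ≈⟨ +-cong (*-congˡ (H≈denominator*h (suc m))) (*-congˡ (H≈denominator*h m)) ⟨
        W * H (suc m) + (p ^ suc m + - 1#) * H m ∎)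
        where
        D = denominator q p m
        x = q ^ suc m
        b = p ^ m
        h₀ = h m
        h₁ = h (suc m)
        h₂ = h (suc (suc m))

-- Partitions

≡ᵇ-refl : ∀ n → (n ≡ᵇ n) ≡ true
≡ᵇ-refl zero    = refl
≡ᵇ-refl (suc n) = ≡ᵇ-refl n

≢⇒≡ᵇ-false : ∀ {m n} → m ≢ n → (m ≡ᵇ n) ≡ false
≢⇒≡ᵇ-false {m} {n} m≢n with m ≡ᵇ n in eq
... | false = refl
... | true  = contradiction (ℕₚ.≡ᵇ⇒≡ m n (subst T (sym eq) tt)) m≢n

>⇒≤ᵇ-false : ∀ {m n} → n < m → (m ≤ᵇ n) ≡ false
>⇒≤ᵇ-false {m} {n} n<m with m ≤ᵇ n in eq
... | false = refl
... | true  = contradiction (ℕₚ.≤ᵇ⇒≤ m n (subst T (sym eq) tt)) (ℕₚ.<⇒≱ n<m)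

≤⇒≤ᵇ-true : ∀ {m n} → m ≤ n → (m ≤ᵇ n) ≡ true
≤⇒≤ᵇ-true {m} {n} m≤n with m ≤ᵇ n in eq
... | true  = refl
... | false = ⊥-elim (subst T eq (ℕₚ.≤⇒≤ᵇ m≤n))

insert : ℕ → List ℕ → List ℕ
insert j []      = j ∷ []
insert j (x ∷ ρ) = if x ≤ᵇ j then j ∷ x ∷ ρ else x ∷ insert j ρ

delete : ℕ → List ℕ → List ℕ
delete j []      = []
delete j (x ∷ ρ) = if x ≡ᵇ j then ρ else x ∷ delete j ρ

delete-insert : ∀ j ρ → delete j (insert j ρ) ≡ ρ
delete-insert j [] rewrite ≡ᵇ-refl j = refl
delete-insert j (x ∷ ρ) with x ≤ᵇ j in eq
... | true  rewrite ≡ᵇ-refl j = refl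
... | false rewrite ≢⇒≡ᵇ-false {x} {j} (λ { refl → subst T eq (ℕₚ.≤⇒≤ᵇ (ℕₚ.≤-refl {x})) }) = cong (x ∷_) (delete-insert j ρ)

Sorted : List ℕ → Set
Sorted ρ = T (nonincreasing ρ)

Sorted-∷⁺ : ∀ {x y} ρ → y ≤ x → Sorted (y ∷ ρ) → Sorted (x ∷ y ∷ ρ)
Sorted-∷⁺ {x} {y} ρ y≤x s = T-∧⁺ (y ≤ᵇ x) (ℕₚ.≤⇒≤ᵇ y≤x) s

Sorted-head : ∀ {x y} ρ → Sorted (x ∷ y ∷ ρ) → y ≤ x
Sorted-head {x} {y} ρ s = ℕₚ.≤ᵇ⇒≤ y x (proj₁ (T-∧⁻ (y ≤ᵇ x) s))

Sorted-tail : ∀ x ρ → Sorted (x ∷ ρ) → Sorted ρ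
Sorted-tail x []      s = tt
Sorted-tail x (y ∷ ρ) s = proj₂ (T-∧⁻ (y ≤ᵇ x) s)

Sorted-∈ : ∀ {x j} ρ → Sorted (x ∷ ρ) → j ∈ ρ → j ≤ x
Sorted-∈ (y ∷ ρ) s (here refl) = Sorted-head ρ s
Sorted-∈ (y ∷ ρ) s (there j∈)  = ℕₚ.≤-trans (Sorted-∈ ρ (Sorted-tail _ (y ∷ ρ) s) j∈) (Sorted-head ρ s)

Sorted-cons : ∀ {x} ρ → Sorted ρ → (∀ {y} → y ∈ ρ → y ≤ x) → Sorted (x ∷ ρ)
Sorted-cons []      s h = tt
Sorted-cons (y ∷ ρ) s h = Sorted-∷⁺ ρ (h (here refl)) s

∈-insert⁻ : ∀ j ρ {y} → y ∈ insert j ρ → y ≡ j ⊎ y ∈ ρ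
∈-insert⁻ j []      (here y≡j) = inj₁ y≡j
∈-insert⁻ j (x ∷ ρ) y∈ with x ≤ᵇ j | y∈
... | true  | here y≡j  = inj₁ y≡j
... | true  | there y∈′ = inj₂ y∈′
... | false | here y≡x  = inj₂ (here y≡x)
... | false | there y∈′ with ∈-insert⁻ j ρ y∈′
... | inj₁ y≡j = inj₁ y≡j
... | inj₂ y∈ρ = inj₂ (there y∈ρ)

∈-insert : ∀ j ρ → j ∈ insert j ρ
∈-insert j []      = here refl
∈-insert j (x ∷ ρ) with x ≤ᵇ j
... | true  = here refl
... | false = there (∈-insert j ρ)

∈-delete⁻ : ∀ j ρ {y} → y ∈ delete j ρ → y ∈ ρ
∈-delete⁻ j (x ∷ ρ) y∈ with x ≡ᵇ j | y∈
... | true  | y∈′       = there y∈′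
... | false | here y≡x  = here y≡x
... | false | there y∈′ = there (∈-delete⁻ j ρ y∈′)

Sorted-insert : ∀ j ρ → Sorted ρ → Sorted (insert j ρ)
Sorted-insert j []      s = tt
Sorted-insert j (x ∷ ρ) s with x ≤ᵇ j in eq
... | true  = Sorted-∷⁺ ρ (ℕₚ.≤ᵇ⇒≤ x j (subst T (sym eq) tt)) s
... | false = Sorted-cons (insert j ρ) (Sorted-insert j ρ (Sorted-tail x ρ s)) bound
  where
  bound : ∀ {y} → y ∈ insert j ρ → y ≤ x
  bound y∈ with ∈-insert⁻ j ρ y∈
  ... | inj₁ refl = ℕₚ.<⇒≤ (ℕₚ.≰⇒> (λ x≤j → subst T eq (ℕₚ.≤⇒≤ᵇ x≤j)))
  ... | inj₂ y∈ρ  = Sorted-∈ ρ s y∈ρ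

Sorted-delete : ∀ j ρ → Sorted ρ → Sorted (delete j ρ)
Sorted-delete j []      s = tt
Sorted-delete j (x ∷ ρ) s with x ≡ᵇ j
... | true  = Sorted-tail x ρ s
... | false = Sorted-cons (delete j ρ) (Sorted-delete j ρ (Sorted-tail x ρ s)) (Sorted-∈ ρ s ∘ ∈-delete⁻ j ρ)

-- In a sorted list the entries before the first j exceed j and those after it do not, so `insert`
-- returns j to the place from which `delete` took it.
insert-delete : ∀ j ρ → Sorted ρ → j ∈ ρ → insert j (delete j ρ) ≡ ρ
insert-delete j (x ∷ ρ) s j∈ with x ≡ᵇ j in eq | j∈
... | false | here refl = ⊥-elim (subst T (trans (sym (≡ᵇ-refl j)) eq) tt)
... | false | there j∈ρ rewrite >⇒≤ᵇ-false {x} {j} (ℕₚ.≤∧≢⇒< (Sorted-∈ ρ s j∈ρ) (λ { refl → subst T (trans (sym (≡ᵇ-refl j)) eq) tt }))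
  = cong (x ∷_) (insert-delete j ρ (Sorted-tail x ρ s) j∈ρ)
... | true  | _ with ℕₚ.≡ᵇ⇒≡ x j (subst T (sym eq) tt)
insert-delete j (j ∷ [])    s j∈ | true | _ | refl = refl
insert-delete j (j ∷ y ∷ ρ) s j∈ | true | _ | refl rewrite ≤⇒≤ᵇ-true (Sorted-head ρ s) = refl

sumℕ-insert : ∀ j ρ → sumℕ (insert j ρ) ≡ j ℕ.+ sumℕ ρ
sumℕ-insert j []      = refl
sumℕ-insert j (x ∷ ρ) with x ≤ᵇ j
... | true  = refl
... | false = trans (cong (x ℕ.+_) (sumℕ-insert j ρ)) (ℕSolver.+-*-Solver.solve 3 (λ x j s → x :+ (j :+ s) := j :+ (x :+ s)) refl x j (sumℕ ρ))
  where open ℕSolver.+-*-Solver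

length-insert : ∀ j ρ → length (insert j ρ) ≡ suc (length ρ)
length-insert j []      = refl
length-insert j (x ∷ ρ) with x ≤ᵇ j
... | true  = refl
... | false = cong suc (length-insert j ρ)

mult-here : ∀ i ρ → mult i (i ∷ ρ) ≡ suc (mult i ρ)
mult-here i ρ rewrite ≡ᵇ-refl i = refl

mult-there : ∀ {i x} ρ → x ≢ i → mult i (x ∷ ρ) ≡ mult i ρ
mult-there {i} {x} ρ x≢i rewrite ≢⇒≡ᵇ-false x≢i = refl

mult-∷-cong : ∀ i x {ρ σ} → mult i ρ ≡ mult i σ → mult i (x ∷ ρ) ≡ mult i (x ∷ σ)
mult-∷-cong i x eq with x ≡ᵇ i
... | true  = cong suc eq
... | false = eq

mult-swap : ∀ i x y ρ → mult i (x ∷ y ∷ ρ) ≡ mult i (y ∷ x ∷ ρ)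
mult-swap i x y ρ with x ≡ᵇ i in e₁ | y ≡ᵇ i in e₂
... | true  | true  rewrite e₁ | e₂ = refl
... | true  | false rewrite e₁ | e₂ = refl
... | false | true  rewrite e₁ | e₂ = refl
... | false | false rewrite e₁ | e₂ = refl

mult-insert : ∀ i j ρ → mult i (insert j ρ) ≡ mult i (j ∷ ρ)
mult-insert i j []      = refl
mult-insert i j (x ∷ ρ) with x ≤ᵇ j
... | true  = refl
... | false = trans (mult-∷-cong i x {insert j ρ} {j ∷ ρ} (mult-insert i j ρ)) (mult-swap i x j ρ)

mult-∉ : ∀ {i} ρ → i ∉ ρ → mult i ρ ≡ 0
mult-∉ []      i∉ = refl
mult-∉ {i} (x ∷ ρ) i∉ = trans (mult-there {i} {x} ρ (λ { refl → i∉ (here refl) })) (mult-∉ ρ (i∉ ∘ there))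

∈⇒≤sumℕ : ∀ {x} ρ → x ∈ ρ → x ≤ sumℕ ρ
∈⇒≤sumℕ (x ∷ ρ) (here refl) = ℕₚ.m≤m+n x (sumℕ ρ)
∈⇒≤sumℕ (y ∷ ρ) (there x∈)  = ℕₚ.≤-trans (∈⇒≤sumℕ ρ x∈) (ℕₚ.m≤n+m (sumℕ ρ) y)

partition-intro : ∀ {m} ρ → All (1 ≤_) ρ → Sorted ρ → sumℕ ρ ≡ m → IsPartition ρ m
partition-intro ρ pos s refl = T-∧⁺ (allB (1 ≤ᵇ_) ρ) (allB-⁺ (1 ≤ᵇ_) ρ (λ x∈ → ℕₚ.≤⇒≤ᵇ (All.lookup pos x∈)))
  (T-∧⁺ (nonincreasing ρ) s (ℕₚ.≡⇒≡ᵇ (sumℕ ρ) (sumℕ ρ) refl))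

partition-elim : ∀ {m} ρ → IsPartition ρ m → All (1 ≤_) ρ × Sorted ρ × sumℕ ρ ≡ m
partition-elim {m} ρ t with T-∧⁻ (allB (1 ≤ᵇ_) ρ) t
... | pos , t′ with T-∧⁻ (nonincreasing ρ) t′
... | s , eq = All.tabulate (λ {x} x∈ → ℕₚ.≤ᵇ⇒≤ 1 x (allB-⁻ (1 ≤ᵇ_) ρ pos x∈)) , s , ℕₚ.≡ᵇ⇒≡ (sumℕ ρ) m eq

length≤sumℕ : ∀ ρ → All (1 ≤_) ρ → length ρ ≤ sumℕ ρ
length≤sumℕ []      []          = ℕ.z≤n
length≤sumℕ (x ∷ ρ) (1≤x ∷ pos) = ℕₚ.+-mono-≤ 1≤x (length≤sumℕ ρ pos)

∈-partitions⁺ : ∀ {m ρ} → IsPartition ρ m → ρ ∈ partitions m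
∈-partitions⁺ {m} {ρ} part with partition-elim ρ part
... | pos , s , refl = ∈-filter⁺ (λ ρ → T? (isPartitionB ρ m))
  (∈-concatMap⁺ (allLists (map suc (upTo m)))
    (Any.map (λ { refl → allLists-complete (All.tabulate (λ {x} x∈ → small x x∈)) })
      (∈-upTo⁺ (ℕ.s≤s (length≤sumℕ ρ pos)))))
  part
  where
  small : ∀ x → x ∈ ρ → x ∈ map suc (upTo (sumℕ ρ))
  small zero    x∈ = contradiction (All.lookup pos x∈) λ ()
  small (suc x) x∈ = ∈-map⁺ suc (∈-upTo⁺ (∈⇒≤sumℕ ρ x∈))

∈-partitions⁻ : ∀ {m ρ} → ρ ∈ partitions m → IsPartition ρ m
∈-partitions⁻ {m} ρ∈ = proj₂ (∈-filter⁻ (λ ρ → T? (isPartitionB ρ m))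
  {xs = concatMap (allLists (map suc (upTo m))) (upTo (suc m))} ρ∈)

allLists-unique : ∀ {A : Set} {xs : List A} → Unique xs → ∀ n → Unique (allLists xs n)
allLists-unique u zero    = [] ∷ []
allLists-unique u (suc n) = concatMap-∷-unique _∷_ Lₚ.∷-injective u (allLists-unique u n)

partitions-unique : ∀ m → Unique (partitions m)
partitions-unique m = Uniqueₚ.filter⁺ (λ ρ → T? (isPartitionB ρ m))
  (concatMap-unique (allLists (map suc (upTo m)))
    (λ {x} {x′} y∈ y∈′ → trans (sym (allLists-length (map suc (upTo m)) x y∈)) (allLists-length (map suc (upTo m)) x′ y∈′))
    (λ n → allLists-unique (Uniqueₚ.map⁺ ℕₚ.suc-injective (Uniqueₚ.upTo⁺ m)) n)
    (Uniqueₚ.upTo⁺ (suc m)))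

insert-partition : ∀ j {k} ρ → IsPartition ρ k → IsPartition (insert (suc j) ρ) (suc j ℕ.+ k)
insert-partition j {k} ρ part with partition-elim ρ part
... | pos , s , refl = partition-intro (insert (suc j) ρ) (All.tabulate positive) (Sorted-insert (suc j) ρ s) (sumℕ-insert (suc j) ρ)
  where
  positive : ∀ {y} → y ∈ insert (suc j) ρ → 1 ≤ y
  positive y∈ with ∈-insert⁻ (suc j) ρ y∈
  ... | inj₁ refl = ℕ.s≤s ℕ.z≤n
  ... | inj₂ y∈ρ  = All.lookup pos y∈ρ

delete-partition : ∀ j {k} ρ → IsPartition ρ (suc j ℕ.+ k) → suc j ∈ ρ → IsPartition (delete (suc j) ρ) k
delete-partition j {k} ρ part j∈ with partition-elim ρ part
... | pos , s , eq = partition-intro (delete (suc j) ρ) (All.tabulate (All.lookup pos ∘ ∈-delete⁻ (suc j) ρ))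
  (Sorted-delete (suc j) ρ s)
  (ℕₚ.+-cancelˡ-≡ (suc j) _ _ (trans (sym (sumℕ-insert (suc j) (delete (suc j) ρ)))
    (trans (cong sumℕ (insert-delete (suc j) ρ s j∈)) eq)))


-- Adding a part j + 1 is a bijection inverted by deleting one such part; as both enumerations are
-- free of repetitions, mutual inclusion suffices.
partitions-with-part : ∀ j k → filter (suc j ∈?_) (partitions (suc j ℕ.+ k)) ↭ map (insert (suc j)) (partitions k)
partitions-with-part j k = unique-⊆⊇⇒↭
  (Uniqueₚ.filter⁺ (suc j ∈?_) (partitions-unique (suc j ℕ.+ k)))
  (Uniqueₚ.map⁺ (λ {ρ} {σ} eq → trans (sym (delete-insert (suc j) ρ)) (trans (cong (delete (suc j)) eq) (delete-insert (suc j) σ)))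
    (partitions-unique k))
  to from
  where
  to : ∀ {ρ} → ρ ∈ filter (suc j ∈?_) (partitions (suc j ℕ.+ k)) → ρ ∈ map (insert (suc j)) (partitions k)
  to {ρ} ρ∈ with ∈-filter⁻ (suc j ∈?_) {xs = partitions (suc j ℕ.+ k)} ρ∈
  ... | ρ∈′ , j∈ = subst (_∈ map (insert (suc j)) (partitions k))
    (insert-delete (suc j) ρ (proj₁ (proj₂ (partition-elim ρ (∈-partitions⁻ {suc j ℕ.+ k} ρ∈′)))) j∈)
    (∈-map⁺ (insert (suc j)) (∈-partitions⁺ {k} {delete (suc j) ρ} (delete-partition j ρ (∈-partitions⁻ {suc j ℕ.+ k} ρ∈′) j∈)))
  from : ∀ {ρ} → ρ ∈ map (insert (suc j)) (partitions k) → ρ ∈ filter (suc j ∈?_) (partitions (suc j ℕ.+ k))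
  from ρ∈ with ∈-map⁻ (insert (suc j)) ρ∈
  ... | σ , σ∈ , refl = ∈-filter⁺ (suc j ∈?_)
    (∈-partitions⁺ {suc j ℕ.+ k} (insert-partition j σ (∈-partitions⁻ {k} σ∈))) (∈-insert (suc j) σ)

∏ : ℕ → (ℕ → ℕ) → ℕ
∏ N f = foldr ℕ._*_ 1 (map f (upTo N))

∏-suc : ∀ N f → ∏ (suc N) f ≡ f 0 ℕ.* ∏ N (f ∘ suc)
∏-suc N f = cong (λ xs → f 0 ℕ.* foldr ℕ._*_ 1 xs) (trans (map-applyUpTo suc f N) (sym (map-applyUpTo id (f ∘ suc) N)))

∏-cong : ∀ N {f g} → (∀ i → f i ≡ g i) → ∏ N f ≡ ∏ N g
∏-cong N h = cong (foldr ℕ._*_ 1) (map-cong h (upTo N))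

∏-extend : ∀ M N {f} → (∀ i → N ≤ i → f i ≡ 1) → ∏ (N ℕ.+ M) f ≡ ∏ N f
∏-extend zero    zero    h = refl
∏-extend (suc M) zero    {f} h = trans (∏-suc M f) (trans (cong (ℕ._* ∏ M (f ∘ suc)) (h 0 ℕ.z≤n))
  (trans (ℕₚ.*-identityˡ _) (∏-extend M zero (λ i _ → h (suc i) ℕ.z≤n))))
∏-extend M       (suc N) {f} h = trans (∏-suc (N ℕ.+ M) f) (trans
  (cong (f 0 ℕ.*_) (∏-extend M N (λ i N≤i → h (suc i) (ℕ.s≤s N≤i)))) (sym (∏-suc N f)))

∏-update : ∀ {N j f g c} → j < N → (∀ i → i ≢ j → f i ≡ g i) → f j ≡ c ℕ.* g j → ∏ N f ≡ c ℕ.* ∏ N g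
∏-update {suc N} {zero} {f} {g} {c} _ h eq = begin
  ∏ (suc N) f  ≡⟨ ∏-suc N f ⟩
  f 0 ℕ.* ∏ N (f ∘ suc)  ≡⟨ cong₂ ℕ._*_ eq (∏-cong N (λ i → h (suc i) λ ())) ⟩
  c ℕ.* g 0 ℕ.* ∏ N (g ∘ suc)  ≡⟨ ℕₚ.*-assoc c (g 0) _ ⟩
  c ℕ.* (g 0 ℕ.* ∏ N (g ∘ suc))  ≡⟨ cong (c ℕ.*_) (∏-suc N g) ⟨
  c ℕ.* ∏ (suc N) g  ∎
  where open ≡.≡-Reasoning
∏-update {suc N} {suc j} {f} {g} {c} (ℕ.s≤s j<N) h eq = begin
  ∏ (suc N) f  ≡⟨ ∏-suc N f ⟩
  f 0 ℕ.* ∏ N (f ∘ suc)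
    ≡⟨ cong₂ ℕ._*_ (h 0 λ ()) (∏-update {c = c} j<N (λ i i≢j → h (suc i) (i≢j ∘ ℕₚ.suc-injective)) eq) ⟩
  g 0 ℕ.* (c ℕ.* ∏ N (g ∘ suc))
    ≡⟨ solve 3 (λ a b c → a :* (b :* c) := b :* (a :* c)) refl (g 0) c (∏ N (g ∘ suc)) ⟩
  c ℕ.* (g 0 ℕ.* ∏ N (g ∘ suc))  ≡⟨ cong (c ℕ.*_) (∏-suc N g) ⟨
  c ℕ.* ∏ (suc N) g  ∎
  where
  open ≡.≡-Reasoning
  open ℕSolver.+-*-Solver

-- Only the factor of the inserted part changes, from i^m m! to i^(m+1) (m+1)!. The range of the
-- product grows with the sum, but the added factors are 1 because no part of ρ exceeds the sum of
-- ρ.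
z-insert : ∀ j ρ → z (insert (suc j) ρ) ≡ (suc j ℕ.* mult (suc j) (insert (suc j) ρ)) ℕ.* z ρ
z-insert j ρ = begin
  z (insert (suc j) ρ)
    ≡⟨ cong (λ N → ∏ N (factorOf (insert (suc j) ρ))) (trans (sumℕ-insert (suc j) ρ) (ℕₚ.+-comm (suc j) (sumℕ ρ))) ⟩
  ∏ (sumℕ ρ ℕ.+ suc j) (factorOf (insert (suc j) ρ))
    ≡⟨ ∏-update {c = suc j ℕ.* mult (suc j) (insert (suc j) ρ)} (ℕₚ.m≤n+m (suc j) (sumℕ ρ))
         (λ i i≢j → cong (λ m → (suc i ℕ.^ m) ℕ.* m !) (trans (mult-insert (suc i) (suc j) ρ) (mult-there ρ (i≢j ∘ sym ∘ ℕₚ.suc-injective)))) at-j ⟩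
  (suc j ℕ.* mult (suc j) (insert (suc j) ρ)) ℕ.* ∏ (sumℕ ρ ℕ.+ suc j) (factorOf ρ)
    ≡⟨ cong ((suc j ℕ.* mult (suc j) (insert (suc j) ρ)) ℕ.*_) (∏-extend (suc j) (sumℕ ρ)
         (λ i s≤i → cong (λ m → (suc i ℕ.^ m) ℕ.* m !) (mult-∉ ρ (λ i∈ → ℕₚ.<⇒≱ (ℕ.s≤s s≤i) (∈⇒≤sumℕ ρ i∈))))) ⟩
  (suc j ℕ.* mult (suc j) (insert (suc j) ρ)) ℕ.* z ρ ∎
  where
  open ≡.≡-Reasoning
  factorOf : List ℕ → ℕ → ℕ
  factorOf ρ i = (suc i ℕ.^ mult (suc i) ρ) ℕ.* (mult (suc i) ρ) !
  at-j : factorOf (insert (suc j) ρ) j ≡ (suc j ℕ.* mult (suc j) (insert (suc j) ρ)) ℕ.* factorOf ρ j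
  at-j rewrite mult-insert (suc j) (suc j) ρ | mult-here (suc j) ρ =
    solve 4 (λ j m p f → (j :* p) :* (m :* f) := (j :* m) :* (p :* f)) refl
      (suc j) (suc (mult (suc j) ρ)) (suc j ℕ.^ mult (suc j) ρ) (mult (suc j) ρ !)
    where open ℕSolver.+-*-Solver

z-nonzero : ∀ ρ → z ρ ≢ 0
z-nonzero ρ = ∏-nonzero (upTo (sumℕ ρ))
  where
  ∏-nonzero : ∀ xs → foldr ℕ._*_ 1 (map (λ i → (suc i ℕ.^ mult (suc i) ρ) ℕ.* (mult (suc i) ρ) !) xs) ≢ 0
  ∏-nonzero []       ()
  ∏-nonzero (i ∷ xs) eq with ℕₚ.m*n≡0⇒m≡0∨n≡0 ((suc i ℕ.^ mult (suc i) ρ) ℕ.* (mult (suc i) ρ) !) eq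
  ... | inj₂ eq₂ = ∏-nonzero xs eq₂
  ... | inj₁ eq₁ with ℕₚ.m*n≡0⇒m≡0∨n≡0 (suc i ℕ.^ mult (suc i) ρ) eq₁
  ... | inj₁ e = contradiction (ℕₚ.m^n≡0⇒m≡0 (suc i) (mult (suc i) ρ) e) λ ()
  ... | inj₂ e = ℕ.≢-nonZero⁻¹ (mult (suc i) ρ !) {{ℕₚ._!≢0 (mult (suc i) ρ)}} e

sumℕ-mult : ∀ N ρ → All (1 ≤_) ρ → All (_≤ N) ρ → ℕ∑.∑ (upTo N) (λ i → suc i ℕ.* mult (suc i) ρ) ≡ sumℕ ρ
sumℕ-mult N []          []          []          = ℕ∑.∑-zero (upTo N) (λ {i} _ → ℕₚ.*-zeroʳ (suc i))
sumℕ-mult N (suc x ∷ ρ) (_ ∷ pos) (x<N ∷ bnd) = begin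
  ℕ∑.∑ (upTo N) (λ i → suc i ℕ.* mult (suc i) (suc x ∷ ρ))
    ≡⟨ ℕ∑.∑-cong′ (upTo N) (λ i → split i) ⟩
  ℕ∑.∑ (upTo N) (λ i → ℕ∑.when (x ℕ.≟ i) (suc i) ℕ.+ suc i ℕ.* mult (suc i) ρ)
    ≡⟨ ℕ∑.∑-distrib-+ (upTo N) _ _ ⟩
  ℕ∑.∑ (upTo N) (λ i → ℕ∑.when (x ℕ.≟ i) (suc i)) ℕ.+ ℕ∑.∑ (upTo N) (λ i → suc i ℕ.* mult (suc i) ρ)
    ≡⟨ cong₂ ℕ._+_ (trans (ℕ∑.∑-single _ (Uniqueₚ.upTo⁺ N) (∈-upTo⁺ x<N) (λ {i} _ i≢x → ℕ∑.when-no (x ℕ.≟ i) (i≢x ∘ sym)))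
         (ℕ∑.when-yes (x ℕ.≟ x) refl)) (sumℕ-mult N ρ pos bnd) ⟩
  suc x ℕ.+ sumℕ ρ ∎
  where
  open ≡.≡-Reasoning
  split : ∀ i → suc i ℕ.* mult (suc i) (suc x ∷ ρ) ≡ ℕ∑.when (x ℕ.≟ i) (suc i) ℕ.+ suc i ℕ.* mult (suc i) ρ
  split i = case x ℕ.≟ i of λ
    { (yes refl) → trans (cong (suc i ℕ.*_) (mult-here (suc i) ρ)) (trans (ℕₚ.*-suc (suc i) (mult (suc i) ρ))
        (cong (ℕ._+ suc i ℕ.* mult (suc i) ρ) (sym (ℕ∑.when-yes (i ℕ.≟ i) refl))))
    ; (no x≢i) → trans (cong (suc i ℕ.*_) (mult-there ρ (x≢i ∘ ℕₚ.suc-injective)))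
        (cong (ℕ._+ suc i ℕ.* mult (suc i) ρ) (sym (ℕ∑.when-no (x ℕ.≟ i) x≢i)))
    }

-- The statistic n of the conjugate partition

weightedSum : ℕ → List ℕ → ℕ
weightedSum i []       = 0
weightedSum i (x ∷ xs) = i ℕ.* x ℕ.+ weightedSum (suc i) xs

private
  weightedSum-unique : (g : ℕ → List ℕ → ℕ) → (∀ i → g i [] ≡ 0) →
                       (∀ i x xs → g i (x ∷ xs) ≡ i ℕ.* x ℕ.+ g (suc i) xs) → ∀ i xs → g i xs ≡ weightedSum i xs
  weightedSum-unique g n c i []       = n i
  weightedSum-unique g n c i (x ∷ xs) = trans (c i x xs) (cong (i ℕ.* x ℕ.+_) (weightedSum-unique g n c (suc i) xs))

-- Naming the local function of nStat by unification, as for linIndep above.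
mutual
  private
    go≗weightedSum : (μ : List ℕ) → ∀ i xs → _ ≡ weightedSum i xs
    go≗weightedSum μ = weightedSum-unique _ (λ _ → refl) (λ _ _ _ → refl)

  nStat≡weightedSum : ∀ μ → nStat μ ≡ weightedSum 0 μ
  nStat≡weightedSum []      = refl
  nStat≡weightedSum (x ∷ xs) with x ∷ xs | 1
  ... | μ | i = go≗weightedSum μ i xs

∑-upTo-suc : ∀ n (f : ℕ → ℕ) → ℕ∑.∑ (upTo (suc n)) f ≡ ℕ∑.∑ (upTo n) f ℕ.+ f n
∑-upTo-suc n f = trans (cong (λ xs → ℕ∑.∑ xs f) (sym (upTo-∷ʳ n)))
  (trans (ℕ∑.∑-++ (upTo n) (n ∷ []) f) (cong (ℕ∑.∑ (upTo n) f ℕ.+_) (ℕₚ.+-identityʳ (f n))))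

triangular : ℕ → ℕ
triangular n = ℕ∑.∑ (upTo n) id

weightedSum-applyUpTo : ∀ i f n → weightedSum i (applyUpTo f n) ≡ ℕ∑.∑ (upTo n) (λ j → (i ℕ.+ j) ℕ.* f j)
weightedSum-applyUpTo i f zero    = refl
weightedSum-applyUpTo i f (suc n) = cong₂ ℕ._+_ (cong (ℕ._* f 0) (sym (ℕₚ.+-identityʳ i))) (begin
  weightedSum (suc i) (applyUpTo (f ∘ suc) n)  ≡⟨ weightedSum-applyUpTo (suc i) (f ∘ suc) n ⟩
  ℕ∑.∑ (upTo n) (λ j → (suc i ℕ.+ j) ℕ.* f (suc j))
    ≡⟨ ℕ∑.∑-cong′ (upTo n) (λ j → cong (ℕ._* f (suc j)) (sym (ℕₚ.+-suc i j))) ⟩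
  ℕ∑.∑ (upTo n) (λ j → (i ℕ.+ suc j) ℕ.* f (suc j))  ≡⟨ ℕ∑.∑-map suc (upTo n) _ ⟨
  ℕ∑.∑ (map suc (upTo n)) (λ j → (i ℕ.+ j) ℕ.* f j)
    ≡⟨ cong (λ xs → ℕ∑.∑ xs (λ j → (i ℕ.+ j) ℕ.* f j)) (map-applyUpTo id suc n) ⟩
  ℕ∑.∑ (applyUpTo suc n) (λ j → (i ℕ.+ j) ℕ.* f j) ∎)
  where open ≡.≡-Reasoning

length-filter : ∀ {A : Set} {P : A → Set} (P? : ∀ x → Dec (P x)) xs → length (filter P? xs) ≡ ℕ∑.∑ xs (λ x → ℕ∑.when (P? x) 1)
length-filter P? xs = trans (sym (trans (∑-const (filter P? xs) 1) (ℕₚ.*-identityʳ _))) (ℕ∑.∑-filter P? xs (λ _ → 1))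

∑-below : ∀ x M → x ≤ M → ℕ∑.∑ (upTo M) (λ j → j ℕ.* ℕ∑.when (T? (suc j ≤ᵇ x)) 1) ≡ triangular x
∑-below x M x≤M with ℕₚ.m≤n⇒∃[o]m+o≡n x≤M
... | d , refl = extend d
  where
  open ≡.≡-Reasoning
  f : ℕ → ℕ
  f j = j ℕ.* ℕ∑.when (T? (suc j ≤ᵇ x)) 1
  extend : ∀ d → ℕ∑.∑ (upTo (x ℕ.+ d)) f ≡ triangular x
  extend zero    = trans (cong (λ m → ℕ∑.∑ (upTo m) f) (ℕₚ.+-identityʳ x)) (ℕ∑.∑-cong (upTo x) (λ {j} j∈ →
    trans (cong (j ℕ.*_) (ℕ∑.when-yes (T? (suc j ≤ᵇ x)) (ℕₚ.≤⇒≤ᵇ (∈-upTo⁻ j∈)))) (ℕₚ.*-identityʳ j)))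
  extend (suc d) = begin
    ℕ∑.∑ (upTo (x ℕ.+ suc d)) f  ≡⟨ cong (λ m → ℕ∑.∑ (upTo m) f) (ℕₚ.+-suc x d) ⟩
    ℕ∑.∑ (upTo (suc (x ℕ.+ d))) f  ≡⟨ ∑-upTo-suc (x ℕ.+ d) f ⟩
    ℕ∑.∑ (upTo (x ℕ.+ d)) f ℕ.+ f (x ℕ.+ d)
      ≡⟨ cong₂ ℕ._+_ (extend d) (trans (cong ((x ℕ.+ d) ℕ.*_) (ℕ∑.when-no (T? (suc (x ℕ.+ d) ≤ᵇ x))
           (λ t → ℕₚ.<⇒≱ (ℕₚ.≤ᵇ⇒≤ (suc (x ℕ.+ d)) x t) (ℕₚ.m≤m+n x d)))) (ℕₚ.*-zeroʳ (x ℕ.+ d))) ⟩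
    triangular x ℕ.+ 0  ≡⟨ ℕₚ.+-identityʳ _ ⟩
    triangular x  ∎

-- Both sides add up the column index j over the cells of the diagram, once by columns and once by
-- rows; a row of length x contributes 0 + 1 + ... + (x - 1).
nStat-conjugate : ∀ λs → nStat (conjugate λs) ≡ ℕ∑.∑ λs triangular
nStat-conjugate λs = begin
  nStat (conjugate λs)  ≡⟨ nStat≡weightedSum (conjugate λs) ⟩
  weightedSum 0 (map above (upTo M))  ≡⟨ cong (weightedSum 0) (map-applyUpTo id above M) ⟩
  weightedSum 0 (applyUpTo above M)  ≡⟨ weightedSum-applyUpTo 0 above M ⟩
  ℕ∑.∑ (upTo M) (λ j → j ℕ.* above j)
    ≡⟨ ℕ∑.∑-cong′ (upTo M) (λ j → trans (cong (j ℕ.*_) (length-filter (λ x → T? (suc j ≤ᵇ x)) λs)) (ℕ∑.*-distribˡ-∑ λs _ j)) ⟩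
  ℕ∑.∑ (upTo M) (λ j → ℕ∑.∑ λs (λ x → j ℕ.* ℕ∑.when (T? (suc j ≤ᵇ x)) 1)) ≡⟨ ℕ∑.∑-swap (upTo M) λs _ ⟩
  ℕ∑.∑ λs (λ x → ℕ∑.∑ (upTo M) (λ j → j ℕ.* ℕ∑.when (T? (suc j ≤ᵇ x)) 1))
    ≡⟨ ℕ∑.∑-cong λs (λ {x} x∈ → ∑-below x M (≤-maxℕ λs x∈)) ⟩
  ℕ∑.∑ λs triangular ∎
  where
  open ≡.≡-Reasoning
  M = maxℕ λs
  above : ℕ → ℕ
  above j = length (filter (λ x → T? (suc j ≤ᵇ x)) λs)

^ℚ-+ : ∀ x m n → x ^ℚ (m ℕ.+ n) ≡ x ^ℚ m ℚ.* x ^ℚ n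
^ℚ-+ x zero    n = sym (ℚₚ.*-identityˡ (x ^ℚ n))
^ℚ-+ x (suc m) n = trans (cong (x ℚ.*_) (^ℚ-+ x m n)) (sym (ℚₚ.*-assoc x (x ^ℚ m) (x ^ℚ n)))

inv-^ : ∀ {x} → x ≢ 0ℚ → ∀ m → inv (x ^ℚ m) ≡ inv x ^ℚ m
inv-^ {x} x≢0 m = inv-unique {x ^ℚ m} (power m)
  where
  open +-*-Solver
  power : ∀ m → x ^ℚ m ℚ.* inv x ^ℚ m ≡ 1ℚ
  power zero    = refl
  power (suc m) = trans (solve 4 (λ a b c d → (a :* b) :* (c :* d) := (a :* c) :* (b :* d)) refl x (x ^ℚ m) (inv x) (inv x ^ℚ m))
    (cong₂ ℚ._*_ (*-inv x≢0) (power m))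

prodℚ-∷ʳ : ∀ xs y → prodℚ (xs ∷ʳ y) ≡ prodℚ xs ℚ.* y
prodℚ-∷ʳ []       y = trans (ℚₚ.*-identityʳ y) (sym (ℚₚ.*-identityˡ y))
prodℚ-∷ʳ (x ∷ xs) y = trans (cong (x ℚ.*_) (prodℚ-∷ʳ xs y)) (sym (ℚₚ.*-assoc x (prodℚ xs) y))

-- Scalar multiples and finite sums of polynomials

module PolynomialSums where
  open CommutativeRing polyRing using (setoid; semiring; commutativeSemiring; reflexive; *-congˡ; *-congʳ)
  open import Relation.Binary.Reasoning.Setoid setoid
  open import Algebra.Properties.Semiring.Mult semiring using () renaming (_×_ to _⋆_)
  open import Algebra.Properties.Semiring.Exp semiring using (_^_)


  module P∑ = Sum commutativeSemiring

  scale-congˡ : ∀ {c d} p → c ≡ d → scale c p ≋ scale d p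
  scale-congˡ p refl = ≋-refl

  scale-+ : ∀ c d p → scale (c ℚ.+ d) p ≋ scale c p ⊕ scale d p
  scale-+ c d p = coefficientwise (λ i → trans (coeff-scale (c ℚ.+ d) p i)
    (trans (ℚₚ.*-distribʳ-+ (coeff p i) c d)
      (sym (trans (coeff-⊕ (scale c p) (scale d p) i) (cong₂ ℚ._+_ (coeff-scale c p i) (coeff-scale d p i))))))

  scale-⊗-scale : ∀ c d p r → scale c p ⊗ scale d r ≋ scale (c ℚ.* d) (p ⊗ r)
  scale-⊗-scale c d p r = begin
    scale c p ⊗ scale d r  ≈⟨ scale-⊗ c p (scale d r) ⟩
    scale c (p ⊗ scale d r)  ≈⟨ scale-cong c (⊗-comm p (scale d r)) ⟩
    scale c (scale d r ⊗ p)  ≈⟨ scale-cong c (scale-⊗ d r p) ⟩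
    scale c (scale d (r ⊗ p))  ≈⟨ scale-scale c d (r ⊗ p) ⟩
    scale (c ℚ.* d) (r ⊗ p)  ≈⟨ scale-cong (c ℚ.* d) (⊗-comm r p) ⟩
    scale (c ℚ.* d) (p ⊗ r)  ∎

  scale-cancel : ∀ {c p r} → c ≢ 0ℚ → scale c p ≋ scale c r → p ≋ r
  scale-cancel {c} {p} {r} c≢0 (coefficientwise h) = coefficientwise (λ i →
    *-cancelˡ c≢0 (trans (sym (coeff-scale c p i)) (trans (h i) (coeff-scale c r i))))

  ∑-scale : ∀ {A : Set} c (xs : List A) (f : A → Poly) → scale c (P∑.∑ xs f) ≋ P∑.∑ xs (scale c ∘ f)
  ∑-scale c []       f = ≋-refl
  ∑-scale c (x ∷ xs) f = ≋-trans (scale-⊕ c (f x) (P∑.∑ xs f)) (⊕-congˡ (scale c (f x)) (∑-scale c xs f))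

  scale-∑ : ∀ {A : Set} (xs : List A) (c : A → ℕ) p → scale (ℕ→ℚ (ℕ∑.∑ xs c)) p ≋ P∑.∑ xs (λ x → scale (ℕ→ℚ (c x)) p)
  scale-∑ []       c p = scale-0 p
  scale-∑ (x ∷ xs) c p = begin
    scale (ℕ→ℚ (c x ℕ.+ ℕ∑.∑ xs c)) p  ≈⟨ scale-congˡ p (ℕ→ℚ-+ (c x) (ℕ∑.∑ xs c)) ⟩
    scale (ℕ→ℚ (c x) ℚ.+ ℕ→ℚ (ℕ∑.∑ xs c)) p  ≈⟨ scale-+ (ℕ→ℚ (c x)) (ℕ→ℚ (ℕ∑.∑ xs c)) p ⟩
    scale (ℕ→ℚ (c x)) p ⊕ scale (ℕ→ℚ (ℕ∑.∑ xs c)) p  ≈⟨ ⊕-congˡ (scale (ℕ→ℚ (c x)) p) (scale-∑ xs c p) ⟩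
    scale (ℕ→ℚ (c x)) p ⊕ P∑.∑ xs (λ x → scale (ℕ→ℚ (c x)) p) ∎

  ⋆1≋constP : ∀ n → n ⋆ constP 1ℚ ≋ constP (ℕ→ℚ n)
  ⋆1≋constP zero    = coefficientwise (λ { zero → refl ; (suc i) → refl })
  ⋆1≋constP (suc n) = ≋-trans (⊕-congˡ (constP 1ℚ) (⋆1≋constP n))
    (≋-trans (≋-sym (constP-+ 1ℚ (ℕ→ℚ n))) (reflexive (cong constP (sym (ℕ→ℚ-+ 1 n)))))

  ⋆1-⊗ : ∀ n p → (n ⋆ constP 1ℚ) ⊗ p ≋ scale (ℕ→ℚ n) p
  ⋆1-⊗ n p = ≋-trans (*-congʳ {p} (⋆1≋constP n)) (≋-sym (scale≋constP-⊗ (ℕ→ℚ n) p))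

  constP-^ : ∀ x m → constP x ^ m ≋ constP (x ^ℚ m)
  constP-^ x zero    = ≋-refl
  constP-^ x (suc m) = ≋-trans (*-congˡ {constP x} (constP-^ x m)) (≋-sym (constP-* x (x ^ℚ m)))

  ℕ→ℚ-suc≢0 : ∀ n → ℕ→ℚ (suc n) ≢ 0ℚ
  ℕ→ℚ-suc≢0 n eq = case ℕ→ℚ-injective {suc n} {0} eq of λ ()

  ℕ→ℚ-^ : ∀ m r → ℕ→ℚ m ^ℚ r ≡ ℕ→ℚ (m ℕ.^ r)
  ℕ→ℚ-^ m zero    = refl
  ℕ→ℚ-^ m (suc r) = trans (cong (ℕ→ℚ m ℚ.*_) (ℕ→ℚ-^ m r)) (sym (ℕ→ℚ-* m (m ℕ.^ r)))

  x-1≡0⇒x≡1 : ∀ {x} → x ℚ.- 1ℚ ≡ 0ℚ → x ≡ 1ℚ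
  x-1≡0⇒x≡1 {x} eq = trans (solve 1 (λ x → x := (x :- con 1ℚ) :+ con 1ℚ) refl x) (cong (ℚ._+ 1ℚ) eq)
    where open +-*-Solver

  2W : Poly
  2W = twoW (constP 1ℚ)

  twoW≋2W-⊗ : ∀ p → twoW p ≋ 2W ⊗ p
  twoW≋2W-⊗ p = ≋-sym (begin
    scale (ℕ→ℚ 2) (shiftW (constP 1ℚ)) ⊗ p  ≈⟨ scale-⊗ (ℕ→ℚ 2) (shiftW (constP 1ℚ)) p ⟩
    scale (ℕ→ℚ 2) (shiftW (constP 1ℚ) ⊗ p)  ≈⟨ scale-cong (ℕ→ℚ 2) (≋-trans (shift-⊗ (constP 1ℚ) p) (∷-cong refl (⊗-identityˡ p))) ⟩
    scale (ℕ→ℚ 2) (shiftW p)  ∎)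

  -- Turns the coefficient a_{nk} into a sum over individual matrices, which can then be exchanged
  -- with the sum over k.
  scale-count : ∀ {A : Set} {P : A → Set} (P? : ∀ x → Dec (P x)) xs p →
                scale (ℕ→ℚ (length (filter P? xs))) p ≋ P∑.∑ xs (λ x → P∑.when (P? x) p)
  scale-count P? xs p = begin
    scale (ℕ→ℚ (length (filter P? xs))) p  ≈⟨ scale-congˡ p (cong ℕ→ℚ (length-filter P? xs)) ⟩
    scale (ℕ→ℚ (ℕ∑.∑ xs (λ x → ℕ∑.when (P? x) 1))) p  ≈⟨ scale-∑ xs (λ x → ℕ∑.when (P? x) 1) p ⟩
    P∑.∑ xs (λ x → scale (ℕ→ℚ (ℕ∑.when (P? x) 1)) p)  ≈⟨ P∑.∑-cong′ xs (λ x → indicator (P? x)) ⟩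
    P∑.∑ xs (λ x → P∑.when (P? x) p)  ∎
    where
    indicator : ∀ {P : Set} (d : Dec P) → scale (ℕ→ℚ (ℕ∑.when d 1)) p ≋ P∑.when d p
    indicator (yes _) = scale-1 p
    indicator (no _)  = scale-0 p

open PolynomialSums

-- The sum over partitions of a single part of λ

module Factor (q : ℚ) (q≢0 : q ≢ 0ℚ) (q^-1≢0 : ∀ r → q ^ℚ suc r ℚ.- 1ℚ ≢ 0ℚ) where
  open CommutativeRing polyRing using (setoid; semiring; reflexive; +-cong; *-congˡ; *-congʳ; *-cong)
  open import Relation.Binary.Reasoning.Setoid setoid
  open import Algebra.Properties.Semiring.Mult semiring using () renaming (_×_ to _⋆_)
  open import Algebra.Properties.Semiring.Exp semiring using (_^_)

  q*p≋1 : constP q ⊗ constP (inv q) ≋ constP 1ℚ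
  q*p≋1 = ≋-trans (≋-sym (constP-* q (inv q))) (reflexive (cong constP (*-inv q≢0)))

  hermite≋H : ∀ m → hermite (inv q) m ≋ HermiteProducts.H polyRing (constP q) (constP (inv q)) 2W q*p≋1 m
  hermite≋H zero          = ≋-refl
  hermite≋H (suc zero)    = ≋-refl
  hermite≋H (suc (suc m)) = +-cong
    (≋-trans (twoW≋2W-⊗ (hermite (inv q) (suc m))) (*-congˡ {2W} (hermite≋H (suc m))))
    (≋-trans (scale≋constP-⊗ (inv q ^ℚ suc m ℚ.- 1ℚ) (hermite (inv q) m)) (*-cong
      (≋-trans (constP-+ (inv q ^ℚ suc m) (ℚ.- 1ℚ)) (+-cong (≋-sym (constP-^ (inv q) (suc m))) (constP-neg 1ℚ)))
      (hermite≋H m)))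

  ∏q^-1 : List ℕ → ℚ
  ∏q^-1 ρ = prodℚ (map (λ r → q ^ℚ r ℚ.- 1ℚ) ρ)

  ∏q^-1-nonzero : ∀ ρ → All (1 ≤_) ρ → ∏q^-1 ρ ≢ 0ℚ
  ∏q^-1-nonzero []          []        = λ ()
  ∏q^-1-nonzero (suc r ∷ ρ) (_ ∷ pos) = *-nonzero (q^-1≢0 r) (∏q^-1-nonzero ρ pos)

  ∏q^-1-insert : ∀ j ρ → ∏q^-1 (insert j ρ) ≡ (q ^ℚ j ℚ.- 1ℚ) ℚ.* ∏q^-1 ρ
  ∏q^-1-insert j []      = refl
  ∏q^-1-insert j (x ∷ ρ) with x ℕ.≤ᵇ j
  ... | true  = refl
  ... | false = trans (cong ((q ^ℚ x ℚ.- 1ℚ) ℚ.*_) (∏q^-1-insert j ρ))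
    (solve 3 (λ x j s → x :* (j :* s) := j :* (x :* s)) refl (q ^ℚ x ℚ.- 1ℚ) (q ^ℚ j ℚ.- 1ℚ) (∏q^-1 ρ))
    where open +-*-Solver

  chebP-insert : ∀ j ρ → chebP (insert j ρ) ≋ cheb j ⊗ chebP ρ
  chebP-insert j []      = ≋-refl
  chebP-insert j (x ∷ ρ) with x ℕ.≤ᵇ j
  ... | true  = ≋-refl
  ... | false = begin
    cheb x ⊗ chebP (insert j ρ)  ≈⟨ *-congˡ {cheb x} (chebP-insert j ρ) ⟩
    cheb x ⊗ (cheb j ⊗ chebP ρ)  ≈⟨ ⊗-assoc (cheb x) (cheb j) (chebP ρ) ⟨
    (cheb x ⊗ cheb j) ⊗ chebP ρ  ≈⟨ *-congʳ {chebP ρ} (⊗-comm (cheb x) (cheb j)) ⟩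
    (cheb j ⊗ cheb x) ⊗ chebP ρ  ≈⟨ ⊗-assoc (cheb j) (cheb x) (chebP ρ) ⟩
    cheb j ⊗ (cheb x ⊗ chebP ρ)  ∎

  term : List ℕ → Poly
  term ρ = scale (ℕ→ℚ (2 ℕ.^ length ρ) ℚ.* inv (ℕ→ℚ (z ρ) ℚ.* ∏q^-1 ρ)) (chebP ρ)

  cycleIndex : ℕ → Poly
  cycleIndex m = sumP (map term (partitions m))

  -- Entry j is the power sum of degree j + 1, so that convolutions start at index 0.
  powerSum : ℕ → Poly
  powerSum j = scale (ℕ→ℚ 2 ℚ.* inv (q ^ℚ suc j ℚ.- 1ℚ)) (cheb (suc j))

  -- The factor (j+1) m_{j+1} is the ratio of the two values of `z` and cancels. The remaining new
  -- factors 2, 1/(q^(j+1) - 1) and T_{j+1} make up the power sum.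
  term-insert : ∀ j ρ → All (1 ≤_) ρ →
    scale (ℕ→ℚ (suc j ℕ.* mult (suc j) (insert (suc j) ρ))) (term (insert (suc j) ρ)) ≋ powerSum j ⊗ term ρ
  term-insert j ρ pos = begin
    scale (ℕ→ℚ c) (term (insert (suc j) ρ))
      ≈⟨ scale-scale (ℕ→ℚ c) _ (chebP (insert (suc j) ρ)) ⟩
    scale (ℕ→ℚ c ℚ.* (ℕ→ℚ (2 ℕ.^ length (insert (suc j) ρ)) ℚ.* inv (ℕ→ℚ (z (insert (suc j) ρ)) ℚ.* ∏q^-1 (insert (suc j) ρ)))) (chebP (insert (suc j) ρ))
      ≈⟨ scale-congˡ (chebP (insert (suc j) ρ)) coefficient ⟩
    scale (α ℚ.* β) (chebP (insert (suc j) ρ))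
      ≈⟨ scale-cong (α ℚ.* β) (chebP-insert (suc j) ρ) ⟩
    scale (α ℚ.* β) (cheb (suc j) ⊗ chebP ρ)
      ≈⟨ scale-⊗-scale α β (cheb (suc j)) (chebP ρ) ⟨
    powerSum j ⊗ term ρ ∎
    where
    c = suc j ℕ.* mult (suc j) (insert (suc j) ρ)
    x = q ^ℚ suc j ℚ.- 1ℚ
    π = ∏q^-1 ρ
    ζ = ℕ→ℚ (z ρ)
    α = ℕ→ℚ 2 ℚ.* inv x
    β = ℕ→ℚ (2 ℕ.^ length ρ) ℚ.* inv (ζ ℚ.* π)
    c≢0 : ℕ→ℚ c ≢ 0ℚ
    c≢0 eq = z-nonzero (insert (suc j) ρ) (trans (z-insert j ρ) (cong (ℕ._* z ρ) (ℕ→ℚ-injective {c} {0} eq)))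
    ζπ≢0 : ζ ℚ.* π ≢ 0ℚ
    ζπ≢0 = *-nonzero (λ eq → z-nonzero ρ (ℕ→ℚ-injective {z ρ} {0} eq)) (∏q^-1-nonzero ρ pos)
    open +-*-Solver
    coefficient : ℕ→ℚ c ℚ.* (ℕ→ℚ (2 ℕ.^ length (insert (suc j) ρ)) ℚ.* inv (ℕ→ℚ (z (insert (suc j) ρ)) ℚ.* ∏q^-1 (insert (suc j) ρ))) ≡ α ℚ.* β
    coefficient = trans (cong₂ (λ u v → ℕ→ℚ c ℚ.* (u ℚ.* inv v))
        (trans (cong (λ l → ℕ→ℚ (2 ℕ.^ l)) (length-insert (suc j) ρ)) (ℕ→ℚ-* 2 (2 ℕ.^ length ρ)))
        (trans (cong₂ ℚ._*_ (trans (cong ℕ→ℚ (z-insert j ρ)) (ℕ→ℚ-* c (z ρ))) (∏q^-1-insert (suc j) ρ))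
          (solve 4 (λ c ζ x π → (c :* ζ) :* (x :* π) := c :* (x :* (ζ :* π))) refl (ℕ→ℚ c) ζ x π)))
      (trans (cong (λ u → ℕ→ℚ c ℚ.* ((ℕ→ℚ 2 ℚ.* ℕ→ℚ (2 ℕ.^ length ρ)) ℚ.* u))
          (trans (inv-* c≢0 (*-nonzero (q^-1≢0 j) ζπ≢0)) (cong (inv (ℕ→ℚ c) ℚ.*_) (inv-* (q^-1≢0 j) ζπ≢0))))
      (trans (solve 6 (λ c c′ t l x y → c :* ((t :* l) :* (c′ :* (x :* y))) := (c :* c′) :* ((t :* x) :* (l :* y))) refl
          (ℕ→ℚ c) (inv (ℕ→ℚ c)) (ℕ→ℚ 2) (ℕ→ℚ (2 ℕ.^ length ρ)) (inv x) (inv (ζ ℚ.* π)))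
      (trans (cong (ℚ._* (α ℚ.* β)) (*-inv c≢0)) (ℚₚ.*-identityˡ (α ℚ.* β)))))

  -- The weight vanishes on partitions without the part j + 1, and all others arise by insertion
  -- from partitions of k.
  ∑-partitions-with-part : ∀ j k →
    P∑.∑ (partitions (suc j ℕ.+ k)) (λ ρ → scale (ℕ→ℚ (suc j ℕ.* mult (suc j) ρ)) (term ρ)) ≋ powerSum j ⊗ cycleIndex k
  ∑-partitions-with-part j k = begin
    P∑.∑ (partitions (suc j ℕ.+ k)) w
      ≈⟨ P∑.∑-cong′ (partitions (suc j ℕ.+ k)) (λ ρ → restrict ρ) ⟩
    P∑.∑ (partitions (suc j ℕ.+ k)) (λ ρ → P∑.when (suc j ∈? ρ) (w ρ))
      ≈⟨ P∑.∑-filter (suc j ∈?_) (partitions (suc j ℕ.+ k)) w ⟨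
    P∑.∑ (filter (suc j ∈?_) (partitions (suc j ℕ.+ k))) w
      ≈⟨ P∑.∑-↭ w (partitions-with-part j k) ⟩
    P∑.∑ (map (insert (suc j)) (partitions k)) w
      ≈⟨ P∑.∑-map (insert (suc j)) (partitions k) w ⟩
    P∑.∑ (partitions k) (w ∘ insert (suc j))
      ≈⟨ P∑.∑-cong (partitions k) (λ {ρ} ρ∈ → term-insert j ρ (proj₁ (partition-elim {k} ρ (∈-partitions⁻ {k} ρ∈)))) ⟩
    P∑.∑ (partitions k) (λ ρ → powerSum j ⊗ term ρ)
      ≈⟨ P∑.*-distribˡ-∑ (partitions k) term (powerSum j) ⟨
    powerSum j ⊗ cycleIndex k ∎
    where
    w : List ℕ → Poly
    w ρ = scale (ℕ→ℚ (suc j ℕ.* mult (suc j) ρ)) (term ρ)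
    restrict : ∀ ρ → w ρ ≋ P∑.when (suc j ∈? ρ) (w ρ)
    restrict ρ = P∑.when-intro (suc j ∈? ρ) (λ j∉ → ≋-trans
      (scale-congˡ (term ρ) (cong ℕ→ℚ (trans (cong (suc j ℕ.*_) (mult-∉ ρ j∉)) (ℕₚ.*-zeroʳ (suc j))))) (scale-0 (term ρ)))

  open PowerSums polyRing using (conv; ∑≈conv; denominator; H≈denominator*h)

  -- Each partition ρ of m + 1 satisfies m + 1 = Σ i m_i(ρ). Distributing the left-hand factor over
  -- the part sizes and exchanging the sums yields one product for every size.
  newton : ∀ m → (suc m ⋆ constP 1ℚ) ⊗ cycleIndex (suc m) ≋ conv powerSum cycleIndex m
  newton m = begin
    (suc m ⋆ constP 1ℚ) ⊗ cycleIndex (suc m)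
      ≈⟨ ⋆1-⊗ (suc m) (cycleIndex (suc m)) ⟩
    scale (ℕ→ℚ (suc m)) (P∑.∑ (partitions (suc m)) term)
      ≈⟨ ∑-scale (ℕ→ℚ (suc m)) (partitions (suc m)) term ⟩
    P∑.∑ (partitions (suc m)) (λ ρ → scale (ℕ→ℚ (suc m)) (term ρ))
      ≈⟨ P∑.∑-cong (partitions (suc m)) (λ {ρ} ρ∈ → by-parts ρ (∈-partitions⁻ {suc m} ρ∈)) ⟩
    P∑.∑ (partitions (suc m)) (λ ρ → P∑.∑ (upTo (suc m)) (λ j → scale (ℕ→ℚ (suc j ℕ.* mult (suc j) ρ)) (term ρ)))
      ≈⟨ P∑.∑-swap (partitions (suc m)) (upTo (suc m)) _ ⟩
    P∑.∑ (upTo (suc m)) (λ j → P∑.∑ (partitions (suc m)) (λ ρ → scale (ℕ→ℚ (suc j ℕ.* mult (suc j) ρ)) (term ρ)))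
      ≈⟨ P∑.∑-cong (upTo (suc m)) (λ {j} j∈ → ≋-trans
           (reflexive (cong (λ k → P∑.∑ (partitions (suc k)) (λ ρ → scale (ℕ→ℚ (suc j ℕ.* mult (suc j) ρ)) (term ρ)))
             (sym (ℕₚ.m+[n∸m]≡n (ℕₚ.<⇒≤pred (∈-upTo⁻ j∈))))))
           (∑-partitions-with-part j (m ℕ.∸ j))) ⟩
    P∑.∑ (upTo (suc m)) (λ j → powerSum j ⊗ cycleIndex (m ℕ.∸ j))
      ≈⟨ ∑≈conv powerSum cycleIndex m ⟩
    conv powerSum cycleIndex m ∎
    where
    by-parts : ∀ ρ → IsPartition ρ (suc m) →
      scale (ℕ→ℚ (suc m)) (term ρ) ≋ P∑.∑ (upTo (suc m)) (λ j → scale (ℕ→ℚ (suc j ℕ.* mult (suc j) ρ)) (term ρ))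
    by-parts ρ part = ≋-trans
      (scale-congˡ (term ρ) (cong ℕ→ℚ (sym (trans (sumℕ-mult (suc m) ρ (proj₁ parts)
        (All.tabulate (λ x∈ → ℕₚ.≤-trans (∈⇒≤sumℕ ρ x∈) (ℕₚ.≤-reflexive sum≡)))) sum≡))))
      (scale-∑ (upTo (suc m)) (λ j → suc j ℕ.* mult (suc j) ρ) (term ρ))
      where
      parts = partition-elim {suc m} ρ part
      sum≡ = proj₂ (proj₂ parts)

  twiceCheb : ℕ → Poly
  twiceCheb j = scale (ℕ→ℚ 2) (cheb (suc j))

  -- Multiplying by q^(j+1) - 1 cancels the denominator and leaves 2 T_{j+1}.
  q^*powerSum : ∀ j → (constP q ^ suc j) ⊗ powerSum j ≋ powerSum j ⊕ twiceCheb j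
  q^*powerSum j = begin
    (constP q ^ suc j) ⊗ powerSum j
      ≈⟨ *-congʳ {powerSum j} (constP-^ q (suc j)) ⟩
    constP (q ^ℚ suc j) ⊗ powerSum j
      ≈⟨ scale≋constP-⊗ (q ^ℚ suc j) (powerSum j) ⟨
    scale (q ^ℚ suc j) (powerSum j)
      ≈⟨ scale-scale (q ^ℚ suc j) _ (cheb (suc j)) ⟩
    scale (q ^ℚ suc j ℚ.* (ℕ→ℚ 2 ℚ.* inv x)) (cheb (suc j))
      ≈⟨ scale-congˡ (cheb (suc j)) (trans
           (solve 3 (λ y t i → y :* (t :* i) := t :* i :+ t :* ((y :- con 1ℚ) :* i)) refl (q ^ℚ suc j) (ℕ→ℚ 2) (inv x))
           (cong (λ e → ℕ→ℚ 2 ℚ.* inv x ℚ.+ e) (trans (cong (ℕ→ℚ 2 ℚ.*_) (*-inv (q^-1≢0 j))) (ℚₚ.*-identityʳ (ℕ→ℚ 2))))) ⟩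
    scale (ℕ→ℚ 2 ℚ.* inv x ℚ.+ ℕ→ℚ 2) (cheb (suc j))
      ≈⟨ scale-+ (ℕ→ℚ 2 ℚ.* inv x) (ℕ→ℚ 2) (cheb (suc j)) ⟩
    powerSum j ⊕ twiceCheb j ∎
    where
    x = q ^ℚ suc j ℚ.- 1ℚ
    open +-*-Solver

  twiceCheb-suc : ∀ j → twiceCheb (suc (suc j)) ≋ (2W ⊗ twiceCheb (suc j)) ⊕ negP (twiceCheb j)
  twiceCheb-suc j = begin
    scale (ℕ→ℚ 2) (twoW T₂ ⊕ negP T₁)
      ≈⟨ scale-⊕ (ℕ→ℚ 2) (twoW T₂) (negP T₁) ⟩
    scale (ℕ→ℚ 2) (twoW T₂) ⊕ scale (ℕ→ℚ 2) (negP T₁)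
      ≈⟨ +-cong
           (≋-trans (scale-cong (ℕ→ℚ 2) (≋-trans (twoW≋2W-⊗ T₂) (⊗-comm 2W T₂)))
             (≋-trans (≋-sym (scale-⊗ (ℕ→ℚ 2) T₂ 2W)) (⊗-comm (scale (ℕ→ℚ 2) T₂) 2W)))
           (≋-trans (scale-scale (ℕ→ℚ 2) (ℚ.- 1ℚ) T₁) (≋-sym (scale-scale (ℚ.- 1ℚ) (ℕ→ℚ 2) T₁))) ⟩
    (2W ⊗ scale (ℕ→ℚ 2) T₂) ⊕ negP (scale (ℕ→ℚ 2) T₁) ∎
    where
    T₂ = cheb (suc (suc j))
    T₁ = cheb (suc j)

  denominatorℚ : ℕ → ℚ
  denominatorℚ zero    = 1ℚ
  denominatorℚ (suc m) = denominatorℚ m ℚ.* ((q ^ℚ suc m ℚ.- 1ℚ) ℚ.* inv q ^ℚ m)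

  hermite≋cycleIndex : ∀ m → HermiteProducts.H polyRing (constP q) (constP (inv q)) 2W q*p≋1 m ≋ scale (denominatorℚ m) (cycleIndex m)
  hermite≋cycleIndex m = ≋-trans
    (H≈denominator*h (constP q) 2W powerSum twiceCheb cycleIndex
      (λ m {x} {y} eq → scale-cancel (ℕ→ℚ-suc≢0 m) (≋-trans (≋-sym (⋆1-⊗ (suc m) x)) (≋-trans eq (⋆1-⊗ (suc m) y))))
      newton q^*powerSum ≋-refl
      -- The initial value 2 T_2 = (2w)² - 2, evaluated coefficient by coefficient.
      (coefficientwise (λ { 0 → refl ; 1 → refl ; 2 → refl ; (suc (suc (suc i))) → refl }))
      twiceCheb-suc
      (constP (inv q)) q*p≋1 (coefficientwise (λ { zero → refl ; (suc i) → refl })) m)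
    (≋-trans (*-congʳ {cycleIndex m} (denominator≋ m)) (≋-sym (scale≋constP-⊗ (denominatorℚ m) (cycleIndex m))))
    where
    denominator≋ : ∀ m → denominator (constP q) (constP (inv q)) m ≋ constP (denominatorℚ m)
    denominator≋ zero    = ≋-refl
    denominator≋ (suc m) = ≋-trans (*-cong (denominator≋ m) (≋-trans
        (*-cong (≋-trans (+-cong (constP-^ q (suc m)) (≋-sym (constP-neg 1ℚ))) (≋-sym (constP-+ (q ^ℚ suc m) (ℚ.- 1ℚ)))) (constP-^ (inv q) m))
        (≋-sym (constP-* (q ^ℚ suc m ℚ.- 1ℚ) (inv q ^ℚ m)))))
      (≋-sym (constP-* (denominatorℚ m) ((q ^ℚ suc m ℚ.- 1ℚ) ℚ.* inv q ^ℚ m)))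

-- The prefactor of the right side

module Normalisation (q : ℚ) (q≢0 : q ≢ 0ℚ) (q^-1≢0 : ∀ r → q ^ℚ suc r ℚ.- 1ℚ ≢ 0ℚ) where
  open Factor q q≢0 q^-1≢0

  q-1≢0 : q ℚ.- 1ℚ ≢ 0ℚ
  q-1≢0 eq = q^-1≢0 0 (trans (cong (ℚ._- 1ℚ) (ℚₚ.*-identityʳ q)) eq)

  qFact-suc : ∀ m → qFact q (suc m) ≡ qFact q m ℚ.* ((q ^ℚ suc m ℚ.- 1ℚ) ℚ.* inv (q ℚ.- 1ℚ))
  qFact-suc m = trans
    (cong prodℚ (trans (cong (map f) (sym (upTo-∷ʳ m))) (map-++ f (upTo m) (m ∷ []))))
    (prodℚ-∷ʳ (map f (upTo m)) (f m))
    where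
    f : ℕ → ℚ
    f j = (q ^ℚ suc j ℚ.- 1ℚ) ℚ.* inv (q ℚ.- 1ℚ)

  -- The powers of q - 1 clear the denominators of the q-factorial, and the exponents 0, 1, ..., m -
  -- 1 of 1/q in `denominatorℚ` add up to the triangular number.
  qFact-normalised : ∀ m → qFact q m ℚ.* (q ℚ.- 1ℚ) ^ℚ m ℚ.* inv q ^ℚ triangular m ≡ denominatorℚ m
  qFact-normalised zero    = refl
  qFact-normalised (suc m) = begin
    qFact q (suc m) ℚ.* (y ℚ.* y ^ℚ m) ℚ.* inv q ^ℚ triangular (suc m)
      ≡⟨ cong₂ (λ a b → a ℚ.* (y ℚ.* y ^ℚ m) ℚ.* b) (qFact-suc m)
           (trans (cong (inv q ^ℚ_) (∑-upTo-suc m id)) (^ℚ-+ (inv q) (triangular m) m)) ⟩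
    (qFact q m ℚ.* (x ℚ.* inv y)) ℚ.* (y ℚ.* y ^ℚ m) ℚ.* (inv q ^ℚ triangular m ℚ.* inv q ^ℚ m)
      ≡⟨ solve 7 (λ f x iy y ym t u → (f :* (x :* iy)) :* (y :* ym) :* (t :* u) := (y :* iy) :* ((f :* ym :* t) :* (x :* u))) refl
           (qFact q m) x (inv y) y (y ^ℚ m) (inv q ^ℚ triangular m) (inv q ^ℚ m) ⟩
    (y ℚ.* inv y) ℚ.* ((qFact q m ℚ.* y ^ℚ m ℚ.* inv q ^ℚ triangular m) ℚ.* (x ℚ.* inv q ^ℚ m))
      ≡⟨ cong₂ (λ a b → a ℚ.* (b ℚ.* (x ℚ.* inv q ^ℚ m))) (*-inv q-1≢0) (qFact-normalised m) ⟩
    1ℚ ℚ.* (denominatorℚ m ℚ.* (x ℚ.* inv q ^ℚ m))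
      ≡⟨ ℚₚ.*-identityˡ _ ⟩
    denominatorℚ m ℚ.* (x ℚ.* inv q ^ℚ m) ∎
    where
    open ≡.≡-Reasoning
    open +-*-Solver
    x = q ^ℚ suc m ℚ.- 1ℚ
    y = q ℚ.- 1ℚ

  ∏-qFact : ∀ λs → prodℚ (map (qFact q) λs) ℚ.* (q ℚ.- 1ℚ) ^ℚ sumℕ λs ℚ.* inv q ^ℚ ℕ∑.∑ λs triangular ≡ prodℚ (map denominatorℚ λs)
  ∏-qFact []       = refl
  ∏-qFact (l ∷ λs) = begin
    (f ℚ.* fs) ℚ.* y ^ℚ (l ℕ.+ sumℕ λs) ℚ.* inv q ^ℚ (triangular l ℕ.+ ℕ∑.∑ λs triangular)
      ≡⟨ cong₂ (λ a b → (f ℚ.* fs) ℚ.* a ℚ.* b) (^ℚ-+ y l (sumℕ λs)) (^ℚ-+ (inv q) (triangular l) (ℕ∑.∑ λs triangular)) ⟩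
    (f ℚ.* fs) ℚ.* (y ^ℚ l ℚ.* y ^ℚ sumℕ λs) ℚ.* (inv q ^ℚ triangular l ℚ.* inv q ^ℚ ℕ∑.∑ λs triangular)
      ≡⟨ solve 6 (λ f fs a as b bs → (f :* fs) :* (a :* as) :* (b :* bs) := (f :* a :* b) :* (fs :* as :* bs)) refl
           f fs (y ^ℚ l) (y ^ℚ sumℕ λs) (inv q ^ℚ triangular l) (inv q ^ℚ ℕ∑.∑ λs triangular) ⟩
    (f ℚ.* y ^ℚ l ℚ.* inv q ^ℚ triangular l) ℚ.* (fs ℚ.* y ^ℚ sumℕ λs ℚ.* inv q ^ℚ ℕ∑.∑ λs triangular)
      ≡⟨ cong₂ ℚ._*_ (qFact-normalised l) (∏-qFact λs) ⟩
    denominatorℚ l ℚ.* prodℚ (map denominatorℚ λs) ∎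
    where
    open ≡.≡-Reasoning
    open +-*-Solver
    f = qFact q l
    fs = prodℚ (map (qFact q) λs)
    y = q ℚ.- 1ℚ

  scaled-cycleIndices : ∀ λs →
    scale (prodℚ (map (qFact q) λs) ℚ.* (q ℚ.- 1ℚ) ^ℚ sumℕ λs ℚ.* inv (q ^ℚ nStat (conjugate λs))) (prodP (map cycleIndex λs)) ≋
    prodP (map (HermiteProducts.H polyRing (constP q) (constP (inv q)) 2W q*p≋1) λs)
  scaled-cycleIndices λs = ≋-trans
    (scale-congˡ (prodP (map cycleIndex λs)) (trans
      (cong (prodℚ (map (qFact q) λs) ℚ.* (q ℚ.- 1ℚ) ^ℚ sumℕ λs ℚ.*_) (trans (inv-^ q≢0 (nStat (conjugate λs))) (cong (inv q ^ℚ_) (nStat-conjugate λs))))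
      (∏-qFact λs)))
    (distribute λs)
    where
    distribute : ∀ λs → scale (prodℚ (map denominatorℚ λs)) (prodP (map cycleIndex λs)) ≋
                        prodP (map (HermiteProducts.H polyRing (constP q) (constP (inv q)) 2W q*p≋1) λs)
    distribute []       = scale-1 (constP 1ℚ)
    distribute (l ∷ λs) = ≋-trans
      (≋-sym (scale-⊗-scale (denominatorℚ l) (prodℚ (map denominatorℚ λs)) (cycleIndex l) (prodP (map cycleIndex λs))))
      (⊗-cong (≋-sym (hermite≋cycleIndex l)) (distribute λs))

-- From matrices in the nilradical to admissible sequences of columns

+-suc-length : ∀ {A : Set} (xs : List A) y j → length xs ℕ.+ suc j ≡ length (xs ∷ʳ y) ℕ.+ j
+-suc-length xs y j = trans (ℕₚ.+-suc (length xs) j) (cong (ℕ._+ j) (sym (trans (length-++ xs) (ℕₚ.+-comm (length xs) 1))))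

lookup-replicate-++ : ∀ {A : Set} l (s : A) rest (j : Fin (length (replicate l s ++ rest))) →
  (toℕ j < l × L.lookup (replicate l s ++ rest) j ≡ s) ⊎
  (∃ λ j′ → l ℕ.+ toℕ j′ ≡ toℕ j × L.lookup (replicate l s ++ rest) j ≡ L.lookup rest j′)
lookup-replicate-++ zero    s rest j       = inj₂ (j , refl , refl)
lookup-replicate-++ (suc l) s rest zero    = inj₁ (ℕ.s≤s ℕ.z≤n , refl)
lookup-replicate-++ (suc l) s rest (suc j) with lookup-replicate-++ l s rest j
... | inj₁ (j<l , eq)      = inj₁ (ℕ.s≤s j<l , eq)
... | inj₂ (j′ , eq , eq′) = inj₂ (j′ , cong suc eq , eq′)

module _ (F : FiniteField) where

  blockOf-< : ∀ l ls {i} → i < l → blockOf F (l ∷ ls) i ≡ 0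
  blockOf-< l ls {i} i<l rewrite ≤⇒≤ᵇ-true i<l = refl

  blockOf-+ : ∀ l ls i → blockOf F (l ∷ ls) (l ℕ.+ i) ≡ suc (blockOf F ls i)
  blockOf-+ l ls i rewrite >⇒≤ᵇ-false {suc (l ℕ.+ i)} {l} (ℕ.s≤s (ℕₚ.m≤m+n l i)) | ℕₚ.m+n∸m≡n l i = refl

  -- Reconciles two encodings of the blocks: a row lies in an earlier block than column j exactly
  -- when its index is below the start t of the block of j. The offset s stands for the blocks
  -- already removed from the list.
  starts-lookup : ∀ ls s (j : Fin (length (starts s ls))) → ∃ λ t → L.lookup (starts s ls) j ≡ s ℕ.+ t × t ≤ toℕ j ×
    (∀ i → blockOf F ls i < blockOf F ls (toℕ j) → i < t) × (∀ i → i < t → blockOf F ls i < blockOf F ls (toℕ j))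
  starts-lookup (l ∷ ls) s j with lookup-replicate-++ l s (starts (s ℕ.+ l) ls) j
  ... | inj₁ (j<l , eq) = 0 , trans eq (sym (ℕₚ.+-identityʳ s)) , ℕ.z≤n ,
    (λ i b< → contradiction (subst (blockOf F (l ∷ ls) i <_) (blockOf-< l ls j<l) b<) λ ()) , (λ i ())
  ... | inj₂ (j′ , j≡ , eq) with starts-lookup ls (s ℕ.+ l) j′
  ... | t , eq′ , t≤j′ , to , from = l ℕ.+ t , trans eq (trans eq′ (ℕₚ.+-assoc s l t)) ,
    subst (l ℕ.+ t ≤_) j≡ (ℕₚ.+-monoʳ-≤ l t≤j′) ,
    (λ i b< → to′ i (subst (blockOf F (l ∷ ls) i <_) block-j b<)) ,
    (λ i i< → subst (blockOf F (l ∷ ls) i <_) (sym block-j) (from′ i i<))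
    where
    block-j : blockOf F (l ∷ ls) (toℕ j) ≡ suc (blockOf F ls (toℕ j′))
    block-j = trans (cong (blockOf F (l ∷ ls)) (sym j≡)) (blockOf-+ l ls (toℕ j′))
    to′ : ∀ i → blockOf F (l ∷ ls) i < suc (blockOf F ls (toℕ j′)) → i < l ℕ.+ t
    to′ i b< with ℕₚ.<-≤-connex i l
    ... | inj₁ i<l = ℕₚ.<-≤-trans i<l (ℕₚ.m≤m+n l t)
    ... | inj₂ l≤i with ℕₚ.m≤n⇒∃[o]m+o≡n l≤i
    ... | i′ , refl = ℕₚ.+-monoʳ-< l (to i′ (ℕ.s≤s⁻¹ (subst (_< suc (blockOf F ls (toℕ j′))) (blockOf-+ l ls i′) b<)))
    from′ : ∀ i → i < l ℕ.+ t → blockOf F (l ∷ ls) i < suc (blockOf F ls (toℕ j′))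
    from′ i i< with ℕₚ.<-≤-connex i l
    ... | inj₁ i<l = subst (_< suc (blockOf F ls (toℕ j′))) (sym (blockOf-< l ls i<l)) (ℕ.s≤s ℕ.z≤n)
    ... | inj₂ l≤i with ℕₚ.m≤n⇒∃[o]m+o≡n l≤i
    ... | i′ , refl = subst (_< suc (blockOf F ls (toℕ j′))) (sym (blockOf-+ l ls i′)) (ℕ.s≤s (from i′ (ℕₚ.+-cancelˡ-< l i′ t i<)))

length-starts : ∀ ls s → length (starts s ls) ≡ sumℕ ls
length-starts []       s = refl
length-starts (l ∷ ls) s = trans (length-++ (replicate l s)) (cong₂ ℕ._+_ (length-replicate l) (length-starts ls (s ℕ.+ l)))

toList-tabulate : ∀ {A : Set} {n} (f : Fin n → A) → toList (tabulate f) ≡ map f (allFin n)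
toList-tabulate f = trans (helper f) (sym (map-tabulate id f))
  where
  helper : ∀ {A : Set} {n} (f : Fin n → A) → toList (tabulate f) ≡ L.tabulate f
  helper {n = zero}  f = refl
  helper {n = suc n} f = cong (f zero ∷_) (helper (f ∘ suc))

transpose : ∀ {A : Set} {m n} → Vec (Vec A n) m → Vec (Vec A m) n
transpose M = tabulate (λ j → tabulate (λ i → lookup (lookup M i) j))

transpose-tabulate : ∀ {A : Set} {m n} (X : Fin m → Fin n → A) →
  transpose (tabulate (λ i → tabulate (X i))) ≡ tabulate (λ j → tabulate (λ i → X i j))
transpose-tabulate X = Vₚ.tabulate-cong (λ j → Vₚ.tabulate-cong (λ i →
  trans (cong (λ v → lookup v j) (Vₚ.lookup∘tabulate (λ i → tabulate (X i)) i)) (Vₚ.lookup∘tabulate (X i) j)))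

transpose-involutive : ∀ {A : Set} {m n} (M : Vec (Vec A n) m) → transpose (transpose M) ≡ M
transpose-involutive M = trans (transpose-tabulate (λ j i → lookup (lookup M i) j))
  (trans (Vₚ.tabulate-cong (λ i → Vₚ.tabulate∘lookup (lookup M i))) (Vₚ.tabulate∘lookup M))

module Translation (F : FiniteField) where
  private module F = FiniteField F
  open F using (elements)
  open LinearAlgebra F
  open Kernel F
  open Rank F using (rank≡rk)
  open IntegerSolver ringF using (solve; _:=_; _:+_; _:*_; :-_)

  columns : ∀ {n} → Matrix F n → Vec (Vec K n) n
  columns X = tabulate (λ j → tabulate (λ i → X i j))

  lookup-columns : ∀ {n} (X : Matrix F n) i j → lookup (lookup (columns X) j) i ≡ X i j
  lookup-columns X i j = trans (cong (λ v → lookup v i) (Vₚ.lookup∘tabulate _ j)) (Vₚ.lookup∘tabulate _ i)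

  -- Matrices are enumerated by rows but counted by columns; transposition, being an involution,
  -- merely permutes the list of all matrices.
  columns-allFuns : ∀ n → map columns (allFuns (allFuns elements n) n) ↭ allVecs (vecs n) n
  columns-allFuns n = ↭-trans (↭-reflexive transposed) (unique-⊆⊇⇒↭
    (Uniqueₚ.map⁺ (λ {M} {N} eq → trans (sym (transpose-involutive M)) (trans (cong transpose eq) (transpose-involutive N)))
      (allVecs-unique (vecs-unique n) n))
    (allVecs-unique (vecs-unique n) n)
    (λ {M} _ → allVecs-complete ∈-vecs M)
    (λ {M} _ → subst (_∈ map transpose (allVecs (vecs n) n)) (transpose-involutive M)
      (∈-map⁺ transpose (allVecs-complete ∈-vecs (transpose M)))))
    where
    open ≡.≡-Reasoning
    transposed : map columns (allFuns (allFuns elements n) n) ≡ map transpose (allVecs (vecs n) n)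
    transposed = begin
      map columns Xs
        ≡⟨ map-cong (λ X → trans (sym (transpose-tabulate X)) (cong transpose (Vₚ.tabulate-∘ tabulate X))) Xs ⟩
      map (transpose ∘ V.map tabulate ∘ tabulate) Xs
        ≡⟨ trans (map-∘ {g = transpose} {f = V.map tabulate ∘ tabulate} Xs) (cong (map transpose) (map-∘ {g = V.map tabulate} {f = tabulate} Xs)) ⟩
      map transpose (map (V.map tabulate) (map tabulate Xs))
        ≡⟨ cong (map transpose ∘ map (V.map tabulate)) (map-tabulate-allFuns (allFuns elements n) n) ⟩
      map transpose (map (V.map tabulate) (allVecs (allFuns elements n) n))
        ≡⟨ cong (map transpose) (trans (sym (allVecs-map tabulate (allFuns elements n) n))
             (cong (λ xs → allVecs xs n) (map-tabulate-allFuns elements n))) ⟩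
      map transpose (allVecs (vecs n) n) ∎
      where
      Xs = allFuns (allFuns elements n) n

  rank-columns : ∀ {n} (X : Matrix F n) → rank F X ≡ rk (toList (columns X))
  rank-columns {n} X = trans (rank≡rk X) (cong rk (sym (toList-tabulate (λ j → tabulate (λ i → X i j)))))

  Supported⁻ : ∀ {m} s (v : Vec K m) → Supported s v → ∀ i → toℕ i < s ⊎ lookup v i ≡ 0#
  Supported⁻ zero    (a ∷ v) (a≡0 , p) zero    = inj₂ a≡0
  Supported⁻ zero    (a ∷ v) (a≡0 , p) (suc i) with Supported⁻ zero v p i
  ... | inj₂ eq = inj₂ eq
  Supported⁻ (suc s) (a ∷ v) p         zero    = inj₁ (ℕ.s≤s ℕ.z≤n)
  Supported⁻ (suc s) (a ∷ v) p         (suc i) with Supported⁻ s v p i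
  ... | inj₁ i<s = inj₁ (ℕ.s≤s i<s)
  ... | inj₂ eq  = inj₂ eq

  Supported⁺ : ∀ {m} s (v : Vec K m) → (∀ i → toℕ i < s ⊎ lookup v i ≡ 0#) → Supported s v
  Supported⁺ s       []      h = tt
  Supported⁺ zero    (a ∷ v) h with h zero
  ... | inj₂ a≡0 = a≡0 , Supported⁺ zero v (λ i → case h (suc i) of λ { (inj₂ eq) → inj₂ eq })
  Supported⁺ (suc s) (a ∷ v) h = Supported⁺ s v (λ i → case h (suc i) of λ
    { (inj₁ (ℕ.s≤s i<s)) → inj₁ i<s ; (inj₂ eq) → inj₂ eq })

  lookup-mulL : ∀ {m n} (c : Fin m → Vec K n) (v : Fin m → K) i →
    lookup (mulL (toList (tabulate c)) (tabulate v)) i ≡ foldr _+_ 0# (map (λ l → lookup (c l) i * v l) (allFin m))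
  lookup-mulL {zero}  {n} c v i = Vₚ.lookup-replicate i 0#
  lookup-mulL {suc m} c v i = begin
    lookup (mulL (toList (tabulate (c ∘ suc))) (tabulate (v ∘ suc)) −[ - v zero ] c zero) i
      ≡⟨ Vₚ.lookup-zipWith _ i (mulL (toList (tabulate (c ∘ suc))) (tabulate (v ∘ suc))) (c zero) ⟩
    lookup (mulL (toList (tabulate (c ∘ suc))) (tabulate (v ∘ suc))) i + - (- v zero * lookup (c zero) i)
      ≡⟨ cong (_+ - (- v zero * lookup (c zero) i)) (lookup-mulL (c ∘ suc) (v ∘ suc) i) ⟩
    foldr _+_ 0# (map (λ l → lookup (c (suc l)) i * v (suc l)) (allFin m)) + - (- v zero * lookup (c zero) i)
      ≡⟨ solve 3 (λ s x y → s :+ :- (:- x :* y) := y :* x :+ s) refl _ (v zero) (lookup (c zero) i) ⟩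
    lookup (c zero) i * v zero + foldr _+_ 0# (map (λ l → lookup (c (suc l)) i * v (suc l)) (allFin m))
      ≡⟨ cong (λ xs → lookup (c zero) i * v zero + foldr _+_ 0# xs)
           (trans (map-tabulate id (λ l → lookup (c (suc l)) i * v (suc l))) (sym (map-tabulate suc (λ l → lookup (c l) i * v l)))) ⟩
    lookup (c zero) i * v zero + foldr _+_ 0# (map (λ l → lookup (c l) i * v l) (L.tabulate suc)) ∎
    where open ≡.≡-Reasoning

  mulL-columns : ∀ {n} (X : Matrix F n) i j → lookup (mulL (toList (columns X)) (lookup (columns X) j)) i ≡ mulM F X X i j
  mulL-columns {n} X i j = trans
    (cong (λ v → lookup (mulL (toList (columns X)) v) i) (Vₚ.lookup∘tabulate _ j))
    (trans (lookup-mulL (λ j → tabulate (λ i → X i j)) (λ i → X i j) i)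
      (cong (foldr _+_ 0#) (map-cong (λ l → cong (_* X l j) (Vₚ.lookup∘tabulate (λ i → X i l) i)) (allFin n))))

  lookup-0ᵥ⇒≡0ᵥ : ∀ {n} (v : Vec K n) → (∀ i → lookup v i ≡ 0#) → v ≡ 0ᵥ
  lookup-0ᵥ⇒≡0ᵥ []      h = refl
  lookup-0ᵥ⇒≡0ᵥ (a ∷ v) h = cong₂ _∷_ (h zero) (lookup-0ᵥ⇒≡0ᵥ v (h ∘ suc))

  allFin²-⁻ : ∀ {n} (b : Fin n → Fin n → Bool) → T (allB (λ i → allB (b i) (allFin n)) (allFin n)) → ∀ i j → T (b i j)
  allFin²-⁻ {n} b t i j = allB-⁻ (b i) (allFin n) (allB-⁻ (λ i → allB (b i) (allFin n)) (allFin n) t (∈-allFin i)) (∈-allFin j)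

  allFin²-⁺ : ∀ {n} (b : Fin n → Fin n → Bool) → (∀ i j → T (b i j)) → T (allB (λ i → allB (b i) (allFin n)) (allFin n))
  allFin²-⁺ {n} b h = allB-⁺ _ (allFin n) (λ {i} _ → allB-⁺ (b i) (allFin n) (λ {j} _ → h i j))

  SquareZero : ∀ {n} → List ℕ → Matrix F n → Set
  SquareZero λs X = T (inNilradical F λs X) × T (isZeroM F (mulM F X X))

  module _ {n : ℕ} where
    -- Every column is tested against the columns before it. A block starts no later than its
    -- columns stand, so by `mulL-++` the test can be made against the whole matrix.
    Admissibles⁻ : ∀ (L : List (Vec K n)) bs ys → (∀ j → L.lookup bs j ≤ length L ℕ.+ toℕ j) → Admissibles L bs ys →
      ∀ j → Admissible (L ++ toList ys) (L.lookup bs j) (lookup ys j)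
    Admissibles⁻ L (s ∷ bs) (y ∷ ys) bnd (adm , adms) zero =
      Admissible-++⁺ L (y ∷ toList ys) (ℕₚ.≤-trans (bnd zero) (ℕₚ.≤-reflexive (ℕₚ.+-identityʳ _))) adm
    Admissibles⁻ L (s ∷ bs) (y ∷ ys) bnd (adm , adms) (suc j) =
      subst (λ M → Admissible M (L.lookup bs j) (lookup ys j)) (++-assoc L (y ∷ []) (toList ys))
        (Admissibles⁻ (L ∷ʳ y) bs ys (λ j → ℕₚ.≤-trans (bnd (suc j)) (ℕₚ.≤-reflexive (+-suc-length L y (toℕ j)))) adms j)

    Admissibles⁺ : ∀ (L : List (Vec K n)) bs ys → (∀ j → L.lookup bs j ≤ length L ℕ.+ toℕ j) →
      (∀ j → Admissible (L ++ toList ys) (L.lookup bs j) (lookup ys j)) → Admissibles L bs ys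
    Admissibles⁺ L []       []       bnd h = tt
    Admissibles⁺ L (s ∷ bs) (y ∷ ys) bnd h =
      Admissible-++⁻ L (y ∷ toList ys) (ℕₚ.≤-trans (bnd zero) (ℕₚ.≤-reflexive (ℕₚ.+-identityʳ _))) (h zero) ,
      Admissibles⁺ (L ∷ʳ y) bs ys (λ j → ℕₚ.≤-trans (bnd (suc j)) (ℕₚ.≤-reflexive (+-suc-length L y (toℕ j))))
        (λ j → subst (λ M → Admissible M (L.lookup bs j) (lookup ys j)) (sym (++-assoc L (y ∷ []) (toList ys))) (h (suc j)))

  module _ (λs : List ℕ) where
    private
      bs = starts 0 λs
      -- With this size the vector of columns and the list of starts have the same length
      -- definitionally.
      n = length bs

    start-bound : ∀ j → L.lookup bs j ≤ toℕ j
    start-bound j with starts-lookup F λs 0 j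
    ... | t , eq , t≤j , _ = subst (_≤ toℕ j) (sym eq) t≤j

    SquareZero⇒Admissibles : ∀ (X : Matrix F n) → SquareZero λs X → Admissibles {n} [] bs (columns X)
    SquareZero⇒Admissibles X (nil , sq) = Admissibles⁺ [] bs (columns X) start-bound (λ j →
      Supported⁺ (L.lookup bs j) (lookup (columns X) j) (support j) ,
      lookup-0ᵥ⇒≡0ᵥ _ (λ i → trans (mulL-columns X i j) (T-does (_ F.≟ 0#) (allFin²-⁻ (λ i j → eqB F (mulM F X X i j) 0#) sq i j))))
      where
      support : ∀ j i → toℕ i < L.lookup bs j ⊎ lookup (lookup (columns X) j) i ≡ 0#
      support j i with starts-lookup F λs 0 j | T-∨⁻ (blockOf F λs (toℕ i) <ᵇ blockOf F λs (toℕ j)) (allFin²-⁻ _ nil i j)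
      ... | t , eq , _ , to , _ | inj₁ b< = inj₁ (subst (toℕ i <_) (sym eq) (to (toℕ i) (ℕₚ.<ᵇ⇒< _ _ b<)))
      ... | _                   | inj₂ x≡0 = inj₂ (trans (lookup-columns X i j) (T-does (X i j F.≟ 0#) x≡0))

    Admissibles⇒SquareZero : ∀ (X : Matrix F n) → Admissibles {n} [] bs (columns X) → SquareZero λs X
    Admissibles⇒SquareZero X adms =
      allFin²-⁺ _ (λ i j → T-∨⁺ (blockOf F λs (toℕ i) <ᵇ blockOf F λs (toℕ j)) (nil i j)) ,
      allFin²-⁺ _ (λ i j → does-T (_ F.≟ 0#) (trans (sym (mulL-columns X i j))
        (trans (cong (λ v → lookup v i) (proj₂ (adm j))) (Vₚ.lookup-replicate i 0#))))
      where
      adm = Admissibles⁻ [] bs (columns X) start-bound adms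
      nil : ∀ i j → T (blockOf F λs (toℕ i) <ᵇ blockOf F λs (toℕ j)) ⊎ T (eqB F (X i j) 0#)
      nil i j with starts-lookup F λs 0 j | Supported⁻ (L.lookup bs j) (lookup (columns X) j) (proj₁ (adm j)) i
      ... | t , eq , _ , _ , from | inj₁ i<  = inj₁ (ℕₚ.<⇒<ᵇ (from (toℕ i) (subst (toℕ i <_) eq i<)))
      ... | _                     | inj₂ x≡0 = inj₂ (does-T (X i j F.≟ 0#) (trans (sym (lookup-columns X i j)) x≡0))

-- The left side as a weighted sum over matrices

module HermiteSide (F : FiniteField) (q : ℚ) (q≡ : q ≡ qℚ F) (q≢0 : q ≢ 0ℚ) (q^-1≢0 : ∀ r → q ^ℚ suc r ℚ.- 1ℚ ≢ 0ℚ) where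
  open CommutativeRing polyRing using (setoid; semiring; reflexive; *-congʳ)
  open import Relation.Binary.Reasoning.Setoid setoid
  open import Algebra.Properties.Semiring.Mult semiring using () renaming (_×_ to _⋆_)
  open FiniteField F using (elements)
  open LinearAlgebra F
  open Kernel F
  open Translation F
  open Factor q q≢0 q^-1≢0 using (q*p≋1; hermite≋H)
  open ColumnSums F polyRing using (columnSum; columnSum-starts; ∑-Admissibles)

  p : Poly
  p = constP (inv q)

  H : ℕ → Poly
  H = HermiteProducts.H polyRing (constP q) p 2W q*p≋1

  weight : ℕ → ℕ → Poly
  weight = HermiteProducts.φ polyRing (constP q) p 2W q*p≋1

  q≋order : constP q ≋ order ⋆ constP 1ℚ
  q≋order = ≋-trans (reflexive (cong constP q≡)) (≋-sym (⋆1≋constP order))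

  summand : ℕ → List ℕ → ℕ → Poly
  summand n λs k = scale (ℕ→ℚ (a F n k λs) ℚ.* inv (q ^ℚ (k ℕ.* (n ℕ.∸ k))))
                         (if (2 ℕ.* k) ≤ᵇ n then hermite (inv q) (n ℕ.∸ 2 ℕ.* k) else [])

  summand≋weight : ∀ n λs k → summand n λs k ≋ scale (ℕ→ℚ (a F n k λs)) (weight n k)
  summand≋weight n λs k = begin
    scale (ℕ→ℚ (a F n k λs) ℚ.* inv (q ^ℚ e)) (h ((2 ℕ.* k) ≤ᵇ n))
      ≈⟨ scale-scale (ℕ→ℚ (a F n k λs)) (inv (q ^ℚ e)) (h ((2 ℕ.* k) ≤ᵇ n)) ⟨
    scale (ℕ→ℚ (a F n k λs)) (scale (inv (q ^ℚ e)) (h ((2 ℕ.* k) ≤ᵇ n)))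
      ≈⟨ scale-cong (ℕ→ℚ (a F n k λs)) (≋-trans (scale≋constP-⊗ (inv (q ^ℚ e)) (h ((2 ℕ.* k) ≤ᵇ n)))
           (⊗-cong (≋-trans (reflexive (cong constP (inv-^ q≢0 e))) (≋-sym (constP-^ (inv q) e))) (h≋ ((2 ℕ.* k) ≤ᵇ n)))) ⟩
    scale (ℕ→ℚ (a F n k λs)) (weight n k) ∎
    where
    e = k ℕ.* (n ℕ.∸ k)
    h : Bool → Poly
    h b = if b then hermite (inv q) (n ℕ.∸ 2 ℕ.* k) else []
    h≋ : ∀ b → h b ≋ (if b then H (n ℕ.∸ 2 ℕ.* k) else [])
    h≋ true  = hermite≋H (n ℕ.∸ 2 ℕ.* k)
    h≋ false = ≋-refl

  module _ (λs : List ℕ) where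
    private
      bs = starts 0 λs
      n = length bs
      Xs = allFuns (allFuns elements n) n

    counted : ℕ → Matrix F n → Bool
    counted k X = inNilradical F λs X ∧ isZeroM F (mulM F X X) ∧ (rank F X ≡ᵇ k)

    contribution : Vec (Vec K n) n → Poly
    contribution Y = P∑.when (admissibles? [] bs Y) (weight n (rk (toList Y)))

    -- For an admissible matrix only the k equal to its rank survives, and the rank is at most n,
    -- hence within the range of summation.
    ∑-ranks : ∀ X → P∑.∑ (upTo (suc n)) (λ k → P∑.when (T? (counted k X)) (weight n k)) ≋ contribution (columns X)
    ∑-ranks X = by-decision (admissibles? [] bs (columns X))
      where
      by-decision : (d : Dec (Admissibles [] bs (columns X))) →
        P∑.∑ (upTo (suc n)) (λ k → P∑.when (T? (counted k X)) (weight n k)) ≋ P∑.when d (weight n (rk (toList (columns X))))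
      by-decision (yes adm) = ≋-trans
        (P∑.∑-single (λ k → P∑.when (T? (counted k X)) (weight n k)) (Uniqueₚ.upTo⁺ (suc n))
          (∈-upTo⁺ (ℕ.s≤s (ℕₚ.≤-trans (rk≤length (toList (columns X))) (ℕₚ.≤-reflexive (Vₚ.length-toList (columns X))))))
          (λ {k} _ k≢r → P∑.when-no (T? (counted k X)) (λ t → k≢r (sym (trans (sym (rank-columns X)) (rank≡ k t))))))
        (P∑.when-yes (T? (counted r X)) (T-∧⁺ (inNilradical F λs X) (proj₁ sq) (T-∧⁺ (isZeroM F (mulM F X X)) (proj₂ sq)
          (ℕₚ.≡⇒≡ᵇ (rank F X) r (rank-columns X)))))
        where
        r = rk (toList (columns X))
        sq = Admissibles⇒SquareZero λs X adm
        rank≡ : ∀ k → T (counted k X) → rank F X ≡ k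
        rank≡ k t = ℕₚ.≡ᵇ⇒≡ (rank F X) k (proj₂ (T-∧⁻ (isZeroM F (mulM F X X)) (proj₂ (T-∧⁻ (inNilradical F λs X) t))))
      by-decision (no ¬adm) = P∑.∑-zero (upTo (suc n)) (λ {k} _ → P∑.when-no (T? (counted k X)) (λ t →
        let nil , t′ = T-∧⁻ (inNilradical F λs X) t in
        ¬adm (SquareZero⇒Admissibles λs X (nil , proj₁ (T-∧⁻ (isZeroM F (mulM F X X)) t′)))))

    ∑-summand : P∑.∑ (upTo (suc n)) (summand n λs) ≋ prodP (map H λs)
    ∑-summand = begin
      P∑.∑ (upTo (suc n)) (summand n λs)
        ≈⟨ P∑.∑-cong′ (upTo (suc n)) (λ k → ≋-trans (summand≋weight n λs k) (scale-count (λ X → T? (counted k X)) Xs (weight n k))) ⟩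
      P∑.∑ (upTo (suc n)) (λ k → P∑.∑ Xs (λ X → P∑.when (T? (counted k X)) (weight n k)))
        ≈⟨ P∑.∑-swap (upTo (suc n)) Xs _ ⟩
      P∑.∑ Xs (λ X → P∑.∑ (upTo (suc n)) (λ k → P∑.when (T? (counted k X)) (weight n k)))
        ≈⟨ P∑.∑-cong′ Xs ∑-ranks ⟩
      P∑.∑ Xs (contribution ∘ columns)
        ≈⟨ P∑.∑-map columns Xs contribution ⟨
      P∑.∑ (map columns Xs) contribution
        ≈⟨ P∑.∑-↭ contribution (columns-allFuns n) ⟩
      P∑.∑ (allVecs (vecs n) n) contribution
        ≈⟨ ∑-Admissibles (constP q) p 2W q*p≋1 q≋order (weight n) bs [] ⟩
      columnSum (constP q) p 2W q*p≋1 q≋order (weight n) [] bs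
        ≈⟨ columnSum-starts (constP q) p 2W q*p≋1 q≋order λs [] (sym (length-starts λs 0)) [] ⟩
      -- The construction starts from the empty corner of size and rank zero, whose weight φ_0(0) is
      -- 1.
      weight 0 0 ⊗ prodP (map H λs)
        ≈⟨ *-congʳ {prodP (map H λs)} (⊗-identityˡ (constP 1ℚ)) ⟩
      constP 1ℚ ⊗ prodP (map H λs)
        ≈⟨ ⊗-identityˡ (prodP (map H λs)) ⟩
      prodP (map H λs) ∎

ℕ→ℚ-^-1≢0 : ∀ {m} → 1 < m → ∀ r → ℕ→ℚ m ^ℚ suc r ℚ.- 1ℚ ≢ 0ℚ
ℕ→ℚ-^-1≢0 {m} 1<m r eq = case ℕₚ.m^n≡1⇒n≡0∨m≡1 m (suc r)
  (ℕ→ℚ-injective {m ℕ.^ suc r} {1} (trans (sym (ℕ→ℚ-^ m (suc r))) (x-1≡0⇒x≡1 eq))) of λ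
  { (inj₂ m≡1) → ℕₚ.<⇒≢ 1<m (sym m≡1) }

theorem2p8 : (F : FiniteField) (n : ℕ) (λs : List ℕ) → IsPartition λs n →
    lhs F n λs ≈ₚ rhs F n λs
theorem2p8 F n λs part = at (≡.subst (λ n → lhs F n λs ≋ rhs F n λs) sum≡n
  (≋-trans lhs≋ (≋-sym (Normalisation.scaled-cycleIndices (qℚ F) q≢0 q^-1≢0 λs))))
  where
  open LinearAlgebra F using (order; order>1)
  sum≡n : sumℕ λs ≡ n
  sum≡n = proj₂ (proj₂ (partition-elim {n} λs part))
  q≢0 : qℚ F ≢ 0ℚ
  q≢0 eq = ℕₚ.<⇒≢ (ℕₚ.<-trans (ℕ.s≤s ℕ.z≤n) order>1) (sym (ℕ→ℚ-injective {order} {0} eq))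
  q^-1≢0 : ∀ r → qℚ F ^ℚ suc r ℚ.- 1ℚ ≢ 0ℚ
  q^-1≢0 = ℕ→ℚ-^-1≢0 order>1
  lhs≋ : lhs F (sumℕ λs) λs ≋ prodP (map (HermiteSide.H F (qℚ F) refl q≢0 q^-1≢0) λs)
  lhs≋ = ≡.subst (λ n → lhs F n λs ≋ prodP (map (HermiteSide.H F (qℚ F) refl q≢0 q^-1≢0) λs)) (length-starts λs 0)
    (HermiteSide.∑-summand F (qℚ F) refl q≢0 q^-1≢0 λs)
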